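{- Let $w$ be an annular web of degree $n$. For every hook partition $\lambda=(k,1^{n-k})\vdash n$, the coefficient of the Schur function $s_\lambda$ in the Schur expansion of the chromatic symmetric function $X_w$ is $$[s_\lambda]X_w=\sum_{T\in\mathcal T_\lambda(w)}q^{\mathrm{inv}_w(T)}\in\mathbb Z_{\ge0}[q^{\pm1}],$$ where $\mathcal T_\lambda(w)$ is the set of $w$-tableaux of shape $\lambda$.
   Context: **Annular webs.** Let $\mathbb A=[0,1]\times[0,1]/\big((x,0)\sim(x,1)\big)$ be the annulus, with $H_1(\mathbb A;\mathbb Z)\cong\mathbb Z$ normalized so that an upward vertical circle represents $+1$ (the class of an oriented circle is its winding number); left/right refer to the first coordinate, upward to the second. An annular web $w$ is a finite trivalent graph embedded in $\mathbb A$ (vertex-free essential circles are allowed as edges), all of whose edges are oriented upward (the second coordinate increases along each edge), together with a thickness $t(e)\in\mathbb Z_{>0}$ for each edge $e$, such that at every vertex the total incoming thickness equals the total outgoing thickness. Every vertex is a merge (two incoming edges, one outgoing) or a split (one incoming, two outgoing). The degree $\deg(w)$ is $\sum t(e)$ over the edges crossed by any radial (horizontal) segment transverse to $w$ and avoiding vertices. **Colorings and $X_w$.** Let $\mathbb N=\{1,2,\dots\}$. A coloring $c$ of $w$ assigns to each edge $e$ a finite set $c(e)\subset\mathbb N$ with $|c(e)|=t(e)$ such that at every vertex the union of the color sets on incoming edges equals the union on outgoing edges; $\mathcal C(w)$ is the set of colorings. For finite $A,B\subset\mathbb N$, $\mathrm{inv}(A,B)=\sum_{a\in A,b\in B}\mathrm{sgn}(a-b)$.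 Put $\mathrm{inv}_w(c)=\sum_m\mathrm{inv}(c(e_R),c(e_L))$ over all merges $m$, where $e_L,e_R$ are the left and right incoming edges of $m$. $\Gamma_i(c)$ is the union of edges $e$ with $i\in c(e)$ (a disjoint union of circles), $x^c=\prod_ix_i^{|\Gamma_i(c)|}$ with $|\cdot|$ the number of components, and $X_w=\sum_{c\in\mathcal C(w)}q^{\mathrm{inv}_w(c)}x^c$, which is a symmetric function, homogeneous of degree $\deg(w)$. **$w$-arrays.** A loop in $w$ is a union of edges forming a circle oriented consistently with the edges. For loops $L_1,L_2$, write $L_1\prec L_2$ if $L_2$ lies in the right-hand region of the complement of $L_1$ (in particular they are disjoint). A loop decomposition of $w$ is a multiset of loops such that each edge $e$ is contained in exactly $t(e)$ of them (with multiplicity). For a weak composition $\alpha$ of $n=\deg(w)$ (a finite sequence of nonnegative integers with sum $n$), a $w$-array $T$ of shape $\alpha$ assigns a loop $T_{i,j}$ to each box $(i,j)$, $1\le j\le\alpha_i$, so that the multiset of assigned loops is a loop decomposition of $w$ and $T_{i,1}\prec T_{i,2}\prec\cdots\prec T_{i,\alpha_i}$ in each row $i$. $T$ determines a coloring $c$ by $c(e)=\{i: e\text{ is contained in a loop in row }i\text{ of }T\}$, and $\mathrm{inv}_w(T):=\mathrm{inv}_w(c)$. **The operation $\mathrm{SW}_{(i,j)}$.** A cell $(i,j)$ with $i>1$ is admissible if $1\le j\le\min(\alpha_i,\alpha_{i-1}+1)$. For such a cell let $A=\bigsqcup_{k\ge j}T_{i-1,k}$ and $B=\bigsqcup_{k>j}T_{i,k}$.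 Let $\Gamma_{A,B}$ be the union of edges belonging to exactly one of $A,B$, with $B$-edges keeping their orientation and $A$-edges reversed; it is a disjoint union of oriented circles. Let $\Gamma^*_{A,B}$ be the union of its components with nonzero winding number. Regard edges of $A$ as colored $i-1$ and edges of $B$ as colored $i$, and swap the colors $i-1$ and $i$ along $\Gamma^*_{A,B}$; let $A'$ be the resulting family of loops of color $i$ and $B'$ the resulting family of loops of color $i-1$ (edges in both $A$ and $B$ lie in both $A'$ and $B'$). Then $|A'|=|A|$, $|B'|=|B|$ as numbers of loops. $\mathrm{SW}_{(i,j)}(T)$ is obtained from $T$ by replacing row $i-1$ by $T_{i-1,1},\dots,T_{i-1,j-1}$ followed by the loops of $B'$ in $\prec$-order, and row $i$ by $T_{i,1},\dots,T_{i,j}$ followed by the loops of $A'$ in $\prec$-order. It has shape $(\dots,\alpha_{i-2},\alpha_i-1,\alpha_{i-1}+1,\alpha_{i+1},\dots)$ but need not be a $w$-array (the row-order condition may fail). **$w$-tableaux.** $T$ is invertible at an admissible cell $(i,j)$ if $\mathrm{SW}_{(i,j)}(T)$ is again a $w$-array; $T$ is invertible if it is invertible at some admissible cell. A $w$-tableau is a $w$-array that is not invertible. -}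

module Defs where

open import Data.Bool using (true; false)
import Data.Bool.Properties as Bool
open import Data.Fin using (Fin; toℕ)
import Data.Fin as Fin
import Data.Fin.Properties as Fin
open import Data.Fin.Subset using (Subset; _∈_; _∪_; _∩_; _─_; ⋃; ⁅_⁆; ∣_∣)
open import Data.Fin.Subset.Properties using (_∈?_)
open import Data.Integer using (ℤ; +_; -[1+_]; +[1+_]; 0ℤ; 1ℤ; -1ℤ; _⊖_)
import Data.Integer as ℤ
open import Data.List
  using (List; []; _∷_; _++_; map; concat; concatMap; filter; length; lookup; foldr;
         replicate; take; drop; zip; upTo; allFin; cartesianProductWith; deduplicate)
open import Data.List.Relation.Binary.Permutation.Propositional using (_↭_)
open import Data.List.Relation.Unary.All using (All; all?)
open import Data.List.Relation.Unary.Any using (Any; any?)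
open import Data.List.Relation.Unary.Linked using (Linked; linked?)
open import Data.Nat.ListAction using (sum)
open import Data.Nat using (ℕ; zero; suc; _+_; _∸_; _⊓_; _≤_; _≥_; _<_; _≤?_; _≥?_; _<?_)
import Data.Nat as ℕ
open import Data.Product using (_×_; _,_; proj₁; proj₂; uncurry; map₁; map₂)
open import Data.Vec using (Vec; []; _∷_; tabulate; toList)
import Data.Vec as Vec
import Data.Vec.Properties as Vec
open import Relation.Binary.Construct.Closure.ReflexiveTransitive using (Star; ε; _◅_)
open import Relation.Binary.PropositionalEquality using (_≡_)
open import Relation.Nullary using (Dec; does; yes; no; ¬_)
open import Relation.Nullary.Decidable using (_×-dec_; _→-dec_; ¬?)

private variable
  E : Set
  m n N : ℕ

vecs : List E → (n : ℕ) → List (Vec E n)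
vecs xs zero    = [] ∷ []
vecs xs (suc n) = cartesianProductWith _∷_ xs (vecs xs n)

subsets : (n : ℕ) → List (Subset n)
subsets = vecs (true ∷ false ∷ [])

elements : Subset n → List (Fin n)
elements p = filter (_∈? p) (allFin _)

fromList : List (Fin n) → Subset n
fromList es = ⋃ (map ⁅_⁆ es)

-- The fillings of the boxes of a diagram with the given row lengths by
-- members of a list; a filling is given by its list of rows.
fillings : List E → List ℕ → List (List (List E))
fillings xs []       = [] ∷ []
fillings xs (k ∷ ks) = cartesianProductWith _∷_ (map toList (vecs xs k)) (fillings xs ks)

sumℤ : List ℤ → ℤ
sumℤ = foldr ℤ._+_ 0ℤ

-- An element of ℤ[q, q⁻¹] is a list of terms (d , z), standing for z q^d;
-- exponents may repeat, so polynomials are compared by _≈_.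
Laurent : Set
Laurent = List (ℤ × ℤ)

coeff : Laurent → ℤ → ℤ
coeff p d = sumℤ (map proj₂ (filter (λ term → proj₁ term ℤ.≟ d) p))

infix 4 _≈_
_≈_ : Laurent → Laurent → Set
p ≈ p′ = ∀ d → coeff p d ≡ coeff p′ d

q^_ : ℤ → Laurent
q^ d = (d , 1ℤ) ∷ []

Σ[_]_ : List E → (E → Laurent) → Laurent
Σ[ xs ] f = concatMap f xs

_·_ : ℕ → Laurent → Laurent
k · p = map (map₂ (+ k ℤ.*_)) p

-- A formal power series in x₁, x₂, … is given by its coefficients; the
-- list α = α₁, …, α_N stands for the monomial x₁^α₁ ⋯ x_N^α_N. The
-- variable x_{i+1}, or the colour i+1, is represented by i : Fin N.

IsPartition : ℕ → List ℕ → Set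
IsPartition n μ = Linked _≥_ μ × All (0 <_) μ × sum μ ≡ n

isPartition? : ∀ n μ → Dec (IsPartition n μ)
isPartition? n μ = linked? _≥?_ μ ×-dec all? (0 <?_) μ ×-dec sum μ ℕ.≟ n

partitions : ℕ → List (List ℕ)
partitions n = filter (isPartition? n)
  (concatMap (λ k → map toList (vecs (upTo (suc n)) k)) (upTo (suc n)))

-- zip truncates to the lower of two consecutive rows, which is no longer
-- than the upper one when the shape is a partition.
IsSemistandard : List (List (Fin N)) → Set
IsSemistandard T =
  All (Linked Fin._≤_) T × Linked (λ R R′ → All (uncurry Fin._<_) (zip R R′)) T

isSemistandard? : (T : List (List (Fin N))) → Dec (IsSemistandard T)
isSemistandard? T =
  all? (linked? Fin._≤?_) T ×-dec
  linked? (λ R R′ → all? (λ ab → proj₁ ab Fin.<? proj₂ ab) (zip R R′)) T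

HasContent : (α : List ℕ) → List (List (Fin (length α))) → Set
HasContent α T = ∀ i → length (filter (i Fin.≟_) (concat T)) ≡ lookup α i

hasContent? : ∀ α T → Dec (HasContent α T)
hasContent? α T = Fin.all? (λ i → length (filter (i Fin.≟_) (concat T)) ℕ.≟ lookup α i)

-- The coefficient of x^α in s_μ.
schur : List ℕ → List ℕ → ℕ
schur μ α = length
  (filter (λ T → isSemistandard? T ×-dec hasContent? α T)
          (fillings (allFin (length α)) μ))

-- f = Σ_{μ ⊢ n} a_μ s_μ; the values of a outside the partitions of n are
-- irrelevant.
IsSchurExpansion : ℕ → (f : List ℕ → Laurent) → (a : List ℕ → Laurent) → Set
IsSchurExpansion n f a = ∀ α → f α ≈ Σ[ partitions n ] (λ μ → schur μ α · a μ)

hook : ℕ → ℕ → List ℕ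
hook k n = k ∷ replicate (n ∸ k) 1

-- Cut the annulus along a horizontal segment avoiding the vertices, after
-- an isotopy placing the vertices at distinct heights. Every arc of the
-- resulting web in a strip is monotone, so the web is recorded by the
-- left-to-right words of arcs met by horizontal segments between
-- consecutive vertices. Each vertex rewrites one word into the next one.
data Slice (t : Fin m → ℕ) : List (Fin m) → List (Fin m) → Set where
  merge : ∀ {l r e es} → t l + t r ≡ t e → Slice t (l ∷ r ∷ es) (e ∷ es)
  split : ∀ {e l r es} → t e ≡ t l + t r → Slice t (e ∷ es) (l ∷ r ∷ es)
  skip  : ∀ {e es es′} → Slice t es es′ → Slice t (e ∷ es) (e ∷ es′)

-- The points where arcs meet. Besides the vertices these are the points of
-- the cut, where an arc reaching the top continues as one leaving the
-- bottom. An edge of the web crossing the cut thus consists of several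
-- arcs.
data Junction (m : ℕ) : Set where
  merge : (l r e : Fin m) → Junction m
  split : (e l r : Fin m) → Junction m
  glue  : (e e′ : Fin m) → Junction m

ins outs ends : Junction m → List (Fin m)
ins (merge l r e) = l ∷ r ∷ []
ins (split e l r) = e ∷ []
ins (glue e e′)   = e ∷ []
outs (merge l r e) = e ∷ []
outs (split e l r) = l ∷ r ∷ []
outs (glue e e′)   = e′ ∷ []
ends j = ins j ++ outs j

module _ {t : Fin m → ℕ} where

  vertex : ∀ {es es′} → Slice t es es′ → Junction m
  vertex (merge {l} {r} {e} _) = merge l r e
  vertex (split {e} {l} {r} _) = split e l r
  vertex (skip s)              = vertex s

  vertices : ∀ {es es′} → Star (Slice t) es es′ → List (Junction m)
  vertices ε        = []
  vertices (s ◅ ss) = vertex s ∷ vertices ss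

  words : ∀ {es es′} → Star (Slice t) es es′ → List (List (Fin m))
  words {es} ε        = es ∷ []
  words {es} (s ◅ ss) = es ∷ words ss

sgn : ℤ → ℤ
sgn +[1+ _ ] = 1ℤ
sgn (+ 0)    = 0ℤ
sgn -[1+ _ ] = -1ℤ

inv : Subset N → Subset N → ℤ
inv A B = sumℤ (cartesianProductWith (λ a b → sgn (toℕ a ⊖ toℕ b)) (elements A) (elements B))

record Web : Set where
  field
    arcs       : ℕ
    thickness  : Fin arcs → ℕ
    positive   : ∀ e → 0 < thickness e
    bottom top : List (Fin arcs)
    slices     : Star (Slice thickness) bottom top
    closed     : map thickness top ≡ map thickness bottom
    -- each name of an arc is given to exactly one arc
    born       : bottom ++ concatMap outs (vertices slices) ↭ allFin arcs

  junctions : List (Junction arcs)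
  junctions = vertices slices ++ map (uncurry glue) (zip top bottom)

  degree : ℕ
  degree = sum (map thickness bottom)

module _ (w : Web) where
  open Web w

  grow : Subset arcs → Subset arcs → Subset arcs
  grow Γ C = C ∪ (Γ ∩ fromList (concatMap ends (filter (λ j → any? (_∈? C) (ends j)) junctions)))

  -- A component has at most  arcs  arcs, so  arcs  rounds exhaust it.
  component : Subset arcs → Fin arcs → Subset arcs
  component Γ e = go arcs ⁅ e ⁆
    where
    go : ℕ → Subset arcs → Subset arcs
    go zero    C = C
    go (suc k) C = go k (grow Γ C)

  components : Subset arcs → List (Subset arcs)
  components Γ = deduplicate (Vec.≡-dec Bool._≟_) (map (component Γ) (elements Γ))

  Coloring : ℕ → Set
  Coloring N = Vec (Subset N) arcs

  IsColoring : Coloring N → Set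
  IsColoring c =
    (∀ e → ∣ Vec.lookup c e ∣ ≡ thickness e) ×
    All (λ j → ⋃ (map (Vec.lookup c) (ins j)) ≡ ⋃ (map (Vec.lookup c) (outs j))) junctions

  isColoring? : (c : Coloring N) → Dec (IsColoring c)
  isColoring? c =
    Fin.all? (λ e → ∣ Vec.lookup c e ∣ ℕ.≟ thickness e) ×-dec
    all? (λ j → Vec.≡-dec Bool._≟_ (⋃ (map (Vec.lookup c) (ins j)))
                                   (⋃ (map (Vec.lookup c) (outs j)))) junctions

  invAt : Coloring N → Junction arcs → ℤ
  invAt c (merge l r _) = inv (Vec.lookup c r) (Vec.lookup c l)
  invAt c (split _ _ _) = 0ℤ
  invAt c (glue _ _)    = 0ℤ

  inv-w : Coloring N → ℤ
  inv-w c = sumℤ (map (invAt c) junctions)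

  Γ : Coloring N → Fin N → Subset arcs
  Γ c i = tabulate (λ e → Vec.lookup (Vec.lookup c e) i)

  HasWeight : (α : List ℕ) → Coloring (length α) → Set
  HasWeight α c = ∀ i → length (components (Γ c i)) ≡ lookup α i

  hasWeight? : ∀ α c → Dec (HasWeight α c)
  hasWeight? α c = Fin.all? (λ i → length (components (Γ c i)) ℕ.≟ lookup α i)

  -- The coefficient of x^α in X_w. A colour used by c occurs in x^c with
  -- positive exponent, so x^c = x^α forces c to use colours 1, …, N only,
  -- where N = length α.
  X : List ℕ → Laurent
  X α = Σ[ filter (λ c → isColoring? c ×-dec hasWeight? α c) (vecs (subsets (length α)) arcs) ]
          (λ c → q^ inv-w c)

  Loop : Set
  Loop = Subset arcs

  -- L is one circle, which passes through each junction at most once, and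
  -- then from an incoming to an outgoing arc.
  IsLoop : Loop → Set
  IsLoop L =
    length (components L) ≡ 1 ×
    All (λ j → length (filter (_∈? L) (ins j)) ≡ length (filter (_∈? L) (outs j)) ×
               length (filter (_∈? L) (ins j)) ≤ 1) junctions

  isLoop? : ∀ L → Dec (IsLoop L)
  isLoop? L =
    length (components L) ℕ.≟ 1 ×-dec
    all? (λ j → length (filter (_∈? L) (ins j)) ℕ.≟ length (filter (_∈? L) (outs j)) ×-dec
                length (filter (_∈? L) (ins j)) ≤? 1) junctions

  -- A loop is monotone and meets every horizontal segment once, so its
  -- right-hand region consists of the points to its right at each height.
  infix 4 _≺_ _≺?_
  _≺_ : Loop → Loop → Set
  L₁ ≺ L₂ = All (λ es → ∀ i j → lookup es i ∈ L₁ → lookup es j ∈ L₂ → i Fin.< j) (words slices)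

  _≺?_ : ∀ L₁ L₂ → Dec (L₁ ≺ L₂)
  L₁ ≺? L₂ = all? (λ es → Fin.all? λ i → Fin.all? λ j →
    (lookup es i ∈? L₁) →-dec (lookup es j ∈? L₂) →-dec (i Fin.<? j)) (words slices)

  insert : Loop → List Loop → List Loop
  insert L []        = L ∷ []
  insert L (L′ ∷ Ls) with L ≺? L′
  ... | yes _ = L ∷ L′ ∷ Ls
  ... | no  _ = L′ ∷ insert L Ls

  ≺-sort : List Loop → List Loop
  ≺-sort = foldr insert []

  -- The list of rows of an assignment of sets of arcs to the boxes of the
  -- diagram of a weak composition.
  Array : Set
  Array = List (List Loop)

  IsArray : Array → Set
  IsArray T =
    All (All IsLoop) T ×
    (∀ e → length (filter (e ∈?_) (concat T)) ≡ thickness e) ×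
    All (Linked _≺_) T

  isArray? : ∀ T → Dec (IsArray T)
  isArray? T =
    all? (all? isLoop?) T ×-dec
    Fin.all? (λ e → length (filter (e ∈?_) (concat T)) ℕ.≟ thickness e) ×-dec
    all? (linked? _≺?_) T

  coloring : (T : Array) → Coloring (length T)
  coloring T = tabulate λ e → tabulate λ i → does (any? (e ∈?_) (lookup T i))

  invT : Array → ℤ
  invT T = inv-w (coloring T)

  -- The class in H₁ of the annulus of a component C of Γ_{A,B}, obtained
  -- as its intersection number with the cut. Arcs of B are oriented
  -- upward, those of A, which are the arcs of C outside B, downward.
  winding : (B C : Subset arcs) → ℤ
  winding B C = + length (filter (_∈? (C ∩ B)) bottom) ℤ.- + length (filter (_∈? (C ─ B)) bottom)

  Γ* : (A B : Subset arcs) → Subset arcs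
  Γ* A B = ⋃ (filter (λ C → ¬? (winding B C ℤ.≟ 0ℤ)) (components ((A ─ B) ∪ (B ─ A))))

  -- The arcs carrying the colour of A after swapping the colours of A and B
  -- along Γ*.
  swapped : (A B : Subset arcs) → Subset arcs
  swapped A B = (A ─ Γ* A B) ∪ (B ∩ Γ* A B)

  swapped′ : (A B : Subset arcs) → Subset arcs
  swapped′ A B = (B ─ Γ* A B) ∪ (A ∩ Γ* A B)

  -- Indices start from 0: SW i j is SW_{(i+2,j+1)}, acting on the rows
  -- P = T_{i+1} and R = T_{i+2}.
  SW : (i j : ℕ) → Array → Array
  SW zero    j (P ∷ R ∷ T) =
    (take j P ++ ≺-sort (components (swapped A B))) ∷
    (take (suc j) R ++ ≺-sort (components (swapped′ A B))) ∷ T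
    where
    A = ⋃ (drop j P)
    B = ⋃ (drop (suc j) R)
  SW (suc i) j (P ∷ T)     = P ∷ SW i j T
  SW _       _ T           = T

  -- The pairs (i , j) with (i+2,j+1) an admissible cell.
  admissible : Array → List (ℕ × ℕ)
  admissible (P ∷ R ∷ T) =
    map (0 ,_) (upTo (length R ⊓ suc (length P))) ++ map (map₁ suc) (admissible (R ∷ T))
  admissible _           = []

  Invertible : Array → Set
  Invertible T = Any (λ ij → IsArray (uncurry SW ij T)) (admissible T)

  invertible? : ∀ T → Dec (Invertible T)
  invertible? T = any? (λ ij → isArray? (uncurry SW ij T)) (admissible T)

  IsTableau : Array → Set
  IsTableau T = IsArray T × ¬ Invertible T

  isTableau? : ∀ T → Dec (IsTableau T)
  isTableau? T = isArray? T ×-dec ¬? (invertible? T)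

  tableaux : List ℕ → List Array
  tableaux α = filter isTableau? (fillings (subsets arcs) α)

-- By Jacobi–Trudi, the coefficient of s_λ in f, for the hook λ = (k , 1^j), is a
-- signed sum of the coefficients of x^α in f, where α runs over the compositions
-- obtained by cutting a word of length k + j at some of the last j gaps, with a
-- sign for each gap that is not cut. In X_w the coefficient of x^α counts the
-- w-arrays of shape α: the loops of a colour class are totally ordered by ≺, since
-- strands keep their order from left to right. Reading the rows from right to
-- left turns an array into a word of loops cut into rows. Whether its loops
-- decompose w and, as loops in one row are disjoint, also its weight depend on
-- the word only. So inclusion–exclusion leaves the words whose first k letters
-- form a row and in which no later letter may join the row before it. At a cell of
-- an array of shape λ, SW moves the whole row above behind a single loop, and
-- therefore the words that are left are precisely the w-tableaux.
--
-- That the signed sum extracts the coefficient of s_λ follows in the same way.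
-- Transposing its matrix of multiplicities turns a semistandard tableau of shape μ
-- into a lattice word with content μ, and only the word 0 ⋯ 0 1 2 ⋯ j is left.

module Submission where

open import Defs
open import Data.Bool using (Bool; true; false; if_then_else_; _∧_; _∨_)
import Data.Bool.Properties as Bool
open import Data.Empty using (⊥-elim)
open import Data.Fin using (Fin; zero; suc; toℕ)
import Data.Fin as Fin
import Data.Fin.Properties as Fin
open import Data.Fin.Subset using (Subset; _∈_; _∉_; _⊆_; _∪_; _∩_; _─_; ⋃; ⁅_⁆; ∣_∣)
import Data.Fin.Subset as Subset
open import Data.Fin.Subset.Properties using (_∈?_; _⊂?_)
import Data.Fin.Subset.Properties as Subset
open import Data.Integer using (ℤ; +_; 0ℤ; 1ℤ; -1ℤ; _⊖_) renaming (_≤_ to _≤ℤ_)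
import Data.Integer as ℤ hiding (+_)
import Data.Integer.Properties as ℤ
open import Data.Integer.Tactic.RingSolver using (solve-∀)
open import Data.List
  using (List; []; _∷_; _++_; map; concat; concatMap; filter; length; lookup; replicate;
         tabulate; zip; allFin; upTo; cartesianProductWith)
import Data.List.Properties as List
import Data.List.Membership.DecPropositional
open import Data.List.Membership.Propositional using (find; lose) renaming (_∈_ to _∈ₗ_; _∉_ to _∉ₗ_)
import Data.List.Membership.Propositional.Properties as ∈ₗ
open import Data.List.Membership.Propositional.Properties.WithK using (unique∧set⇒bag)
open import Data.List.Relation.Binary.BagAndSetEquality using (∼bag⇒↭)
open import Data.List.Relation.Binary.Disjoint.Propositional using (Disjoint)
open import Data.List.Relation.Binary.Permutation.Propositional as ↭ using (_↭_; ↭-sym; ↭-trans)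
import Data.List.Relation.Binary.Permutation.Propositional.Properties as ↭
import Data.List.Relation.Binary.Permutation.Setoid.Properties as ↭ₛ
open import Data.List.Relation.Unary.All as All using (All; []; _∷_; all?)
import Data.List.Relation.Unary.All.Properties as All
open import Data.List.Relation.Unary.AllPairs as AllPairs using (AllPairs; []; _∷_)
import Data.List.Relation.Unary.AllPairs.Properties as AllPairs
open import Data.List.Relation.Unary.Any as Any using (Any; here; there; any?)
import Data.List.Relation.Unary.Any.Properties as AnyP
open import Data.List.Relation.Unary.Linked as Linked using (Linked; []; [-]; _∷_; linked?)
import Data.List.Relation.Unary.Linked.Properties as Linked
open import Data.List.Relation.Unary.Unique.DecPropositional.Properties using (deduplicate-!)
open import Data.List.Relation.Unary.Unique.Propositional using (Unique)
import Data.List.Relation.Unary.Unique.Propositional.Properties as Unique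
open import Data.Nat using (ℕ; zero; suc; _+_; _≤_; _<_; _≥_; z≤n; s≤s)
import Data.Nat as ℕ
import Data.Nat.Properties as ℕ
open import Data.Nat.ListAction using (sum)
open import Data.Product using (_×_; _,_; proj₁; proj₂; ∃; ∃₂; map₁; map₂; uncurry)
open import Data.Sum using (_⊎_; inj₁; inj₂; [_,_]′)
open import Data.Unit using (⊤; tt)
open import Data.Vec using (Vec; []; _∷_; toList)
import Data.Vec as Vec
import Data.Vec.Properties as Vec
open import Function using (_∘_; id; case_of_; _⇔_; mk⇔; Equivalence)
import Function.Construct.Composition as ⇔
open import Level using (0ℓ)
open import Relation.Binary using (Rel; tri<; tri≈; tri>)
import Relation.Binary as B
open import Relation.Binary.Construct.Closure.ReflexiveTransitive using (Star; ε; _◅_)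
open import Relation.Binary.PropositionalEquality
  using (_≡_; _≢_; refl; sym; trans; cong; cong₂; subst; subst₂; setoid; module ≡-Reasoning)
open import Relation.Nullary using (Dec; yes; no; ¬_; does; contradiction)
open import Relation.Nullary.Decidable using (_×-dec_; ¬?; _→-dec_; dec-true)
open import Relation.Unary using (Decidable)

-- The Schur expansion is a hypothesis, so its coefficient at the hook is reached by one linear
-- functional. Evaluating it on each `s_μ` and on `X_w` is the same problem, with rows increasing
-- for `≤` on colours or for `≺` on loops; `alternating-fillings` solves it for any relation,
-- provided the remaining factor depends on the word only.
--
-- For lattice words this holds because the smallest letter of a row is read last, so that cutting
-- it off changes no prefix. For inversions it holds because loops through one merge share its
-- outgoing arc: disjoint loops never meet there, and giving them one colour or two consecutive ones
-- makes no difference.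
--
-- Words run from right to left because `SW` puts the row above to the right of the single loop; a
-- gap is tested by asking whether the next loop lies left of the row before it.
--
-- The geometric obstacle is the cut: a strand might return to it in another position. A function
-- constant along strands takes the same sequence of values in every horizontal word, so numbering
-- the strands from the left at the bottom gives the same numbers at the top, and gluing position by
-- position is consistent.

private variable
  A B E : Set
  Φ Ψ : Set
  a b j k n r N t : ℕ

-- Finite sums and indicators

∑ : List A → (A → ℤ) → ℤ
∑ xs f = sumℤ (map f xs)

∑-cong : ∀ (xs : List A) {f g} → (∀ {x} → x ∈ₗ xs → f x ≡ g x) → ∑ xs f ≡ ∑ xs g
∑-cong []       eq = refl
∑-cong (x ∷ xs) eq = cong₂ ℤ._+_ (eq (here refl)) (∑-cong xs (eq ∘ there))

∑-cong′ : ∀ (xs : List A) {f g} → (∀ x → f x ≡ g x) → ∑ xs f ≡ ∑ xs g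
∑-cong′ xs eq = ∑-cong xs λ {x} _ → eq x

∑-++ : ∀ (xs ys : List A) f → ∑ (xs ++ ys) f ≡ ∑ xs f ℤ.+ ∑ ys f
∑-++ []       ys f = sym (ℤ.+-identityˡ _)
∑-++ (x ∷ xs) ys f = trans (cong₂ ℤ._+_ (refl {x = f x}) (∑-++ xs ys f)) (sym (ℤ.+-assoc (f x) _ _))

∑-map : ∀ (h : A → B) xs f → ∑ (map h xs) f ≡ ∑ xs (f ∘ h)
∑-map h xs f = cong sumℤ (sym (List.map-∘ xs))

∑-product : ∀ {C : Set} (h : A → B → C) xs ys f →
  ∑ (cartesianProductWith h xs ys) f ≡ ∑ xs λ x → ∑ ys λ y → f (h x y)
∑-product h []       ys f = refl
∑-product h (x ∷ xs) ys f = trans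
  (∑-++ (map (h x) ys) _ f)
  (cong₂ ℤ._+_ (∑-map (h x) ys f) (∑-product h xs ys f))

∑-zero : ∀ (xs : List A) → ∑ xs (λ _ → 0ℤ) ≡ 0ℤ
∑-zero []       = refl
∑-zero (_ ∷ xs) = trans (ℤ.+-identityˡ _) (∑-zero xs)

+-interchange : ∀ a b c d → (a ℤ.+ b) ℤ.+ (c ℤ.+ d) ≡ (a ℤ.+ c) ℤ.+ (b ℤ.+ d)
+-interchange a b c d = begin
  (a ℤ.+ b) ℤ.+ (c ℤ.+ d)  ≡⟨ ℤ.+-assoc a b _ ⟩
  a ℤ.+ (b ℤ.+ (c ℤ.+ d))  ≡⟨ cong₂ ℤ._+_ (refl {x = a}) (ℤ.+-assoc b c d) ⟨
  a ℤ.+ ((b ℤ.+ c) ℤ.+ d)  ≡⟨ cong (λ z → a ℤ.+ (z ℤ.+ d)) (ℤ.+-comm b c) ⟩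
  a ℤ.+ ((c ℤ.+ b) ℤ.+ d)  ≡⟨ cong₂ ℤ._+_ (refl {x = a}) (ℤ.+-assoc c b d) ⟩
  a ℤ.+ (c ℤ.+ (b ℤ.+ d))  ≡⟨ ℤ.+-assoc a c _ ⟨
  (a ℤ.+ c) ℤ.+ (b ℤ.+ d)  ∎
  where open ≡-Reasoning

∑-+ : ∀ (xs : List A) f g → ∑ xs (λ x → f x ℤ.+ g x) ≡ ∑ xs f ℤ.+ ∑ xs g
∑-+ []       f g = refl
∑-+ (x ∷ xs) f g = trans (cong₂ ℤ._+_ (refl {x = f x ℤ.+ g x}) (∑-+ xs f g)) (+-interchange (f x) (g x) _ _)

∑-*ˡ : ∀ (xs : List A) c f → ∑ xs (λ x → c ℤ.* f x) ≡ c ℤ.* ∑ xs f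
∑-*ˡ []       c f = sym (ℤ.*-zeroʳ c)
∑-*ˡ (x ∷ xs) c f = trans (cong₂ ℤ._+_ (refl {x = c ℤ.* f x}) (∑-*ˡ xs c f)) (sym (ℤ.*-distribˡ-+ c (f x) _))

∑-*ʳ : ∀ (xs : List A) c f → ∑ xs (λ x → f x ℤ.* c) ≡ ∑ xs f ℤ.* c
∑-*ʳ xs c f = begin
  ∑ xs (λ x → f x ℤ.* c)  ≡⟨ ∑-cong′ xs (λ x → ℤ.*-comm (f x) c) ⟩
  ∑ xs (λ x → c ℤ.* f x)  ≡⟨ ∑-*ˡ xs c f ⟩
  c ℤ.* ∑ xs f            ≡⟨ ℤ.*-comm c _ ⟩
  ∑ xs f ℤ.* c            ∎
  where open ≡-Reasoning

∑-swap : ∀ (xs : List A) (ys : List B) (f : A → B → ℤ) →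
  ∑ xs (λ x → ∑ ys (f x)) ≡ ∑ ys (λ y → ∑ xs (λ x → f x y))
∑-swap []       ys f = sym (∑-zero ys)
∑-swap (x ∷ xs) ys f = trans (cong₂ ℤ._+_ (refl {x = ∑ ys (f x)}) (∑-swap xs ys f)) (sym (∑-+ ys (f x) _))

∑-↭ : ∀ {xs ys : List A} → xs ↭ ys → ∀ f → ∑ xs f ≡ ∑ ys f
∑-↭ ↭.refl         f = refl
∑-↭ (↭.prep x p)   f = cong₂ ℤ._+_ (refl {x = f x}) (∑-↭ p f)
∑-↭ (↭.swap {xs} {ys} x y p) f = begin
  f x ℤ.+ (f y ℤ.+ ∑ xs f)  ≡⟨ ℤ.+-assoc (f x) (f y) _ ⟨
  (f x ℤ.+ f y) ℤ.+ ∑ xs f  ≡⟨ cong₂ ℤ._+_ (ℤ.+-comm (f x) (f y)) (∑-↭ p f) ⟩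
  (f y ℤ.+ f x) ℤ.+ ∑ ys f  ≡⟨ ℤ.+-assoc (f y) (f x) _ ⟩
  f y ℤ.+ (f x ℤ.+ ∑ ys f)  ∎
  where open ≡-Reasoning
∑-↭ (↭.trans p q)  f = trans (∑-↭ p f) (∑-↭ q f)

∑-single : ∀ {xs : List A} {x₀} {f} → Unique xs → x₀ ∈ₗ xs →
  (∀ {x} → x ∈ₗ xs → x ≢ x₀ → f x ≡ 0ℤ) → ∑ xs f ≡ f x₀
∑-single {xs = x ∷ xs} {f = f} (x∉ ∷ u) (here refl) f0 = begin
  f x ℤ.+ ∑ xs f           ≡⟨ cong₂ ℤ._+_ (refl {x = f x}) (∑-cong xs λ y∈ →
                                f0 (there y∈) λ { refl → All.lookup x∉ y∈ refl }) ⟩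
  f x ℤ.+ ∑ xs (λ _ → 0ℤ)  ≡⟨ cong₂ ℤ._+_ (refl {x = f x}) (∑-zero xs) ⟩
  f x ℤ.+ 0ℤ               ≡⟨ ℤ.+-identityʳ _ ⟩
  f x                      ∎
  where open ≡-Reasoning
∑-single {xs = x ∷ xs} {f = f} (x∉ ∷ u) (there i) f0 = begin
  f x ℤ.+ ∑ xs f  ≡⟨ cong₂ ℤ._+_ (f0 (here refl) λ { refl → All.lookup x∉ i refl })
                                 (∑-single u i (f0 ∘ there)) ⟩
  0ℤ ℤ.+ f _      ≡⟨ ℤ.+-identityˡ _ ⟩
  f _             ∎
  where open ≡-Reasoning

[_]? : Dec Φ → ℤ
[ P? ]? = if does P? then 1ℤ else 0ℤ

[]?-yes : (P? : Dec Φ) → Φ → [ P? ]? ≡ 1ℤ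
[]?-yes (yes _) _ = refl
[]?-yes (no ¬p) p = ⊥-elim (¬p p)

[]?-no : (P? : Dec Φ) → ¬ Φ → [ P? ]? ≡ 0ℤ
[]?-no (yes p) ¬p = ⊥-elim (¬p p)
[]?-no (no _)  _  = refl

[]?-cong : (P? : Dec Φ) (Q? : Dec Ψ) → Φ ⇔ Ψ → [ P? ]? ≡ [ Q? ]?
[]?-cong (yes p) Q? e = sym ([]?-yes Q? (Equivalence.to e p))
[]?-cong (no ¬p) Q? e = sym ([]?-no Q? (¬p ∘ Equivalence.from e))

[]?-× : (P? : Dec Φ) (Q? : Dec Ψ) → [ P? ×-dec Q? ]? ≡ [ P? ]? ℤ.* [ Q? ]?
[]?-× (yes _) (yes _) = refl
[]?-× (yes _) (no _)  = refl
[]?-× (no _)  (yes _) = refl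
[]?-× (no _)  (no _)  = refl

-- The factors are compared only where the indicator is 1, so row order may be assumed when lattice
-- conditions or inversion numbers are compared.
[]?-*-cong : (P? : Dec Φ) {x y : ℤ} → (Φ → x ≡ y) → [ P? ]? ℤ.* x ≡ [ P? ]? ℤ.* y
[]?-*-cong (yes p) e = cong₂ ℤ._*_ (refl {x = 1ℤ}) (e p)
[]?-*-cong (no _)  e = refl

∑-filter : ∀ {R : A → Set} (R? : Decidable R) xs f →
  ∑ (filter R? xs) f ≡ ∑ xs λ x → [ R? x ]? ℤ.* f x
∑-filter R? []       f = refl
∑-filter R? (x ∷ xs) f with R? x
... | yes _ = cong₂ ℤ._+_ (sym (ℤ.*-identityˡ (f x))) (∑-filter R? xs f)
... | no  _ = trans (∑-filter R? xs f) (sym (ℤ.+-identityˡ _))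

length-filter : ∀ {R : A → Set} (R? : Decidable R) xs →
  + length (filter R? xs) ≡ ∑ xs λ x → [ R? x ]?
length-filter R? []       = refl
length-filter R? (x ∷ xs) with R? x
... | yes _ = trans (ℤ.pos-+ 1 _) (cong₂ ℤ._+_ (refl {x = 1ℤ}) (length-filter R? xs))
... | no  _ = trans (length-filter R? xs) (sym (ℤ.+-identityˡ _))

sameElements⇒↭ : ∀ {xs ys : List A} → Unique xs → Unique ys →
  (∀ {x} → x ∈ₗ xs → x ∈ₗ ys) → (∀ {x} → x ∈ₗ ys → x ∈ₗ xs) → xs ↭ ys
sameElements⇒↭ u v to from = ∼bag⇒↭ (unique∧set⇒bag u v (mk⇔ to from))

unique-map : ∀ {xs : List A} (φ : A → B) → Unique xs →
  (∀ {x y} → x ∈ₗ xs → y ∈ₗ xs → φ x ≡ φ y → x ≡ y) → Unique (map φ xs)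
unique-map {xs = []}     φ []        inj = []
unique-map {xs = x ∷ xs} φ (x∉ ∷ u) inj =
  All.tabulate (λ y∈ e → case∈ (∈ₗ.∈-map⁻ φ y∈) e) ∷ unique-map φ u λ i j → inj (there i) (there j)
  where
  case∈ : ∀ {y} → (∃ λ z → z ∈ₗ xs × y ≡ φ z) → φ x ≢ y
  case∈ (z , z∈ , refl) e = All.lookup x∉ z∈ (inj (here refl) (there z∈) e)

-- Both lists are free of repetitions, so mutually inverse maps make one filtered list a permutation
-- of the image of the other. This carries the two bijections of the proof: tableaux with lattice
-- arrays, and arrays with colourings.
∑-bijection : ∀ {xs : List A} {ys : List B} {R : A → Set} {S : B → Set}
  (R? : Decidable R) (S? : Decidable S) (φ : A → B) (ψ : B → A) →
  Unique xs → Unique ys →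
  (∀ {x} → x ∈ₗ xs → R x → φ x ∈ₗ ys × S (φ x) × ψ (φ x) ≡ x) →
  (∀ {y} → y ∈ₗ ys → S y → ψ y ∈ₗ xs × R (ψ y) × φ (ψ y) ≡ y) →
  ∀ f → ∑ (filter S? ys) f ≡ ∑ (filter R? xs) (f ∘ φ)
∑-bijection {xs = xs} {ys} R? S? φ ψ u v to from f =
  trans (sym (∑-↭ perm f)) (∑-map φ (filter R? xs) f)
  where
  to′ : ∀ {x} → x ∈ₗ filter R? xs → φ x ∈ₗ ys × _ × ψ (φ x) ≡ x
  to′ i = let i′ , r = ∈ₗ.∈-filter⁻ R? {xs = xs} i in to i′ r
  image⊆ : ∀ {y} → (∃ λ x → x ∈ₗ filter R? xs × y ≡ φ x) → y ∈ₗ filter S? ys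
  image⊆ (x , i , refl) = let j , s , _ = to′ i in ∈ₗ.∈-filter⁺ S? j s
  ⊆image : ∀ {y} → y ∈ₗ ys × _ → y ∈ₗ map φ (filter R? xs)
  ⊆image (j , s) = let i , r , e = from j s in
    subst (_∈ₗ _) e (∈ₗ.∈-map⁺ φ (∈ₗ.∈-filter⁺ R? i r))
  perm : map φ (filter R? xs) ↭ filter S? ys
  perm = sameElements⇒↭
    (unique-map φ (Unique.filter⁺ R? u) λ i j e →
      trans (sym (proj₂ (proj₂ (to′ i)))) (trans (cong ψ e) (proj₂ (proj₂ (to′ j)))))
    (Unique.filter⁺ S? v)
    (image⊆ ∘ ∈ₗ.∈-map⁻ φ) (⊆image ∘ ∈ₗ.∈-filter⁻ S? {xs = ys})

-- Coefficients of Laurent polynomials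

coeff-++ : ∀ p p′ d → coeff (p ++ p′) d ≡ coeff p d ℤ.+ coeff p′ d
coeff-++ p p′ d = begin
  sumℤ (map proj₂ (filter _ (p ++ p′)))           ≡⟨ cong (λ z → ∑ z proj₂) (List.filter-++ _ p p′) ⟩
  ∑ (filter _ p ++ filter _ p′) proj₂             ≡⟨ ∑-++ (filter _ p) _ proj₂ ⟩
  coeff p d ℤ.+ coeff p′ d                        ∎
  where open ≡-Reasoning

coeff-Σ : ∀ (xs : List A) f d → coeff (Σ[ xs ] f) d ≡ ∑ xs λ x → coeff (f x) d
coeff-Σ []       f d = refl
coeff-Σ (x ∷ xs) f d = trans (coeff-++ (f x) _ d) (cong₂ ℤ._+_ (refl {x = coeff (f x) d}) (coeff-Σ xs f d))

coeff-· : ∀ k p d → coeff (k · p) d ≡ + k ℤ.* coeff p d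
coeff-· k []            d = sym (ℤ.*-zeroʳ (+ k))
coeff-· k ((e , z) ∷ p) d with does (e ℤ.≟ d)
... | true  = trans (cong₂ ℤ._+_ (refl {x = + k ℤ.* z}) (coeff-· k p d)) (sym (ℤ.*-distribˡ-+ (+ k) z _))
... | false = coeff-· k p d

coeff-q^-≥0 : ∀ e d → 0ℤ ℤ.≤ coeff (q^ e) d
coeff-q^-≥0 e d with does (e ℤ.≟ d)
... | true  = ℤ.+≤+ z≤n
... | false = ℤ.+≤+ z≤n

∑-≥0 : ∀ (xs : List A) {f} → (∀ x → 0ℤ ℤ.≤ f x) → 0ℤ ℤ.≤ ∑ xs f
∑-≥0 []       f≥0 = ℤ.≤-refl
∑-≥0 (x ∷ xs) f≥0 = ℤ.+-mono-≤ (f≥0 x) (∑-≥0 xs f≥0)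

-- Words cut into rows

∈-vecs : ∀ {xs : List E} → (∀ x → x ∈ₗ xs) → ∀ {n} (v : Vec E n) → v ∈ₗ vecs xs n
∈-vecs all []      = here refl
∈-vecs all (x ∷ v) = ∈ₗ.∈-cartesianProductWith⁺ _∷_ (all x) (∈-vecs all v)

∈-vecs⁺ : ∀ {xs : List E} {n} (v : Vec E n) → All (_∈ₗ xs) (toList v) → v ∈ₗ vecs xs n
∈-vecs⁺ []      []       = here refl
∈-vecs⁺ (x ∷ v) (i ∷ is) = ∈ₗ.∈-cartesianProductWith⁺ _∷_ i (∈-vecs⁺ v is)

unique-vecs : ∀ {xs : List E} → Unique xs → ∀ n → Unique (vecs xs n)
unique-vecs u zero    = [] ∷ []
unique-vecs u (suc n) = Unique.cartesianProductWith⁺ _∷_ Vec.∷-injective u (unique-vecs u n)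

unique-map-toList : ∀ {vs : List (Vec E k)} → Unique vs → Unique (map toList vs)
unique-map-toList = Unique.map⁺ λ {u} {v} e → trans (sym (Vec.cast-is-id refl u)) (Vec.toList-injective refl u v e)

∈-map-toList-vecs : ∀ {xs : List E} ys → All (_∈ₗ xs) ys → ys ∈ₗ map toList (vecs xs (length ys))
∈-map-toList-vecs {xs = xs} ys is = subst (_∈ₗ map toList (vecs xs (length ys))) (Vec.toList∘fromList ys)
  (∈ₗ.∈-map⁺ toList (∈-vecs⁺ (Vec.fromList ys) (subst (All (_∈ₗ xs)) (sym (Vec.toList∘fromList ys)) is)))

∈-fillings⁺ : ∀ {xs : List E} → (∀ x → x ∈ₗ xs) → ∀ T → T ∈ₗ fillings xs (map length T)
∈-fillings⁺ all []      = here refl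
∈-fillings⁺ all (R ∷ T) = ∈ₗ.∈-cartesianProductWith⁺ _∷_
  (∈-map-toList-vecs R (All.tabulate λ {x} _ → all x)) (∈-fillings⁺ all T)

∈-fillings⁻ : ∀ {xs : List E} ks {T} → T ∈ₗ fillings xs ks → map length T ≡ ks
∈-fillings⁻ []       (here refl) = refl
∈-fillings⁻ {xs = xs} (k ∷ ks) i
  with ∈ₗ.∈-cartesianProductWith⁻ _∷_ (map toList (vecs xs k)) (fillings xs ks) i
... | R , T , i′ , i″ , refl with ∈ₗ.∈-map⁻ toList {xs = vecs xs k} i′
...   | v , _ , e = cong₂ _∷_ (trans (cong length e) (Vec.length-toList v)) (∈-fillings⁻ ks i″)

unique-fillings : ∀ {xs : List E} → Unique xs → ∀ ks → Unique (fillings xs ks)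
unique-fillings u []       = [] ∷ []
unique-fillings u (k ∷ ks) = Unique.cartesianProductWith⁺ _∷_ List.∷-injective
  (unique-map-toList (unique-vecs u k)) (unique-fillings u ks)

-- A subset of the gaps of a word, coded by a vector of booleans, cuts the word
-- into rows. The first row is P extended to the left; true stands for a cut.
-- Rows are read from right to left, so that a letter is appended at the head.
rows : List E → Vec Bool j → Vec E j → List (List E)
rows P []          []      = P ∷ []
rows P (true ∷ b)  (x ∷ v) = P ∷ rows (x ∷ []) b v
rows P (false ∷ b) (x ∷ v) = rows (x ∷ P) b v

shape : ℕ → Vec Bool j → List ℕ
shape k []          = k ∷ []
shape k (true ∷ b)  = k ∷ shape 1 b
shape k (false ∷ b) = shape (suc k) b

bools : List Bool
bools = true ∷ false ∷ []

sign : Vec Bool j → ℤ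
sign []          = 1ℤ
sign (true ∷ b)  = sign b
sign (false ∷ b) = ℤ.- sign b

singletons : List E → Vec E j → List (List E)
singletons P v = P ∷ map (_∷ []) (toList v)

concat-rows : ∀ (P : List E) (b : Vec Bool j) v → concat (rows P b v) ↭ P ++ toList v
concat-rows P []          []      = ↭.refl
concat-rows P (true ∷ b)  (x ∷ v) = ↭.++⁺ˡ P (concat-rows (x ∷ []) b v)
concat-rows P (false ∷ b) (x ∷ v) =
  ↭-trans (concat-rows (x ∷ P) b v) (↭-sym (↭.shift x P (toList v)))

concat-singletons : ∀ (P : List E) (v : Vec E j) → concat (singletons P v) ≡ P ++ toList v
concat-singletons P v = cong (P ++_) (List.concat-map-[_] (toList v))

∑-fillings-∷ : ∀ (xs : List E) k ks F →
  ∑ (fillings xs (k ∷ ks)) F ≡ ∑ (vecs xs k) λ P → ∑ (fillings xs ks) λ T → F (toList P ∷ T)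
∑-fillings-∷ xs k ks F = trans
  (∑-product _∷_ (map toList (vecs xs k)) (fillings xs ks) F)
  (∑-map toList (vecs xs k) _)

∑-vecs-1 : ∀ (xs : List E) (F : Vec E 1 → ℤ) → ∑ (vecs xs 1) F ≡ ∑ xs λ x → F (x ∷ [])
∑-vecs-1 xs F = trans (∑-product _∷_ xs (vecs xs 0) F)
                      (∑-cong′ xs λ x → ℤ.+-identityʳ _)

-- An uncut gap moves a letter from `v` to the head of `P`. Sums over different shapes thus become
-- sums over the same words and can be combined term by term.
∑-fillings-shape : ∀ (xs : List E) k (b : Vec Bool j) F →
  ∑ (fillings xs (shape k b)) F ≡
  ∑ (vecs xs k) λ P → ∑ (vecs xs j) λ v → F (rows (toList P) b v)
∑-fillings-shape xs k [] F = ∑-fillings-∷ xs k [] F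
∑-fillings-shape {j = suc j} xs k (true ∷ b) F = begin
  ∑ (fillings xs (k ∷ shape 1 b)) F
    ≡⟨ ∑-fillings-∷ xs k (shape 1 b) F ⟩
  (∑ (vecs xs k) λ P → ∑ (fillings xs (shape 1 b)) λ T → F (toList P ∷ T))
    ≡⟨ ∑-cong′ (vecs xs k) (λ P → ∑-fillings-shape xs 1 b _) ⟩
  (∑ (vecs xs k) λ P → ∑ (vecs xs 1) λ Q → ∑ (vecs xs j) λ v → F (toList P ∷ rows (toList Q) b v))
    ≡⟨ ∑-cong′ (vecs xs k) (λ P → ∑-vecs-1 xs _) ⟩
  (∑ (vecs xs k) λ P → ∑ xs λ x → ∑ (vecs xs j) λ v → F (toList P ∷ rows (x ∷ []) b v))
    ≡⟨ ∑-cong′ (vecs xs k) (λ P → ∑-product _∷_ xs (vecs xs j) _) ⟨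
  (∑ (vecs xs k) λ P → ∑ (vecs xs (suc j)) λ v → F (rows (toList P) (true ∷ b) v)) ∎
  where open ≡-Reasoning
∑-fillings-shape {j = suc j} xs k (false ∷ b) F = begin
  ∑ (fillings xs (shape (suc k) b)) F
    ≡⟨ ∑-fillings-shape xs (suc k) b F ⟩
  (∑ (vecs xs (suc k)) λ P → ∑ (vecs xs j) λ v → F (rows (toList P) b v))
    ≡⟨ ∑-product _∷_ xs (vecs xs k) _ ⟩
  (∑ xs λ x → ∑ (vecs xs k) λ P → ∑ (vecs xs j) λ v → F (rows (x ∷ toList P) b v))
    ≡⟨ ∑-swap xs (vecs xs k) _ ⟩
  (∑ (vecs xs k) λ P → ∑ xs λ x → ∑ (vecs xs j) λ v → F (rows (x ∷ toList P) b v))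
    ≡⟨ ∑-cong′ (vecs xs k) (λ P → ∑-product _∷_ xs (vecs xs j) _) ⟨
  (∑ (vecs xs k) λ P → ∑ (vecs xs (suc j)) λ v → F (rows (toList P) (false ∷ b) v)) ∎
  where open ≡-Reasoning

cuts : ∀ j → Vec Bool j
cuts j = Vec.replicate j true

rows-cuts : ∀ (P : List E) (v : Vec E j) → rows P (cuts j) v ≡ singletons P v
rows-cuts P []      = refl
rows-cuts P (x ∷ v) = cong (P ∷_) (rows-cuts (x ∷ []) v)

shape-cuts : ∀ k j → shape k (cuts j) ≡ k ∷ replicate j 1
shape-cuts k zero    = refl
shape-cuts k (suc j) = cong (k ∷_) (shape-cuts 1 j)

∑-fillings-hook : ∀ (xs : List E) k j F →
  ∑ (fillings xs (k ∷ replicate j 1)) F ≡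
  ∑ (vecs xs k) λ P → ∑ (vecs xs j) λ v → F (singletons (toList P) v)
∑-fillings-hook xs k j F = begin
  ∑ (fillings xs (k ∷ replicate j 1)) F
    ≡⟨ cong (λ ks → ∑ (fillings xs ks) F) (shape-cuts k j) ⟨
  ∑ (fillings xs (shape k (cuts j))) F
    ≡⟨ ∑-fillings-shape xs k (cuts j) F ⟩
  (∑ (vecs xs k) λ P → ∑ (vecs xs j) λ v → F (rows (toList P) (cuts j) v))
    ≡⟨ ∑-cong′ (vecs xs k) (λ P → ∑-cong′ (vecs xs j) λ v → cong F (rows-cuts (toList P) v)) ⟩
  (∑ (vecs xs k) λ P → ∑ (vecs xs j) λ v → F (singletons (toList P) v)) ∎
  where open ≡-Reasoning

module _ {E : Set} {_~_ : Rel E 0ℓ} (_~?_ : B.Decidable _~_) where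

  -- This refers to the word with all its last gaps cut, so after `P` every row before a gap is a
  -- single letter.
  NoRise : List E → Vec E j → Set
  NoRise P []      = ⊤
  NoRise P (x ∷ v) = ¬ Linked _~_ (x ∷ P) × NoRise (x ∷ []) v

  noRise? : ∀ P (v : Vec E j) → Dec (NoRise P v)
  noRise? P []      = yes tt
  noRise? P (x ∷ v) = ¬? (linked? _~?_ (x ∷ P)) ×-dec noRise? (x ∷ []) v

  -- `Linked` compares neighbours only, so the head of a linked row alone decides whether another
  -- letter may join it. In the induction this makes the uncut and the cut case end in the same
  -- condition on the rest of the word.
  noRise-head : ∀ {x P} (v : Vec E j) → Linked _~_ (x ∷ P) → NoRise (x ∷ P) v ⇔ NoRise (x ∷ []) v
  noRise-head []      l = mk⇔ id id
  noRise-head (y ∷ v) l = mk⇔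
    (λ (n , ns) → (λ { (r ∷ _) → n (r ∷ l) }) , ns)
    (λ (n , ns) → (λ { (r ∷ _) → n (r ∷ [-]) }) , ns)

  private
    #row : List E → ℤ
    #row P = [ linked? _~?_ P ]?

    #allRows : List (List E) → ℤ
    #allRows T = [ all? (linked? _~?_) T ]?

  -- Inclusion–exclusion over the set of uncut gaps.
  alternating-rows : ∀ P (v : Vec E j) →
    ∑ (vecs bools j) (λ b → sign b ℤ.* #allRows (rows P b v)) ≡ #row P ℤ.* [ noRise? P v ]?
  alternating-rows P [] = begin
    1ℤ ℤ.* #allRows (P ∷ []) ℤ.+ 0ℤ  ≡⟨ ℤ.+-identityʳ _ ⟩
    1ℤ ℤ.* #allRows (P ∷ [])         ≡⟨ ℤ.*-identityˡ _ ⟩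
    #allRows (P ∷ [])                ≡⟨ []?-cong (all? (linked? _~?_) (P ∷ [])) (linked? _~?_ P)
                                   (mk⇔ (λ { (l ∷ []) → l }) (_∷ [])) ⟩
    #row P                        ≡⟨ ℤ.*-identityʳ _ ⟨
    #row P ℤ.* 1ℤ                 ∎
    where open ≡-Reasoning
  alternating-rows {suc j} P (x ∷ v) = begin
    ∑ (vecs bools (suc j)) (λ b → sign b ℤ.* #allRows (rows P b (x ∷ v)))
      ≡⟨ ∑-product _∷_ bools bs _ ⟩
    ∑ bs (λ b → sign b ℤ.* #allRows (P ∷ rows (x ∷ []) b v)) ℤ.+
    (∑ bs (λ b → ℤ.- sign b ℤ.* #allRows (rows (x ∷ P) b v)) ℤ.+ 0ℤ)
      ≡⟨ cong₂ ℤ._+_ cut (trans (ℤ.+-identityʳ _) uncut) ⟩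
    #row P ℤ.* stays ℤ.+ ℤ.- (#row (x ∷ P) ℤ.* stays)
      ≡⟨ cong₂ ℤ._+_ (refl {x = #row P ℤ.* stays}) (ℤ.neg-distribˡ-* (#row (x ∷ P)) stays) ⟩
    #row P ℤ.* stays ℤ.+ (ℤ.- #row (x ∷ P)) ℤ.* stays
      ≡⟨ ℤ.*-distribʳ-+ stays (#row P) _ ⟨
    (#row P ℤ.- #row (x ∷ P)) ℤ.* stays
      ≡⟨ cong (ℤ._* stays) difference ⟩
    #row P ℤ.* [ ¬? (linked? _~?_ (x ∷ P)) ]? ℤ.* stays
      ≡⟨ ℤ.*-assoc (#row P) _ stays ⟩
    #row P ℤ.* ([ ¬? (linked? _~?_ (x ∷ P)) ]? ℤ.* stays)
      ≡⟨ cong₂ ℤ._*_ (refl {x = #row P})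
          ([]?-× (¬? (linked? _~?_ (x ∷ P))) (noRise? (x ∷ []) v)) ⟨
    #row P ℤ.* [ noRise? P (x ∷ v) ]? ∎
    where
    open ≡-Reasoning
    bs = vecs bools j
    stays  = [ noRise? (x ∷ []) v ]?

    -- If `x ∷ P` is linked, then so is `P`, and the two indicators cancel.
    difference : #row P ℤ.- #row (x ∷ P) ≡ #row P ℤ.* [ ¬? (linked? _~?_ (x ∷ P)) ]?
    difference with linked? _~?_ (x ∷ P)
    ... | yes l = trans (cong (ℤ._- 1ℤ) ([]?-yes (linked? _~?_ P) (Linked.tail l)))
                        (sym (ℤ.*-zeroʳ (#row P)))
    ... | no  _ = trans (ℤ.+-identityʳ (#row P)) (sym (ℤ.*-identityʳ (#row P)))

    cut : ∑ bs (λ b → sign b ℤ.* #allRows (P ∷ rows (x ∷ []) b v)) ≡ #row P ℤ.* stays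
    cut = begin
      ∑ bs (λ b → sign b ℤ.* #allRows (P ∷ rows (x ∷ []) b v))
        ≡⟨ ∑-cong′ bs (λ b → begin
             sign b ℤ.* #allRows (P ∷ rows (x ∷ []) b v)
               ≡⟨ cong₂ ℤ._*_ (refl {x = sign b}) (allRows-∷ (rows (x ∷ []) b v)) ⟩
             sign b ℤ.* (#row P ℤ.* #allRows (rows (x ∷ []) b v))
               ≡⟨ ℤ.*-assoc (sign b) (#row P) _ ⟨
             sign b ℤ.* #row P ℤ.* #allRows (rows (x ∷ []) b v)
               ≡⟨ cong (ℤ._* #allRows (rows (x ∷ []) b v)) (ℤ.*-comm (sign b) (#row P)) ⟩
             #row P ℤ.* sign b ℤ.* #allRows (rows (x ∷ []) b v)
               ≡⟨ ℤ.*-assoc (#row P) (sign b) _ ⟩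
             #row P ℤ.* (sign b ℤ.* #allRows (rows (x ∷ []) b v)) ∎) ⟩
      ∑ bs (λ b → #row P ℤ.* (sign b ℤ.* #allRows (rows (x ∷ []) b v)))
        ≡⟨ ∑-*ˡ bs (#row P) _ ⟩
      #row P ℤ.* ∑ bs (λ b → sign b ℤ.* #allRows (rows (x ∷ []) b v))
        ≡⟨ cong₂ ℤ._*_ (refl {x = #row P}) (trans (alternating-rows (x ∷ []) v) (ℤ.*-identityˡ stays)) ⟩
      #row P ℤ.* stays ∎
      where
      allRows-∷ : ∀ T → #allRows (P ∷ T) ≡ #row P ℤ.* #allRows T
      allRows-∷ T = trans
        ([]?-cong (all? (linked? _~?_) (P ∷ T)) (linked? _~?_ P ×-dec all? (linked? _~?_) T)
                  (mk⇔ All.uncons (λ (l , ls) → l ∷ ls)))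
        ([]?-× (linked? _~?_ P) (all? (linked? _~?_) T))

    uncut : ∑ bs (λ b → ℤ.- sign b ℤ.* #allRows (rows (x ∷ P) b v)) ≡ ℤ.- (#row (x ∷ P) ℤ.* stays)
    uncut = begin
      ∑ bs (λ b → ℤ.- sign b ℤ.* #allRows (rows (x ∷ P) b v))
        ≡⟨ ∑-cong′ bs (λ b → trans (sym (ℤ.neg-distribˡ-* (sign b) _)) (sym (ℤ.-1*i≡-i _))) ⟩
      ∑ bs (λ b → -1ℤ ℤ.* (sign b ℤ.* #allRows (rows (x ∷ P) b v)))
        ≡⟨ ∑-*ˡ bs -1ℤ _ ⟩
      -1ℤ ℤ.* ∑ bs (λ b → sign b ℤ.* #allRows (rows (x ∷ P) b v))
        ≡⟨ ℤ.-1*i≡-i _ ⟩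
      ℤ.- ∑ bs (λ b → sign b ℤ.* #allRows (rows (x ∷ P) b v))
        ≡⟨ cong ℤ.-_ (alternating-rows (x ∷ P) v) ⟩
      ℤ.- (#row (x ∷ P) ℤ.* [ noRise? (x ∷ P) v ]?)
        ≡⟨ cong ℤ.-_ ([]?-*-cong (linked? _~?_ (x ∷ P)) λ l →
             []?-cong (noRise? (x ∷ P) v) (noRise? (x ∷ []) v) (noRise-head v l)) ⟩
      ℤ.- (#row (x ∷ P) ℤ.* stays) ∎

  -- The weight `W` does not see the cuts `b`. It can therefore be taken out of the alternating sum
  -- over `b`, which then reduces to `alternating-rows`.
  alternating-fillings : ∀ (xs : List E) k j (F : List (List E) → ℤ) (W : List E → Vec E j → ℤ) →
    (∀ P b v → F (rows P b v) ≡ #allRows (rows P b v) ℤ.* W P v) →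
    ∑ (vecs bools j) (λ b → sign b ℤ.* ∑ (fillings xs (shape k b)) F) ≡
    ∑ (vecs xs k) λ P → ∑ (vecs xs j) λ v →
      [ linked? _~?_ (toList P) ×-dec noRise? (toList P) v ]? ℤ.* W (toList P) v
  alternating-fillings xs k j F W F-rows = begin
    ∑ bs (λ b → sign b ℤ.* ∑ (fillings xs (shape k b)) F)
      ≡⟨ ∑-cong′ bs (λ b → begin
           sign b ℤ.* ∑ (fillings xs (shape k b)) F
             ≡⟨ cong₂ ℤ._*_ (refl {x = sign b}) (∑-fillings-shape xs k b F) ⟩
           sign b ℤ.* (∑ Ps λ P → ∑ vs λ v → F (rows (toList P) b v))
             ≡⟨ ∑-*ˡ Ps (sign b) _ ⟨
           (∑ Ps λ P → sign b ℤ.* ∑ vs λ v → F (rows (toList P) b v))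
             ≡⟨ ∑-cong′ Ps (λ P → ∑-*ˡ vs (sign b) _) ⟨
           (∑ Ps λ P → ∑ vs λ v → sign b ℤ.* F (rows (toList P) b v)) ∎) ⟩
    (∑ bs λ b → ∑ Ps λ P → ∑ vs λ v → sign b ℤ.* F (rows (toList P) b v))
      ≡⟨ ∑-swap bs Ps _ ⟩
    (∑ Ps λ P → ∑ bs λ b → ∑ vs λ v → sign b ℤ.* F (rows (toList P) b v))
      ≡⟨ ∑-cong′ Ps (λ P → ∑-swap bs vs _) ⟩
    (∑ Ps λ P → ∑ vs λ v → ∑ bs λ b → sign b ℤ.* F (rows (toList P) b v))
      ≡⟨ ∑-cong′ Ps (λ P → ∑-cong′ vs λ v → term (toList P) v) ⟩
    (∑ Ps λ P → ∑ vs λ v →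
      [ linked? _~?_ (toList P) ×-dec noRise? (toList P) v ]? ℤ.* W (toList P) v) ∎
    where
    open ≡-Reasoning
    bs = vecs bools j
    Ps = vecs xs k
    vs = vecs xs j
    term : ∀ P v → ∑ bs (λ b → sign b ℤ.* F (rows P b v)) ≡
                   [ linked? _~?_ P ×-dec noRise? P v ]? ℤ.* W P v
    term P v = begin
      ∑ bs (λ b → sign b ℤ.* F (rows P b v))
        ≡⟨ ∑-cong′ bs (λ b → trans (cong₂ ℤ._*_ (refl {x = sign b}) (F-rows P b v))
                                   (sym (ℤ.*-assoc (sign b) (#allRows (rows P b v)) _))) ⟩
      ∑ bs (λ b → sign b ℤ.* #allRows (rows P b v) ℤ.* W P v)
        ≡⟨ ∑-*ʳ bs (W P v) _ ⟩
      ∑ bs (λ b → sign b ℤ.* #allRows (rows P b v)) ℤ.* W P v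
        ≡⟨ cong (ℤ._* W P v) (trans (alternating-rows P v)
             (sym ([]?-× (linked? _~?_ P) (noRise? P v)))) ⟩
      [ linked? _~?_ P ×-dec noRise? P v ]? ℤ.* W P v ∎

-- Semistandard tableaux and lattice words

cnt : Fin r → List (Fin r) → ℕ
cnt i xs = length (filter (i Fin.≟_) xs)

cnt-++ : ∀ (i : Fin r) xs ys → cnt i (xs ++ ys) ≡ cnt i xs + cnt i ys
cnt-++ i xs ys = trans (cong length (List.filter-++ (i Fin.≟_) xs ys)) (List.length-++ (filter (i Fin.≟_) xs))

cnt-∷-≡ : ∀ (i : Fin r) xs → cnt i (i ∷ xs) ≡ suc (cnt i xs)
cnt-∷-≡ i xs = cong length (List.filter-accept (i Fin.≟_) refl)

cnt-∷-≢ : ∀ {i x : Fin r} xs → i ≢ x → cnt i (x ∷ xs) ≡ cnt i xs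
cnt-∷-≢ xs i≢x = cong length (List.filter-reject (_ Fin.≟_) i≢x)

cnt-∉ : ∀ {i : Fin r} {xs} → All (i ≢_) xs → cnt i xs ≡ 0
cnt-∉ all = cong length (List.filter-none (_ Fin.≟_) all)

cnt-∈ : ∀ {i : Fin r} {xs} → i ∈ₗ xs → 1 ≤ cnt i xs
cnt-∈ {i = i} i∈ = List.filter-some (i Fin.≟_) i∈

total : (Fin n → ℕ) → ℕ
total {zero}  g = 0
total {suc n} g = g zero + total (g ∘ suc)

total-cong : ∀ {g h : Fin n → ℕ} → (∀ i → g i ≡ h i) → total g ≡ total h
total-cong {zero}  e = refl
total-cong {suc n} e = cong₂ _+_ (e zero) (total-cong (e ∘ suc))

sortedList : (Fin r → ℕ) → List (Fin r)
sortedList {zero}  g = []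
sortedList {suc r} g = replicate (g zero) zero ++ map suc (sortedList (g ∘ suc))

sortedList-cong : ∀ {g h : Fin r → ℕ} → (∀ i → g i ≡ h i) → sortedList g ≡ sortedList h
sortedList-cong {zero}  e = refl
sortedList-cong {suc r} e = cong₂ _++_ (cong (λ n → replicate n zero) (e zero))
                                   (cong (map suc) (sortedList-cong (e ∘ suc)))

length-sortedList : ∀ (g : Fin r → ℕ) → length (sortedList g) ≡ total g
length-sortedList {zero}  g = refl
length-sortedList {suc r} g = trans (List.length-++ (replicate (g zero) zero))
  (cong₂ _+_ (List.length-replicate (g zero))
             (trans (List.length-map suc (sortedList (g ∘ suc))) (length-sortedList (g ∘ suc))))

cnt-map-suc : ∀ (i : Fin r) xs → cnt (suc i) (map suc xs) ≡ cnt i xs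
cnt-map-suc i []       = refl
cnt-map-suc i (x ∷ xs) = case i Fin.≟ x of λ
  { (yes refl) → trans (cnt-∷-≡ (suc i) (map suc xs))
                       (trans (cong suc (cnt-map-suc i xs)) (sym (cnt-∷-≡ i xs)))
  ; (no i≢x)   → trans (cnt-∷-≢ (map suc xs) (i≢x ∘ Fin.suc-injective))
                       (trans (cnt-map-suc i xs) (sym (cnt-∷-≢ xs i≢x))) }

cnt-replicate : ∀ n (i : Fin r) → cnt i (replicate n i) ≡ n
cnt-replicate zero    i = refl
cnt-replicate (suc n) i = trans (cnt-∷-≡ i (replicate n i)) (cong suc (cnt-replicate n i))

cnt-sortedList : ∀ (g : Fin r → ℕ) i → cnt i (sortedList g) ≡ g i
cnt-sortedList {suc r} g zero = begin
  cnt zero (replicate (g zero) zero ++ map suc (sortedList (g ∘ suc)))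
    ≡⟨ cnt-++ zero (replicate (g zero) zero) _ ⟩
  cnt zero (replicate (g zero) zero) + cnt zero (map suc (sortedList (g ∘ suc)))
    ≡⟨ cong₂ _+_ (cnt-replicate (g zero) zero)
                    (cnt-∉ {xs = map suc (sortedList (g ∘ suc))} (All.map⁺ (All.tabulate λ _ ()))) ⟩
  g zero + 0
    ≡⟨ ℕ.+-identityʳ _ ⟩
  g zero ∎
  where open ≡-Reasoning
cnt-sortedList {suc r} g (suc i) = begin
  cnt (suc i) (replicate (g zero) zero ++ map suc (sortedList (g ∘ suc)))
    ≡⟨ cnt-++ (suc i) (replicate (g zero) zero) _ ⟩
  cnt (suc i) (replicate (g zero) zero) + cnt (suc i) (map suc (sortedList (g ∘ suc)))
    ≡⟨ cong₂ _+_ (cnt-∉ (All.replicate⁺ (g zero) λ ())) (cnt-map-suc i (sortedList (g ∘ suc))) ⟩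
  cnt i (sortedList (g ∘ suc))
    ≡⟨ cnt-sortedList (g ∘ suc) i ⟩
  g (suc i) ∎
  where open ≡-Reasoning

sortedList-AllPairs : ∀ (g : Fin r → ℕ) → AllPairs Fin._≤_ (sortedList g)
sortedList-AllPairs {zero}  g = []
sortedList-AllPairs {suc r} g = zeros (g zero)
  where
  open import Data.List.Relation.Unary.AllPairs.Properties as AP using ()
  zeros : ∀ n → AllPairs Fin._≤_ (replicate n zero ++ map suc (sortedList (g ∘ suc)))
  zeros zero    = AP.map⁺ (AllPairs.map s≤s (sortedList-AllPairs (g ∘ suc)))
  zeros (suc n) = All.tabulate (λ _ → z≤n) ∷ zeros n

sortedList-linked : ∀ (g : Fin r → ℕ) → Linked Fin._≤_ (sortedList g)
sortedList-linked g = Linked.AllPairs⇒Linked (sortedList-AllPairs g)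

sortedList-insert : ∀ (x : Fin r) {g h : Fin r → ℕ} → h x ≡ suc (g x) → (∀ {i} → i ≢ x → h i ≡ g i) →
  (∀ {i} → i Fin.< x → g i ≡ 0) → sortedList h ≡ x ∷ sortedList g
sortedList-insert {suc r} zero {g} {h} hx h≢ g0 = cong₂ _++_
  (cong (λ n → replicate n zero) hx) (cong (map suc) (sortedList-cong λ i → h≢ λ ()))
sortedList-insert {suc r} (suc x) {g} {h} hx h≢ g0 = begin
  replicate (h zero) zero ++ map suc (sortedList (h ∘ suc))
    ≡⟨ cong (λ n → replicate n zero ++ map suc (sortedList (h ∘ suc))) (trans (h≢ λ ()) (g0 (s≤s z≤n))) ⟩
  map suc (sortedList (h ∘ suc))
    ≡⟨ cong (map suc) (sortedList-insert x hx (λ i≢ → h≢ (i≢ ∘ Fin.suc-injective)) (g0 ∘ s≤s)) ⟩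
  suc x ∷ map suc (sortedList (g ∘ suc))
    ≡⟨ cong (λ n → suc x ∷ replicate n zero ++ map suc (sortedList (g ∘ suc))) (g0 {zero} (s≤s z≤n)) ⟨
  suc x ∷ replicate (g zero) zero ++ map suc (sortedList (g ∘ suc)) ∎
  where open ≡-Reasoning

sortedList-cnt : ∀ {xs : List (Fin r)} → Linked Fin._≤_ xs → sortedList (λ i → cnt i xs) ≡ xs
sortedList-cnt l = go (Linked.Linked⇒AllPairs Fin.≤-trans l)
  where
  sortedList-0 : ∀ r → sortedList {r} (λ _ → 0) ≡ []
  sortedList-0 zero    = refl
  sortedList-0 (suc r) = cong (map suc) (sortedList-0 r)
  go : ∀ {r} {xs : List (Fin r)} → AllPairs Fin._≤_ xs → sortedList (λ i → cnt i xs) ≡ xs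
  go []                     = sortedList-0 _
  go {xs = x ∷ xs} (x≤ ∷ p) = trans
    (sortedList-insert x (cnt-∷-≡ x xs) (cnt-∷-≢ xs) λ i<x →
      cnt-∉ (All.map (λ { x≤y refl → ℕ.<⇒≱ i<x x≤y }) x≤))
    (cong (x ∷_) (go p))

-- Rows past the end are empty, so the index type need not be tied to the length of the array.
row : List (List E) → Fin n → List E
row []      _       = []
row (R ∷ T) zero    = R
row (R ∷ T) (suc i) = row T i

row-tabulate : ∀ (h : Fin n → List E) i → row (tabulate h) i ≡ h i
row-tabulate h zero    = refl
row-tabulate h (suc i) = row-tabulate (h ∘ suc) i

tabulate-row : ∀ (T : List (List E)) → tabulate (row {n = length T} T) ≡ T
tabulate-row []      = refl
tabulate-row (R ∷ T) = cong (R ∷_) (tabulate-row T)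

all-row : ∀ {P : List E → Set} {T} → All P T → ∀ (i : Fin (length T)) → P (row T i)
all-row (p ∷ ps) zero    = p
all-row (p ∷ ps) (suc i) = all-row ps i

cnt-concat : ∀ (c : Fin r) T → cnt c (concat T) ≡ total {length T} λ i → cnt c (row T i)
cnt-concat c []      = refl
cnt-concat c (R ∷ T) = trans (cnt-++ c R (concat T)) (cong (λ m → cnt c R + m) (cnt-concat c T))

cnt-concat-tabulate : ∀ (c : Fin r) (h : Fin n → List (Fin r)) →
  cnt c (concat (tabulate h)) ≡ total λ i → cnt c (h i)
cnt-concat-tabulate {n = zero}  c h = refl
cnt-concat-tabulate {n = suc n} c h =
  trans (cnt-++ c (h zero) _) (cong (λ m → cnt c (h zero) + m) (cnt-concat-tabulate c (h ∘ suc)))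

-- The matrix of multiplicities has `a` rows and one column for each of the `b` letters, whether it
-- occurs or not. Keeping the zero columns as empty rows is what makes the operation invertible.
transpose : ∀ a b → List (List (Fin b)) → List (List (Fin a))
transpose a b T = tabulate λ c → sortedList λ i → cnt c (row T i)

cnt-transpose : ∀ (T : List (List (Fin b))) c (i : Fin a) → cnt i (row (transpose a b T) c) ≡ cnt c (row T i)
cnt-transpose T c i = trans (cong (cnt i) (row-tabulate _ c)) (cnt-sortedList _ i)

linked-transpose : ∀ a b T → All (Linked Fin._≤_) (transpose a b T)
linked-transpose a b T = All.tabulate⁺ λ c → sortedList-linked λ i → cnt c (row T i)

length-transpose : ∀ a b (T : List (List (Fin b))) → length (transpose a b T) ≡ b
length-transpose a b T = List.length-tabulate {n = b} λ c → sortedList {a} λ i → cnt c (row T i)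

transpose-involutive : ∀ {T : List (List (Fin b))} → length T ≡ a → All (Linked Fin._≤_) T →
  transpose b a (transpose a b T) ≡ T
transpose-involutive {b = b} {T = T} refl ls = begin
  tabulate (λ i → sortedList λ c → cnt i (row (transpose (length T) b T) c))
    ≡⟨ List.tabulate-cong (λ i → trans (sortedList-cong λ c → cnt-transpose T c i)
                                       (sortedList-cnt (all-row ls i))) ⟩
  tabulate (row {n = length T} T)
    ≡⟨ tabulate-row T ⟩
  T ∎
  where open ≡-Reasoning

-- Both sides are column sums of the matrix of multiplicities. Together with `content-transpose`,
-- for the row sums, this exchanges shape and content.
lengths-transpose : ∀ {T : List (List (Fin b))} → length T ≡ a →
  map length (transpose a b T) ≡ tabulate λ c → cnt c (concat T)
lengths-transpose {T = T} refl = trans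
  (List.map-tabulate _ length)
  (List.tabulate-cong λ c → trans (length-sortedList {length T} λ i → cnt c (row T i)) (sym (cnt-concat c T)))

content-transpose : ∀ {T : List (List (Fin b))} → length T ≡ a → All (Linked Fin._≤_) T →
  ∀ i → cnt i (concat (transpose a b T)) ≡ length (row T i)
content-transpose {b = b} {T = T} refl ls i = begin
  cnt i (concat (transpose (length T) b T))  ≡⟨ cnt-concat-tabulate i U ⟩
  total (λ c → cnt i (U c))                  ≡⟨ total-cong (λ c → cnt-sortedList (λ i → cnt c (row T i)) i) ⟩
  total (λ c → cnt c (row T i))              ≡⟨ length-sortedList (λ c → cnt c (row T i)) ⟨
  length (sortedList λ c → cnt c (row T i))      ≡⟨ cong length (sortedList-cnt (all-row ls i)) ⟩
  length (row T i)                           ∎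
  where
  open ≡-Reasoning
  U : Fin b → List (Fin (length T))
  U c = sortedList λ i → cnt c (row T i)

-- Column strictness in terms of letter counts

partial : (Fin n → ℕ) → Fin n → ℕ
partial g zero    = 0
partial g (suc c) = g zero + partial (g ∘ suc) c

partial-cong : ∀ {g h : Fin n → ℕ} c → (∀ {i} → i Fin.< c → h i ≡ g i) → partial h c ≡ partial g c
partial-cong zero    e = refl
partial-cong (suc c) e = cong₂ _+_ (e (s≤s z≤n)) (partial-cong c (e ∘ s≤s))

partial-increment : ∀ {g h : Fin n → ℕ} {x} c → x Fin.< c →
  h x ≡ suc (g x) → (∀ {i} → i ≢ x → h i ≡ g i) → partial h c ≡ suc (partial g c)
partial-increment {x = zero}  (suc c) _         hx h≢ =
  cong₂ _+_ hx (partial-cong c λ _ → h≢ λ ())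
partial-increment {x = suc x} (suc c) (s≤s x<c) hx h≢ = trans
  (cong₂ _+_ (h≢ λ ()) (partial-increment c x<c hx λ i≢x → h≢ (i≢x ∘ Fin.suc-injective)))
  (ℕ.+-suc _ _)

#< #≤ : Fin N → List (Fin N) → ℕ
#< c R = partial (λ c′ → cnt c′ R) c
#≤ c R = #< c R + cnt c R

#<-∷-< : ∀ {c x : Fin N} R → x Fin.< c → #< c (x ∷ R) ≡ suc (#< c R)
#<-∷-< {c = c} {x} R x<c = partial-increment c x<c (cnt-∷-≡ x R) (cnt-∷-≢ R)

#<-∷-≥ : ∀ {c x : Fin N} R → c Fin.≤ x → #< c (x ∷ R) ≡ #< c R
#<-∷-≥ {c = c} R c≤x = partial-cong c λ i<c → cnt-∷-≢ R λ { refl → ℕ.<⇒≱ i<c c≤x }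

#≤-∷-≤ : ∀ {c x : Fin N} R → x Fin.≤ c → #≤ c (x ∷ R) ≡ suc (#≤ c R)
#≤-∷-≤ {c = c} {x} R x≤c = case c Fin.≟ x of λ
  { (yes refl) → trans (cong₂ _+_ (#<-∷-≥ {c = c} R ℕ.≤-refl) (cnt-∷-≡ c R)) (ℕ.+-suc _ _)
  ; (no c≢x)   → cong₂ _+_ (#<-∷-< R (Fin.≤∧≢⇒< x≤c (c≢x ∘ sym))) (cnt-∷-≢ R c≢x) }

#≤-∷-> : ∀ {c x : Fin N} R → c Fin.< x → #≤ c (x ∷ R) ≡ #≤ c R
#≤-∷-> R c<x = cong₂ _+_ (#<-∷-≥ R (ℕ.<⇒≤ c<x)) (cnt-∷-≢ R λ { refl → ℕ.<-irrefl refl c<x })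

#<-[] : ∀ (c : Fin N) → #< c [] ≡ 0
#<-[] zero    = refl
#<-[] (suc c) = #<-[] c

#≤-[] : ∀ (c : Fin N) → #≤ c [] ≡ 0
#≤-[] c = trans (ℕ.+-identityʳ _) (#<-[] c)

#<-none : ∀ {c : Fin N} {R} → All (c Fin.≤_) R → #< c R ≡ 0
#<-none {c = c} []              = #<-[] c
#<-none         (c≤x ∷ c≤) = trans (#<-∷-≥ _ c≤x) (#<-none c≤)

#≤-none : ∀ {c : Fin N} {R} → All (c Fin.<_) R → #≤ c R ≡ 0
#≤-none {c = c} []              = #≤-[] c
#≤-none         (c<x ∷ c<) = trans (#≤-∷-> _ c<x) (#≤-none c<)

ColumnStrict : List (Fin N) → List (Fin N) → Set
ColumnStrict R R′ = All (uncurry Fin._<_) (zip R R′)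

#<-∷-mono : ∀ (c x : Fin N) R → #< c R ≤ #< c (x ∷ R)
#<-∷-mono c x R = case c Fin.≤? x of λ
  { (yes c≤x) → ℕ.≤-reflexive (sym (#<-∷-≥ R c≤x))
  ; (no c≰x)  → ℕ.≤-trans (ℕ.n≤1+n _) (ℕ.≤-reflexive (sym (#<-∷-< R (ℕ.≰⇒> c≰x)))) }

-- Each letter at most `c` in the lower row stands below a letter less than `c` in the upper one.
-- The bound on the lengths prevents `zip` from dropping letters of the lower row.
columnStrict⇒ : ∀ {R R′ : List (Fin N)} → length R′ ≤ length R → ColumnStrict R R′ →
  ∀ c → #≤ c R′ ≤ #< c R
columnStrict⇒ {R′ = []}                 _        _          c = ℕ.≤-trans (ℕ.≤-reflexive (#≤-[] c)) z≤n
columnStrict⇒ {R = x ∷ R} {R′ = y ∷ R′} (s≤s le) (x<y ∷ cs) c = case y Fin.≤? c of λ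
  { (yes y≤c) → begin
      #≤ c (y ∷ R′)  ≡⟨ #≤-∷-≤ R′ y≤c ⟩
      suc (#≤ c R′)  ≤⟨ s≤s (columnStrict⇒ le cs c) ⟩
      suc (#< c R)   ≡⟨ #<-∷-< R (ℕ.<-≤-trans x<y y≤c) ⟨
      #< c (x ∷ R)   ∎
  ; (no y≰c) → begin
      #≤ c (y ∷ R′)  ≡⟨ #≤-∷-> R′ (ℕ.≰⇒> y≰c) ⟩
      #≤ c R′        ≤⟨ columnStrict⇒ le cs c ⟩
      #< c R         ≤⟨ #<-∷-mono c x R ⟩
      #< c (x ∷ R)   ∎ }
  where open ℕ.≤-Reasoning

-- The inequality at the first letter `y` of the lower row gives the first column: if the sorted
-- upper row began with a letter at least `y`, it would have no letter below `y` at all. Deleting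
-- that column preserves the inequalities.
columnStrict⇐ : ∀ {R R′ : List (Fin N)} → AllPairs Fin._≤_ R → AllPairs Fin._≤_ R′ →
  (∀ c → #≤ c R′ ≤ #< c R) → ColumnStrict R R′
columnStrict⇐ {R = []}    _ _                            h = []
columnStrict⇐ {R = x ∷ R} {[]}     _ _                    h = []
columnStrict⇐ {R = x ∷ R} {y ∷ R′} (x≤ ∷ p) (y≤ ∷ p′) h = head ∷ columnStrict⇐ p p′ tail
  where
  open ℕ.≤-Reasoning
  head : x Fin.< y
  head = case y Fin.≤? x of λ
    { (no y≰x)  → ℕ.≰⇒> y≰x
    ; (yes y≤x) → contradiction
        (begin
          1              ≤⟨ s≤s z≤n ⟩
          suc (#≤ y R′)  ≡⟨ #≤-∷-≤ {c = y} R′ ℕ.≤-refl ⟨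
          #≤ y (y ∷ R′)  ≤⟨ h y ⟩
          #< y (x ∷ R)   ≡⟨ #<-none (y≤x ∷ All.map (ℕ.≤-trans y≤x) x≤) ⟩
          0              ∎)
        λ () }
  tail : ∀ c → #≤ c R′ ≤ #< c R
  tail c = case y Fin.≤? c of λ
    { (yes y≤c) → ℕ.≤-pred (begin
        suc (#≤ c R′)  ≡⟨ #≤-∷-≤ R′ y≤c ⟨
        #≤ c (y ∷ R′)  ≤⟨ h c ⟩
        #< c (x ∷ R)   ≡⟨ #<-∷-< R (ℕ.<-≤-trans head y≤c) ⟩
        suc (#< c R)   ∎)
    ; (no y≰c) → ℕ.≤-trans
        (ℕ.≤-reflexive (#≤-none (All.map (ℕ.<-≤-trans (ℕ.≰⇒> y≰c)) y≤))) z≤n }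

Adjacent : Fin r → Fin r → Set
Adjacent i j = toℕ j ≡ suc (toℕ i)

linked⇔adjacent : ∀ {P : List E → List E → Set} T →
  Linked P T ⇔ (∀ (i j : Fin (length T)) → Adjacent i j → P (row T i) (row T j))
linked⇔adjacent {P = P} T = mk⇔ to (from T)
  where
  to : ∀ {T} → Linked P T → ∀ (i j : Fin (length T)) → Adjacent i j → P (row T i) (row T j)
  to (p ∷ ps) zero    (suc zero) e = p
  to (p ∷ ps) (suc i) (suc j)    e = to ps i j (ℕ.suc-injective e)
  to [-]      zero    zero       ()
  from : ∀ T → (∀ (i j : Fin (length T)) → Adjacent i j → P (row T i) (row T j)) → Linked P T
  from []          h = []
  from (R ∷ [])    h = [-]
  from (R ∷ R′ ∷ T) h = h zero (suc zero) refl ∷ from (R′ ∷ T) λ i j e → h (suc i) (suc j) (cong suc e)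

-- Every prefix of the concatenated rows has partition content, when each row is
-- read with its larger letters first; f is the content of what precedes U.
Lattice : (Fin r → ℕ) → List (List (Fin r)) → Set
Lattice f []      = ⊤
Lattice f (R ∷ U) = (∀ i j → Adjacent i j → f j + cnt j R ≤ f i) × Lattice (λ i → f i + cnt i R) U

lattice? : ∀ f (U : List (List (Fin r))) → Dec (Lattice f U)
lattice? f []      = yes tt
lattice? f (R ∷ U) =
  Fin.all? (λ i → Fin.all? λ j → (toℕ j ℕ.≟ suc (toℕ i)) →-dec (f j + cnt j R ℕ.≤? f i))
  ×-dec lattice? _ U

-- The accumulator of `Lattice` is replaced by the explicit content of the rows before `c`, the form
-- in which it can be compared with `#<`.
lattice-tabulate : ∀ f (h : Fin n → List (Fin r)) → Lattice f (tabulate h) ⇔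
  (∀ c i j → Adjacent i j →
    f j + partial (λ c′ → cnt j (h c′)) c + cnt j (h c) ≤ f i + partial (λ c′ → cnt i (h c′)) c)
lattice-tabulate {n = zero}  f h = mk⇔ (λ _ ()) (λ _ → tt)
lattice-tabulate {n = suc n} f h = mk⇔ to from
  where
  open Equivalence (lattice-tabulate {n = n} (λ i → f i + cnt i (h zero)) (h ∘ suc)) renaming (to to to′; from to from′)
  reassoc : ∀ i c → f i + cnt i (h zero) + partial (λ c′ → cnt i (h (suc c′))) c
                  ≡ f i + partial (λ c′ → cnt i (h c′)) (suc c)
  reassoc i c = ℕ.+-assoc (f i) _ _
  to : Lattice f (tabulate h) → _
  to (l , ls) zero    i j adj = subst₂ _≤_ (cong (_+ cnt j (h zero)) (sym (ℕ.+-identityʳ (f j))))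
                                           (sym (ℕ.+-identityʳ (f i))) (l i j adj)
  to (l , ls) (suc c) i j adj =
    subst₂ _≤_ (cong (_+ cnt j (h (suc c))) (reassoc j c)) (reassoc i c) (to′ ls c i j adj)
  from : _ → Lattice f (tabulate h)
  from l =
    (λ i j adj → subst₂ _≤_ (cong (_+ cnt j (h zero)) (ℕ.+-identityʳ (f j)))
                            (ℕ.+-identityʳ (f i)) (l zero i j adj)) ,
    from′ λ c i j adj →
      subst₂ _≤_ (cong (_+ cnt j (h (suc c))) (sym (reassoc j c))) (sym (reassoc i c)) (l (suc c) i j adj)

-- In the transposed array the number of letters `i` before row `c` is the number of letters less
-- than `c` in row `i` of `T`. So the lattice inequality at row `c` for adjacent `i` and `j` reads
-- `#≤ c (row T j) ≤ #< c (row T i)`, and over all `c` this is column strictness of the two rows.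
lattice-transpose : ∀ {T : List (List (Fin N))} → length T ≡ r → All (Linked Fin._≤_) T →
  Linked (λ R R′ → length R ≥ length R′) T →
  Linked ColumnStrict T ⇔ Lattice (λ _ → 0) (transpose r N T)
lattice-transpose {N = N} {T = T} refl ls lens = mk⇔
  (λ cs → L.from λ c i j adj → subst₂ _≤_ (sym (#≤-eq c j)) (sym (#<-eq c i))
    (columnStrict⇒ (Equivalence.to (linked⇔adjacent T) lens i j adj)
                   (Equivalence.to (linked⇔adjacent T) cs i j adj) c))
  (λ l → Equivalence.from (linked⇔adjacent T) λ i j adj →
    columnStrict⇐ (pairs i) (pairs j) λ c →
      subst₂ _≤_ (#≤-eq c j) (#<-eq c i) (L.to l c i j adj))
  where
  U : Fin N → List (Fin (length T))
  U c = sortedList λ i → cnt c (row T i)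
  module L = Equivalence (lattice-tabulate (λ _ → 0) U)
  pairs : ∀ i → AllPairs Fin._≤_ (row T i)
  pairs i = Linked.Linked⇒AllPairs Fin.≤-trans (all-row ls i)
  #<-eq : ∀ c i → partial (λ c′ → cnt i (U c′)) c ≡ #< c (row T i)
  #<-eq c i = partial-cong c λ {c′} _ → cnt-sortedList (λ i → cnt c′ (row T i)) i
  #≤-eq : ∀ c i → partial (λ c′ → cnt i (U c′)) c + cnt i (U c) ≡ #≤ c (row T i)
  #≤-eq c i = cong₂ _+_ (#<-eq c i) (cnt-sortedList (λ i → cnt c (row T i)) i)

length-row : ∀ (T : List (List E)) {μ} → map length T ≡ μ → ∀ i → length (row T i) ≡ lookup μ i
length-row (R ∷ T) refl zero    = refl
length-row (R ∷ T) refl (suc i) = length-row T refl i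

IsLatticeArray : ∀ μ → List (List (Fin (length μ))) → Set
IsLatticeArray μ U = All (Linked Fin._≤_) U × HasContent μ U × Lattice (λ _ → 0) U

isLatticeArray? : ∀ μ U → Dec (IsLatticeArray μ U)
isLatticeArray? μ U = all? (linked? Fin._≤?_) U ×-dec hasContent? μ U ×-dec lattice? (λ _ → 0) U

-- A partition has weakly decreasing parts, which supplies the bound on row lengths in
-- `lattice-transpose`. In the result `α` is a shape and no longer a content, so the alternating sum
-- over shapes can be applied.
schur-lattice : ∀ {n μ} → IsPartition n μ → ∀ α →
  + schur μ α ≡ ∑ (fillings (allFin (length μ)) α) λ U → [ isLatticeArray? μ U ]?
schur-lattice {n} {μ} (decreasing , _) α = begin
  + schur μ α
    ≡⟨ length-filter R? Ts ⟩
  ∑ Ts (λ T → [ R? T ]?)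
    ≡⟨ ∑-cong′ Ts (λ T → ℤ.*-identityʳ _) ⟨
  ∑ Ts (λ T → [ R? T ]? ℤ.* 1ℤ)
    ≡⟨ ∑-filter R? Ts _ ⟨
  ∑ (filter R? Ts) (λ _ → 1ℤ)
    ≡⟨ ∑-bijection R? (isLatticeArray? μ) (transpose #μ #α) (transpose #α #μ)
         (unique-fillings (Unique.allFin⁺ #α) μ) (unique-fillings (Unique.allFin⁺ #μ) α) to from (λ _ → 1ℤ) ⟨
  ∑ (filter (isLatticeArray? μ) Us) (λ _ → 1ℤ)
    ≡⟨ ∑-filter (isLatticeArray? μ) Us _ ⟩
  ∑ Us (λ U → [ isLatticeArray? μ U ]? ℤ.* 1ℤ)
    ≡⟨ ∑-cong′ Us (λ U → ℤ.*-identityʳ _) ⟩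
  ∑ Us (λ U → [ isLatticeArray? μ U ]?) ∎
  where
  open ≡-Reasoning
  #α = length α
  #μ = length μ
  Ts = fillings (allFin #α) μ
  Us = fillings (allFin #μ) α
  R? = λ T → isSemistandard? T ×-dec hasContent? α T

  lengths : ∀ {T : List (List E)} → map length T ≡ μ → Linked (λ R R′ → length R ≥ length R′) T
  lengths refl = Linked.map⁻ decreasing

  to : ∀ {T} → T ∈ₗ Ts → IsSemistandard T × HasContent α T →
       transpose #μ #α T ∈ₗ Us × IsLatticeArray μ (transpose #μ #α T) × transpose #α #μ (transpose #μ #α T) ≡ T
  to {T} T∈ ((ls , cs) , content) =
    subst (λ ks → transpose #μ #α T ∈ₗ fillings (allFin #μ) ks)
          (trans (lengths-transpose {T = T} length-T) (trans (List.tabulate-cong content) (List.tabulate-lookup α)))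
          (∈-fillings⁺ ∈ₗ.∈-allFin (transpose #μ #α T)) ,
    (linked-transpose #μ #α T ,
     (λ i → trans (content-transpose {T = T} length-T ls i) (length-row T shape-T i)) ,
     Equivalence.to (lattice-transpose length-T ls (lengths shape-T)) cs) ,
    transpose-involutive length-T ls
    where
    shape-T  = ∈-fillings⁻ μ T∈
    length-T = trans (sym (List.length-map length T)) (cong length shape-T)

  from : ∀ {U} → U ∈ₗ Us → IsLatticeArray μ U →
         transpose #α #μ U ∈ₗ Ts × (IsSemistandard (transpose #α #μ U) × HasContent α (transpose #α #μ U)) ×
         transpose #μ #α (transpose #α #μ U) ≡ U
  from {U} U∈ (ls , content , lattice) =
    subst (λ ks → T ∈ₗ fillings (allFin #α) ks) shape-T (∈-fillings⁺ ∈ₗ.∈-allFin T) ,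
    ((linked-transpose #α #μ U ,
      Equivalence.from (lattice-transpose (length-transpose _ _ U) (linked-transpose #α #μ U) (lengths shape-T))
        (subst (Lattice (λ _ → 0)) (sym inv-U) lattice)) ,
     λ c → trans (content-transpose {T = U} length-U ls c) (length-row U shape-U c)) ,
    inv-U
    where
    T        = transpose #α #μ U
    shape-U  = ∈-fillings⁻ α U∈
    length-U = trans (sym (List.length-map length U)) (cong length shape-U)
    shape-T  = trans (lengths-transpose {T = U} length-U) (trans (List.tabulate-cong content) (List.tabulate-lookup μ))
    inv-U    = transpose-involutive length-U ls

lattice-cong : ∀ {f g : Fin r → ℕ} → (∀ i → f i ≡ g i) → ∀ U → Lattice f U → Lattice g U
lattice-cong e []      _        = tt
lattice-cong e (R ∷ U) (l , ls) =
  (λ i j adj → subst₂ _≤_ (cong (_+ cnt j R) (e j)) (e i) (l i j adj)) ,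
  lattice-cong (λ i → cong (_+ cnt i R) (e i)) U ls

cnt-∷ : ∀ (i x : Fin r) P → cnt i (x ∷ P) ≡ cnt i P + cnt i (x ∷ [])
cnt-∷ i x P = trans (cnt-++ i (x ∷ []) P) (ℕ.+-comm _ (cnt i P))

-- The letter `x` is a smallest one of its row and is read last, so cutting it off does not change
-- the reading word. In the converse the critical case is `j = x`: the letters of `P` are at least
-- `j`, so no `i` in `P` can have helped.
lattice-merge : ∀ {f} {x : Fin r} {P} U → Linked Fin._≤_ (x ∷ P) →
  Lattice f ((x ∷ P) ∷ U) ⇔ Lattice f (P ∷ (x ∷ []) ∷ U)
lattice-merge {f = f} {x} {P} U linked = mk⇔ to from
  where
  x≤P : All (x Fin.≤_) P
  x≤P = AllPairs.head (Linked.Linked⇒AllPairs Fin.≤-trans linked)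
  regroup : ∀ i → f i + cnt i (x ∷ P) ≡ f i + cnt i P + cnt i (x ∷ [])
  regroup i = trans (cong (f i ℕ.+_) (cnt-∷ i x P)) (sym (ℕ.+-assoc (f i) _ _))
  to : Lattice f ((x ∷ P) ∷ U) → Lattice f (P ∷ (x ∷ []) ∷ U)
  to (l , ls) =
    (λ i j adj → ℕ.≤-trans (ℕ.m≤m+n _ _) (ℕ.≤-trans (ℕ.≤-reflexive (sym (regroup j))) (l i j adj))) ,
    (λ i j adj → ℕ.≤-trans (ℕ.≤-reflexive (sym (regroup j))) (ℕ.≤-trans (l i j adj) (ℕ.m≤m+n _ _))) ,
    lattice-cong regroup U ls
  from : Lattice f (P ∷ (x ∷ []) ∷ U) → Lattice f ((x ∷ P) ∷ U)
  from (l , l′ , ls) = l″ , lattice-cong (sym ∘ regroup) U ls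
    where
    l″ : ∀ i j → Adjacent i j → f j + cnt j (x ∷ P) ≤ f i
    l″ i j adj = case j Fin.≟ x of λ
      { (yes refl) → begin
          f j + cnt j (j ∷ P)              ≡⟨ regroup j ⟩
          f j + cnt j P + cnt j (j ∷ [])   ≤⟨ l′ i j adj ⟩
          f i + cnt i P                    ≡⟨ cong (f i ℕ.+_) (cnt-∉ (All.map (λ { j≤i refl →
                                                ℕ.<⇒≱ (ℕ.≤-reflexive (sym adj)) j≤i }) x≤P)) ⟩
          f i + 0                          ≡⟨ ℕ.+-identityʳ _ ⟩
          f i                              ∎
      ; (no j≢x) → ℕ.≤-trans (ℕ.≤-reflexive (cong (f j ℕ.+_) (cnt-∷-≢ P j≢x))) (l i j adj) }
      where open ℕ.≤-Reasoning

linked-first : ∀ {_~_ : Rel E 0ℓ} P (b : Vec Bool j) v → All (Linked _~_) (rows P b v) → Linked _~_ P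
linked-first P []          []      (l ∷ _) = l
linked-first P (true ∷ b)  (x ∷ v) (l ∷ _) = l
linked-first P (false ∷ b) (x ∷ v) ls      = Linked.tail (linked-first (x ∷ P) b v ls)

-- For linked rows the lattice condition depends on the word alone, as the weight in
-- `alternating-fillings` must.
lattice-rows : ∀ {f} (P : List (Fin r)) (b : Vec Bool j) v → All (Linked Fin._≤_) (rows P b v) →
  Lattice f (rows P b v) ⇔ Lattice f (singletons P v)
lattice-rows P []          []      _        = mk⇔ id id
lattice-rows P (true ∷ b)  (x ∷ v) (_ ∷ ls) = mk⇔ (map₂ (Equivalence.to rec)) (map₂ (Equivalence.from rec))
  where rec = lattice-rows (x ∷ []) b v ls
lattice-rows P (false ∷ b) (x ∷ v) ls       =
  lattice-merge _ (linked-first (x ∷ P) b v ls) ⇔.⇔-∘ lattice-rows (x ∷ P) b v ls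

cnt-↭ : ∀ (i : Fin r) {xs ys} → xs ↭ ys → cnt i xs ≡ cnt i ys
cnt-↭ i p = ↭.↭-length (↭.filter-↭ (i Fin.≟_) p)

IsLatticeWord : ∀ μ → List (Fin (length μ)) → Vec (Fin (length μ)) j → Set
IsLatticeWord μ P v =
  (∀ i → cnt i (P ++ toList v) ≡ lookup μ i) × Lattice (λ _ → 0) (singletons P v)

isLatticeWord? : ∀ μ P (v : Vec _ j) → Dec (IsLatticeWord μ P v)
isLatticeWord? μ P v =
  Fin.all? (λ i → cnt i (P ++ toList v) ℕ.≟ lookup μ i) ×-dec lattice? (λ _ → 0) (singletons P v)

isLatticeArray-rows : ∀ μ P (b : Vec Bool j) v →
  [ isLatticeArray? μ (rows P b v) ]? ≡
  [ all? (linked? Fin._≤?_) (rows P b v) ]? ℤ.* [ isLatticeWord? μ P v ]?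
isLatticeArray-rows μ P b v = trans
  ([]?-× linked?′ (hasContent? μ (rows P b v) ×-dec lattice? (λ _ → 0) (rows P b v)))
  ([]?-*-cong linked?′ λ ls → []?-cong
    (hasContent? μ (rows P b v) ×-dec lattice? (λ _ → 0) (rows P b v)) (isLatticeWord? μ P v)
    (mk⇔
      (λ (content , lattice) → (λ i → trans (sym (cnt-↭ i perm)) (content i)) ,
                               Equivalence.to (lattice-rows P b v ls) lattice)
      (λ (content , lattice) → (λ i → trans (cnt-↭ i perm) (content i)) ,
                               Equivalence.from (lattice-rows P b v ls) lattice)))
  where
  linked?′ = all? (linked? Fin._≤?_) (rows P b v)
  perm = concat-rows P b v

-- Lattice words without rises

Steps : ℕ → Vec (Fin r) j → Set
Steps t []      = ⊤
Steps t (y ∷ v) = toℕ y ≡ suc t × Steps (suc t) v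

steps-unique : ∀ {v v′ : Vec (Fin r) j} → Steps t v → Steps t v′ → v ≡ v′
steps-unique {v = []}    {[]}     _        _          = refl
steps-unique {v = y ∷ v} {y′ ∷ v′} (e , s) (e′ , s′) =
  cong₂ _∷_ (Fin.toℕ-injective (trans e (sym e′))) (steps-unique s s′)

steps-exist : ∀ t j → t + j < r → ∃ λ (v : Vec (Fin r) j) → Steps t v
steps-exist t zero    _  = [] , tt
steps-exist {r} t (suc j) lt =
  let lt′ = ℕ.≤-trans (ℕ.≤-reflexive (cong suc (sym (ℕ.+-suc t j)))) lt
      v , s = steps-exist (suc t) j lt′
      t<r = ℕ.≤-trans (s≤s (s≤s (ℕ.m≤m+n t j))) lt′
  in Fin.fromℕ< t<r ∷ v , Fin.toℕ-fromℕ< t<r , s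

steps-bound : ∀ (v : Vec (Fin r) j) → Steps t v → t < r → t + j < r
steps-bound {t = t} []      _        lt = ℕ.≤-trans (ℕ.≤-reflexive (cong suc (ℕ.+-identityʳ t))) lt
steps-bound {t = t} (y ∷ v) (e , s)  lt = ℕ.≤-trans (ℕ.≤-reflexive (cong suc (ℕ.+-suc t _)))
  (steps-bound v s (ℕ.≤-trans (ℕ.≤-reflexive (cong suc (sym e))) (Fin.toℕ<n y)))

steps-cnt-≤ : ∀ {i} (v : Vec (Fin r) j) → Steps t v → toℕ i ≤ t → cnt i (toList v) ≡ 0
steps-cnt-≤ []      _       _   = refl
steps-cnt-≤ (y ∷ v) (e , s) i≤t = trans
  (cnt-∷-≢ (toList v) λ { refl → ℕ.<⇒≱ (ℕ.≤-reflexive (sym e)) i≤t })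
  (steps-cnt-≤ v s (ℕ.m≤n⇒m≤1+n i≤t))

steps-cnt-> : ∀ {i} (v : Vec (Fin r) j) → Steps t v → t + j < toℕ i → cnt i (toList v) ≡ 0
steps-cnt-> []                     _       _  = refl
steps-cnt-> {t = t} (y ∷ v) (e , s) lt = trans
  (cnt-∷-≢ (toList v) λ { refl → ℕ.<⇒≱ lt (ℕ.≤-trans (ℕ.≤-reflexive e)
      (ℕ.≤-trans (s≤s (ℕ.m≤m+n t _)) (ℕ.≤-reflexive (sym (ℕ.+-suc t _))))) })
  (steps-cnt-> v s (ℕ.≤-trans (ℕ.≤-reflexive (cong suc (sym (ℕ.+-suc t _)))) lt))

steps-cnt : ∀ {i} (v : Vec (Fin r) j) → Steps t v → t < toℕ i → toℕ i ≤ t + j → cnt i (toList v) ≡ 1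
steps-cnt {t = t} [] _ lt le = contradiction (ℕ.≤-trans le (ℕ.≤-reflexive (ℕ.+-identityʳ t))) (ℕ.<⇒≱ lt)
steps-cnt {t = t} {i = i} (y ∷ v) (e , s) lt le = case i Fin.≟ y of λ
  { (yes refl) → trans (cnt-∷-≡ i (toList v)) (cong suc (steps-cnt-≤ v s (ℕ.≤-reflexive e)))
  ; (no i≢y)   → trans (cnt-∷-≢ (toList v) i≢y)
      (steps-cnt v s (ℕ.≤∧≢⇒< lt λ e′ → i≢y (Fin.toℕ-injective (trans (sym e′) (sym e))))
                     (ℕ.≤-trans le (ℕ.≤-reflexive (ℕ.+-suc t _)))) }

-- A letter y > x can only follow x if y is the successor of a letter seen before.
lattice⇒steps : ∀ {f} {x : Fin r} (v : Vec (Fin r) j) → (∀ i → toℕ x < toℕ i → f i ≡ 0) →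
  NoRise Fin._≤?_ (x ∷ []) v → Lattice f (map (_∷ []) (toList v)) → Steps (toℕ x) v
lattice⇒steps []          _  _          _        = tt
lattice⇒steps {f = f} {x} (y ∷ v) f0 (nr , nrs) (l , ls) =
  y≡1+x , subst (λ t → Steps t v) y≡1+x (lattice⇒steps v f0′ nrs ls)
  where
  x<y : x Fin.< y
  x<y = ℕ.≰⇒> λ y≤x → nr (y≤x ∷ [-])
  pred : ∀ {y x : Fin _} → x Fin.< y → ∃ λ i → Adjacent i y
  pred {suc y} _ = Fin.inject₁ y , cong suc (sym (Fin.toℕ-inject₁ y))
  i = proj₁ (pred x<y)
  adj : Adjacent i y
  adj = proj₂ (pred x<y)
  i≤x : i Fin.≤ x
  i≤x = ℕ.≮⇒≥ λ x<i → ℕ.<⇒≱ (begin-strict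
    0                     <⟨ cnt-∈ {xs = y ∷ []} (here refl) ⟩
    cnt y (y ∷ [])        ≤⟨ ℕ.m≤n+m _ (f y) ⟩
    f y + cnt y (y ∷ [])  ≤⟨ l i y adj ⟩
    f i                   ≡⟨ f0 i x<i ⟩
    0                     ∎) z≤n
    where open ℕ.≤-Reasoning
  y≡1+x : toℕ y ≡ suc (toℕ x)
  y≡1+x = ℕ.≤-antisym (ℕ.≤-trans (ℕ.≤-reflexive adj) (s≤s i≤x)) x<y
  f0′ : ∀ i → toℕ y < toℕ i → f i + cnt i (y ∷ []) ≡ 0
  f0′ i y<i = cong₂ _+_ (f0 i (ℕ.<-trans x<y y<i)) (cnt-∷-≢ {i = i} {y} [] λ { refl → ℕ.<-irrefl refl y<i })

-- The invariant is that exactly the letters up to `t` have been read. The next letter `t + 1` then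
-- has count 0 and its predecessor has count at least 1.
steps⇒lattice : ∀ {f} (v : Vec (Fin r) j) → Steps t v → (∀ i j → Adjacent i j → f j ≤ f i) →
  (∀ i → toℕ i ≤ t → 1 ≤ f i) → (∀ i → t < toℕ i → f i ≡ 0) → Lattice f (map (_∷ []) (toList v))
steps⇒lattice []      _       _   _  _  = tt
steps⇒lattice {t = t} {f = f} (y ∷ v) (e , s) dec f1 f0 =
  l , steps⇒lattice v s (λ i j adj → ℕ.≤-trans (l i j adj) (ℕ.m≤m+n _ _)) f1′ f0′
  where
  l : ∀ i j → Adjacent i j → f j + cnt j (y ∷ []) ≤ f i
  l i j adj = case j Fin.≟ y of λ
    { (yes refl) → begin
        f j + cnt j (j ∷ [])  ≡⟨ cong₂ _+_ (f0 j (ℕ.≤-reflexive (sym e))) (cnt-∷-≡ j []) ⟩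
        1                     ≤⟨ f1 i (ℕ.≤-reflexive (ℕ.suc-injective (trans (sym adj) e))) ⟩
        f i                   ∎
    ; (no j≢y) → begin
        f j + cnt j (y ∷ [])  ≡⟨ cong (f j ℕ.+_) (cnt-∷-≢ [] j≢y) ⟩
        f j + 0               ≡⟨ ℕ.+-identityʳ _ ⟩
        f j                   ≤⟨ dec i j adj ⟩
        f i                   ∎ }
    where open ℕ.≤-Reasoning
  f1′ : ∀ i → toℕ i ≤ suc t → 1 ≤ f i + cnt i (y ∷ [])
  f1′ i i≤ = case i Fin.≟ y of λ
    { (yes refl) → ℕ.≤-trans (ℕ.≤-reflexive (sym (cnt-∷-≡ i []))) (ℕ.m≤n+m _ (f i))
    ; (no i≢y)   → ℕ.≤-trans (f1 i (ℕ.≤-pred (ℕ.≤∧≢⇒< i≤ λ e′ → i≢y (Fin.toℕ-injective (trans e′ (sym e))))))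
                             (ℕ.m≤m+n (f i) _) }
  f0′ : ∀ i → suc t < toℕ i → f i + cnt i (y ∷ []) ≡ 0
  f0′ i lt = cong₂ _+_ (f0 i (ℕ.<-trans (ℕ.n<1+n t) lt))
                       (cnt-∷-≢ {i = i} {y} [] λ { refl → ℕ.<-irrefl (sym e) lt })

steps⇒noRise : ∀ {x : Fin r} (v : Vec (Fin r) j) → Steps (toℕ x) v → NoRise Fin._≤?_ (x ∷ []) v
steps⇒noRise []      _       = tt
steps⇒noRise {x = x} (y ∷ v) (e , s) =
  (λ { (y≤x ∷ _) → ℕ.<⇒≱ (ℕ.≤-reflexive (sym e)) y≤x }) , steps⇒noRise v (subst (λ t → Steps t v) (sym e) s)

IsZero : Fin r → Set
IsZero i = toℕ i ≡ 0

-- Nothing precedes the first row, and within it larger letters are read first: a positive letter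
-- would be read before any copy of its predecessor.
lattice⇒zeros : ∀ P (U : List (List (Fin r))) → Lattice (λ _ → 0) (P ∷ U) → All IsZero P
lattice⇒zeros P U (l , _) = All.tabulate λ { {zero} _ → refl ; {suc p} p∈ → contradiction
  (ℕ.≤-trans (cnt-∈ p∈) (l (Fin.inject₁ p) (suc p) (cong suc (sym (Fin.toℕ-inject₁ p))))) λ () }

cnt-zeros : ∀ {i : Fin r} {P} → All IsZero P → IsZero i → cnt i P ≡ length P
cnt-zeros               []       _  = refl
cnt-zeros {i = i} {p ∷ P} (e ∷ es) i0 = trans
  (subst (λ p → cnt i (p ∷ P) ≡ suc (cnt i P)) (Fin.toℕ-injective (trans i0 (sym e))) (cnt-∷-≡ i P))
  (cong suc (cnt-zeros es i0))

cnt-nonzero : ∀ {i : Fin r} {P} → All IsZero P → 0 < toℕ i → cnt i P ≡ 0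
cnt-nonzero zs 0<i = cnt-∉ (All.map (λ { e refl → ℕ.<-irrefl (sym e) 0<i }) zs)

zeros-linked : ∀ {P : List (Fin r)} → All IsZero P → Linked Fin._≤_ P
zeros-linked []           = []
zeros-linked (e ∷ [])     = [-]
zeros-linked (e ∷ e′ ∷ es) = ℕ.≤-reflexive (trans e (sym e′)) ∷ zeros-linked (e′ ∷ es)

zeros-unique : ∀ {P P′ : Vec (Fin r) k} → All IsZero (toList P) → All IsZero (toList P′) → P ≡ P′
zeros-unique {P = []}    {[]}      _        _          = refl
zeros-unique {P = p ∷ P} {p′ ∷ P′} (e ∷ es) (e′ ∷ es′) =
  cong₂ _∷_ (Fin.toℕ-injective (trans e (sym e′))) (zeros-unique es es′)

Survives : ∀ μ → List (Fin (length μ)) → Vec (Fin (length μ)) j → Set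
Survives μ P v = (Linked Fin._≤_ P × NoRise Fin._≤?_ P v) × IsLatticeWord μ P v

survives? : ∀ μ P (v : Vec _ j) → Dec (Survives μ P v)
survives? μ P v = (linked? Fin._≤?_ P ×-dec noRise? Fin._≤?_ P v) ×-dec isLatticeWord? μ P v

survives⇒zeros : ∀ μ P (v : Vec _ j) → Survives μ P v → All IsZero P
survives⇒zeros μ P v (_ , _ , l) = lattice⇒zeros P _ l

survives⇒steps : ∀ μ p P (v : Vec _ j) → Survives μ (p ∷ P) v → Steps 0 v
survives⇒steps μ p P v S@((linked , nr) , _ , l , ls) with survives⇒zeros μ (p ∷ P) v S
... | zs@(p0 ∷ _) = subst (λ t → Steps t v) p0 (lattice⇒steps v
  (λ i p<i → cnt-nonzero zs (ℕ.≤-<-trans z≤n p<i))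
  (Equivalence.to (noRise-head Fin._≤?_ v linked) nr) ls)

content-hook : ∀ {P} (v : Vec (Fin r) j) → r ≡ suc j → All IsZero P → Steps 0 v →
  tabulate (λ i → cnt i (P ++ toList v)) ≡ length P ∷ replicate j 1
content-hook {j = j} {P} v refl zs s = cong₂ _∷_
  (trans (cnt-++ zero P (toList v)) (trans
    (cong₂ _+_ (cnt-zeros zs refl) (steps-cnt-≤ v s z≤n)) (ℕ.+-identityʳ _)))
  (trans (List.tabulate-cong λ i → trans (cnt-++ (suc i) P (toList v))
           (cong₂ _+_ (cnt-nonzero zs (s≤s z≤n)) (steps-cnt v s (s≤s z≤n) (Fin.toℕ<n i))))
         (ones j))
  where
  ones : ∀ j → tabulate {n = j} (λ _ → 1) ≡ replicate j 1
  ones zero    = refl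
  ones (suc j) = cong (1 ∷_) (ones j)

-- If `μ` had more than `j + 1` parts, the letter `j + 1` would be missing from the word, while the
-- content condition makes its multiplicity a positive part of `μ`.
survives⇒length : ∀ {n μ} → IsPartition n μ → ∀ p P (v : Vec _ j) → Survives μ (p ∷ P) v → length μ ≡ suc j
survives⇒length {j = j} {μ = μ} (_ , positive , _) p P v S@(_ , content , _) =
  ℕ.≤-antisym (ℕ.≮⇒≥ λ 1+j<r →
    let i = Fin.fromℕ< 1+j<r
        i≡ = Fin.toℕ-fromℕ< 1+j<r
        cnt-i≡0 = trans (cnt-++ i (p ∷ P) (toList v))
          (cong₂ _+_ (cnt-nonzero zs (ℕ.≤-trans (s≤s z≤n) (ℕ.≤-reflexive (sym i≡))))
                     (steps-cnt-> v s (ℕ.≤-reflexive (sym i≡))))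
    in ℕ.<-irrefl (trans (sym cnt-i≡0) (content i)) (All.lookup positive (∈ₗ.∈-lookup i)))
  (steps-bound v s (ℕ.≤-trans (s≤s z≤n) (Fin.toℕ<n p)))
  where
  zs = survives⇒zeros μ (p ∷ P) v S
  s = survives⇒steps μ p P v S

survives⇒hook : ∀ {n μ} → IsPartition n μ → ∀ (P : Vec _ (suc k)) (v : Vec _ j) →
  Survives μ (toList P) v → μ ≡ suc k ∷ replicate j 1
survives⇒hook {k = k} {j} {μ = μ} part (p ∷ P) v S@(_ , content , _) = begin
  μ
    ≡⟨ List.tabulate-lookup μ ⟨
  tabulate (lookup μ)
    ≡⟨ List.tabulate-cong content ⟨
  tabulate (λ i → cnt i (p ∷ toList P ++ toList v))
    ≡⟨ content-hook v (survives⇒length part p (toList P) v S)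
         (survives⇒zeros μ (p ∷ toList P) v S) (survives⇒steps μ p (toList P) v S) ⟩
  suc (length (toList P)) ∷ replicate j 1
    ≡⟨ cong (λ m → suc m ∷ replicate j 1) (Vec.length-toList P) ⟩
  suc k ∷ replicate j 1 ∎
  where open ≡-Reasoning

survives-hook : ∀ {μ} → μ ≡ suc k ∷ replicate j 1 → (P : Vec _ (suc k)) (v : Vec _ j) →
  All IsZero (toList P) → Steps 0 v → Survives μ (toList P) v
survives-hook {k} {j} {μ} μ≡ (p ∷ P) v zs@(p0 ∷ _) s =
  (linked , Equivalence.from (noRise-head Fin._≤?_ v linked)
    (steps⇒noRise v (subst (λ t → Steps t v) (sym p0) s))) ,
  content ,
  (λ i j adj → ℕ.≤-reflexive (cnt-nonzero zs (ℕ.≤-trans (s≤s z≤n) (ℕ.≤-reflexive (sym adj))))) ,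
  steps⇒lattice v s
    (λ i j adj → ℕ.≤-trans
      (ℕ.≤-reflexive (cnt-nonzero zs (ℕ.≤-trans (s≤s z≤n) (ℕ.≤-reflexive (sym adj))))) z≤n)
    (λ i i≤0 → ℕ.≤-trans (s≤s z≤n) (ℕ.≤-reflexive (sym (cnt-zeros zs (ℕ.n≤0⇒n≡0 i≤0)))))
    (λ i 0<i → cnt-nonzero zs 0<i)
  where
  linked = zeros-linked zs
  length-μ : length μ ≡ suc j
  length-μ = trans (cong length μ≡) (cong suc (List.length-replicate j))
  tabulate-injective : ∀ {n} {f g : Fin n → ℕ} → tabulate f ≡ tabulate g → ∀ i → f i ≡ g i
  tabulate-injective e zero    = List.∷-injectiveˡ e
  tabulate-injective e (suc i) = tabulate-injective (List.∷-injectiveʳ e) i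
  content : ∀ i → cnt i (p ∷ toList P ++ toList v) ≡ lookup μ i
  content = tabulate-injective (begin
    tabulate (λ i → cnt i (p ∷ toList P ++ toList v))
      ≡⟨ content-hook v length-μ zs s ⟩
    suc (length (toList P)) ∷ replicate j 1
      ≡⟨ cong (λ m → suc m ∷ replicate j 1) (Vec.length-toList P) ⟩
    suc k ∷ replicate j 1
      ≡⟨ μ≡ ⟨
    μ
      ≡⟨ List.tabulate-lookup μ ⟨
    tabulate (lookup μ) ∎)
    where open ≡-Reasoning

zeros-exist : 0 < r → ∀ k → ∃ λ (P : Vec (Fin r) k) → All IsZero (toList P)
zeros-exist {suc r} _   zero    = [] , []
zeros-exist {suc r} 0<r (suc k) = let P , zs = zeros-exist 0<r k in zero ∷ P , refl ∷ zs

_≟ₗ_ : ∀ (μ ν : List ℕ) → Dec (μ ≡ ν)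
_≟ₗ_ = List.≡-dec ℕ._≟_

∑-survives : ∀ {n μ} → IsPartition n μ → ∀ k j →
  (∑ (vecs (allFin (length μ)) (suc k)) λ P → ∑ (vecs (allFin (length μ)) j) λ v → [ survives? μ (toList P) v ]?)
  ≡ [ μ ≟ₗ (suc k ∷ replicate j 1) ]?
∑-survives {μ = μ} part k j with μ ≟ₗ (suc k ∷ replicate j 1)
... | no μ≢ = trans
  (∑-cong′ Ps λ P → trans
    (∑-cong′ vs λ v → []?-no (survives? μ (toList P) v) (μ≢ ∘ survives⇒hook part P v))
    (∑-zero vs))
  (∑-zero Ps)
  where
  Ps = vecs (allFin (length μ)) (suc k)
  vs = vecs (allFin (length μ)) j
... | yes μ≡ = begin
  ∑ Ps (λ P → ∑ vs λ v → [ survives? μ (toList P) v ]?)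
    ≡⟨ ∑-single (unique-vecs (Unique.allFin⁺ _) _) (∈-vecs ∈ₗ.∈-allFin P₀) (λ {P} _ P≢ → trans
         (∑-cong′ vs λ v → []?-no (survives? μ (toList P) v)
            λ S → P≢ (zeros-unique (survives⇒zeros μ (toList P) v S) zs₀))
         (∑-zero vs)) ⟩
  ∑ vs (λ v → [ survives? μ (toList P₀) v ]?)
    ≡⟨ ∑-single (unique-vecs (Unique.allFin⁺ _) _) (∈-vecs ∈ₗ.∈-allFin v₀) (λ {v} _ v≢ →
         []?-no (survives? μ (toList P₀) v) λ S → v≢ (steps-unique (steps P₀ v S) s₀)) ⟩
  [ survives? μ (toList P₀) v₀ ]?
    ≡⟨ []?-yes (survives? μ (toList P₀) v₀) (survives-hook μ≡ P₀ v₀ zs₀ s₀) ⟩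
  1ℤ ∎
  where
  open ≡-Reasoning
  Ps = vecs (allFin (length μ)) (suc k)
  vs = vecs (allFin (length μ)) j
  j<r : j < length μ
  j<r = ℕ.≤-reflexive (sym (trans (cong length μ≡) (cong suc (List.length-replicate j))))
  P₀ = proj₁ (zeros-exist (ℕ.≤-trans (s≤s z≤n) j<r) (suc k))
  zs₀ = proj₂ (zeros-exist (ℕ.≤-trans (s≤s z≤n) j<r) (suc k))
  v₀ = proj₁ (steps-exist 0 j j<r)
  s₀ = proj₂ (steps-exist 0 j j<r)
  steps : ∀ (P : Vec _ (suc k)) v → Survives μ (toList P) v → Steps 0 v
  steps (p ∷ P) v S = survives⇒steps μ p (toList P) v S

alternating-schur : ∀ {n μ} → IsPartition n μ → ∀ k j →
  ∑ (vecs bools j) (λ b → sign b ℤ.* + schur μ (shape (suc k) b)) ≡ [ μ ≟ₗ (suc k ∷ replicate j 1) ]?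
alternating-schur {μ = μ} part k j = begin
  ∑ (vecs bools j) (λ b → sign b ℤ.* + schur μ (shape (suc k) b))
    ≡⟨ ∑-cong′ (vecs bools j) (λ b → cong₂ ℤ._*_ (refl {x = sign b}) (schur-lattice part (shape (suc k) b))) ⟩
  ∑ (vecs bools j) (λ b → sign b ℤ.* ∑ (fillings xs (shape (suc k) b)) λ U → [ isLatticeArray? μ U ]?)
    ≡⟨ alternating-fillings Fin._≤?_ xs (suc k) j _ (λ P v → [ isLatticeWord? μ P v ]?) (isLatticeArray-rows μ) ⟩
  (∑ (vecs xs (suc k)) λ P → ∑ (vecs xs j) λ v →
    [ linked? Fin._≤?_ (toList P) ×-dec noRise? Fin._≤?_ (toList P) v ]? ℤ.* [ isLatticeWord? μ (toList P) v ]?)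
    ≡⟨ ∑-cong′ (vecs xs (suc k)) (λ P → ∑-cong′ (vecs xs j) λ v →
         []?-× (linked? Fin._≤?_ (toList P) ×-dec noRise? Fin._≤?_ (toList P) v) (isLatticeWord? μ (toList P) v)) ⟨
  (∑ (vecs xs (suc k)) λ P → ∑ (vecs xs j) λ v → [ survives? μ (toList P) v ]?)
    ≡⟨ ∑-survives part k j ⟩
  [ μ ≟ₗ (suc k ∷ replicate j 1) ]? ∎
  where
  open ≡-Reasoning
  xs = allFin (length μ)

-- The coefficient of a hook Schur function

listsOfLength : ℕ → ℕ → List (List ℕ)
listsOfLength n l = map toList (vecs (upTo (suc n)) l)

-- The list that `partitions n` filters, named so that its lack of repetitions can be stated.
candidates : ℕ → List (List ℕ)
candidates n = concatMap (listsOfLength n) (upTo (suc n))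

-- Lists of different lengths are distinct, and each length is enumerated without repetition. Hence
-- the hook occurs only once among the partitions and contributes its coefficient only once to the
-- alternating sum.
unique-candidates : ∀ n → Unique (candidates n)
unique-candidates n = Unique.concat⁺ {xss = map (listsOfLength n) (upTo (suc n))}
  (All.map⁺ {f = listsOfLength n} (All.tabulate {xs = upTo (suc n)} λ {l} _ →
    unique-map-toList (unique-vecs (Unique.upTo⁺ (suc n)) l)))
  (AllPairs.map⁺ (AllPairs.map disjoint (Unique.upTo⁺ (suc n))))
  where
  length-∈ : ∀ l {μ} → μ ∈ₗ listsOfLength n l → length μ ≡ l
  length-∈ l i with v , _ , e ← ∈ₗ.∈-map⁻ toList {xs = vecs (upTo (suc n)) l} i =
    trans (cong length e) (Vec.length-toList v)
  disjoint : ∀ {l l′} → l ≢ l′ → Disjoint (listsOfLength n l) (listsOfLength n l′)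
  disjoint {l} {l′} l≢l′ (i , i′) = l≢l′ (trans (sym (length-∈ l i)) (length-∈ l′ i′))

unique-partitions : ∀ n → Unique (partitions n)
unique-partitions n = Unique.filter⁺ (isPartition? n) {xs = candidates n} (unique-candidates n)

partition-hook : suc k + j ≡ n → IsPartition n (suc k ∷ replicate j 1)
partition-hook {k} {j} e = decreasing j , s≤s z≤n ∷ All.replicate⁺ j (s≤s z≤n) ,
                           trans (cong (λ m → suc k + m) (sum-ones j)) e
  where
  ones : ∀ j → Linked _≥_ (replicate j 1)
  ones zero          = []
  ones (suc zero)    = [-]
  ones (suc (suc j)) = ℕ.≤-refl ∷ ones (suc j)
  decreasing : ∀ j → Linked _≥_ (suc k ∷ replicate j 1)
  decreasing zero    = [-]
  decreasing (suc j) = s≤s z≤n ∷ ones (suc j)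
  sum-ones : ∀ j → sum (replicate j 1) ≡ j
  sum-ones zero    = refl
  sum-ones (suc j) = cong suc (sum-ones j)

hook∈partitions : suc k + j ≡ n → (suc k ∷ replicate j 1) ∈ₗ partitions n
hook∈partitions {k} {j} {n} e = ∈ₗ.∈-filter⁺ (isPartition? n) {xs = candidates n}
  (∈ₗ.∈-concat⁺′ (∈-map-toList-vecs μ small) (∈ₗ.∈-map⁺ (listsOfLength n) (∈ₗ.∈-upTo⁺ (s≤s length≤n))))
  (partition-hook e)
  where
  μ = suc k ∷ replicate j 1
  length≤n : length μ ≤ n
  length≤n = subst₂ _≤_ (cong suc (sym (List.length-replicate j))) e (s≤s (ℕ.m≤n+m j k))
  small : All (_∈ₗ upTo (suc n)) μ
  small = ∈ₗ.∈-upTo⁺ (s≤s (ℕ.≤-trans (ℕ.m≤m+n (suc k) j) (ℕ.≤-reflexive e))) ∷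
          All.replicate⁺ j (∈ₗ.∈-upTo⁺ (s≤s (ℕ.≤-trans (s≤s z≤n) (ℕ.≤-reflexive e))))

-- The Jacobi–Trudi expansion of a hook Schur function, read dually.
hook-coefficient : ∀ {f a} → IsSchurExpansion n f a → ∀ k j → suc k + j ≡ n → ∀ d →
  coeff (a (suc k ∷ replicate j 1)) d ≡
  ∑ (vecs bools j) λ b → sign b ℤ.* coeff (f (shape (suc k) b)) d
hook-coefficient {n} {f} {a} expansion k j e d = sym (begin
  ∑ bs (λ b → sign b ℤ.* coeff (f (shape (suc k) b)) d)
    ≡⟨ ∑-cong′ bs (λ b → begin
         sign b ℤ.* coeff (f (shape (suc k) b)) d
           ≡⟨ cong₂ ℤ._*_ (refl {x = sign b}) (expansion (shape (suc k) b) d) ⟩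
         sign b ℤ.* coeff (Σ[ μs ] λ μ → schur μ (shape (suc k) b) · a μ) d
           ≡⟨ cong₂ ℤ._*_ (refl {x = sign b}) (trans (coeff-Σ μs _ d)
                (∑-cong′ μs λ μ → coeff-· (schur μ (shape (suc k) b)) (a μ) d)) ⟩
         sign b ℤ.* ∑ μs (λ μ → + schur μ (shape (suc k) b) ℤ.* coeff (a μ) d)
           ≡⟨ ∑-*ˡ μs (sign b) _ ⟨
         ∑ μs (λ μ → sign b ℤ.* (+ schur μ (shape (suc k) b) ℤ.* coeff (a μ) d))
           ≡⟨ ∑-cong′ μs (λ μ → ℤ.*-assoc (sign b) _ _) ⟨
         ∑ μs (λ μ → sign b ℤ.* + schur μ (shape (suc k) b) ℤ.* coeff (a μ) d) ∎) ⟩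
  ∑ bs (λ b → ∑ μs λ μ → sign b ℤ.* + schur μ (shape (suc k) b) ℤ.* coeff (a μ) d)
    ≡⟨ ∑-swap bs μs _ ⟩
  ∑ μs (λ μ → ∑ bs λ b → sign b ℤ.* + schur μ (shape (suc k) b) ℤ.* coeff (a μ) d)
    ≡⟨ ∑-cong μs (λ {μ} μ∈ → trans (∑-*ʳ bs (coeff (a μ) d) _)
         (cong (ℤ._* coeff (a μ) d)
               (alternating-schur (proj₂ (∈ₗ.∈-filter⁻ (isPartition? n) {xs = candidates n} μ∈)) k j))) ⟩
  ∑ μs (λ μ → [ μ ≟ₗ λ₀ ]? ℤ.* coeff (a μ) d)
    ≡⟨ ∑-single (unique-partitions n) (hook∈partitions e) (λ {μ} _ μ≢ →
         cong (ℤ._* coeff (a μ) d) ([]?-no (μ ≟ₗ λ₀) μ≢)) ⟩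
  [ λ₀ ≟ₗ λ₀ ]? ℤ.* coeff (a λ₀) d
    ≡⟨ cong (ℤ._* coeff (a λ₀) d) ([]?-yes (λ₀ ≟ₗ λ₀) refl) ⟩
  1ℤ ℤ.* coeff (a λ₀) d
    ≡⟨ ℤ.*-identityˡ _ ⟩
  coeff (a λ₀) d ∎)
  where
  open ≡-Reasoning
  bs = vecs bools j
  μs = partitions n
  λ₀ = suc k ∷ replicate j 1

-- Components, loops and strands

-- The iteration inside component is local to its definition. Generalising its
-- two arguments one after the other, Agda recovers it by unification.
mutual
  growAll : ∀ w (Γ : Subset (Web.arcs w)) (e : Fin (Web.arcs w)) → Subset (Web.arcs w) → Subset (Web.arcs w)
  growAll w Γ e C = _

  component≡growAll : ∀ w Γ e → component w Γ e ≡ growAll w Γ e ⁅ e ⁆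
  component≡growAll w Γ e with ⁅ e ⁆
  ... | C = refl

-- Hiding everything that depends on the number of arcs in a record makes it
-- possible to abstract over the number of rounds alone.
record Growth (w : Web) : Set₁ where
  open Web w
  field
    support : Subset arcs
    start   : Fin arcs
    current : Subset arcs
    Result  : Subset arcs → Set

mutual
  growRounds : ∀ w → Growth w → ℕ → Subset (Web.arcs w)
  growRounds w g k = _

  growAll-growRounds : ∀ w g → let open Growth g in
    Result (growRounds w g (Web.arcs w)) → Result (growAll w support start current)
  growAll-growRounds w g with Web.arcs w
  ... | k = λ r → r

-- The number of rounds is now an argument open to induction. Every choice of `Result` yields the
-- same set, so the trivial one is taken.
growN : ∀ w (Γ : Subset (Web.arcs w)) (e : Fin (Web.arcs w)) → ℕ → Subset (Web.arcs w) → Subset (Web.arcs w)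
growN w Γ e k C =
  growRounds w record { support = Γ ; start = e ; current = C ; Result = λ _ → ⊤ } k

component≡growN : ∀ w Γ e → component w Γ e ≡ growN w Γ e (Web.arcs w) ⁅ e ⁆
component≡growN w Γ e = trans (component≡growAll w Γ e) (growAll-growRounds w
  record { support = Γ ; start = e ; current = ⁅ e ⁆ ; Result = _≡ growN w Γ e (Web.arcs w) ⁅ e ⁆ } refl)

∈-⋃⁻ : ∀ (ps : List (Subset n)) {x} → x ∈ ⋃ ps → Any (x ∈_) ps
∈-⋃⁻ []       x∈ = ⊥-elim (Subset.∉⊥ x∈)
∈-⋃⁻ (p ∷ ps) x∈ with Subset.x∈p∪q⁻ p (⋃ ps) x∈
... | inj₁ x∈p  = here x∈p
... | inj₂ x∈ps = there (∈-⋃⁻ ps x∈ps)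

∈-⋃⁺ : ∀ {ps : List (Subset n)} {x} → Any (x ∈_) ps → x ∈ ⋃ ps
∈-⋃⁺ (here x∈p)   = Subset.x∈p∪q⁺ (inj₁ x∈p)
∈-⋃⁺ (there x∈ps) = Subset.x∈p∪q⁺ (inj₂ (∈-⋃⁺ x∈ps))

∈-fromList⁺ : ∀ {es : List (Fin n)} {x} → x ∈ₗ es → x ∈ fromList es
∈-fromList⁺ {x = x} (here refl) = Subset.x∈p∪q⁺ (inj₁ (Subset.x∈⁅x⁆ x))
∈-fromList⁺         (there x∈)  = Subset.x∈p∪q⁺ (inj₂ (∈-fromList⁺ x∈))

∈-fromList⁻ : ∀ (es : List (Fin n)) {x} → x ∈ fromList es → x ∈ₗ es
∈-fromList⁻ []       x∈ = ⊥-elim (Subset.∉⊥ x∈)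
∈-fromList⁻ (e ∷ es) x∈ with Subset.x∈p∪q⁻ ⁅ e ⁆ (fromList es) x∈
... | inj₁ x∈e  = here (Subset.x∈⁅y⁆⇒x≡y e x∈e)
... | inj₂ x∈es = there (∈-fromList⁻ es x∈es)

∈-elements⁺ : ∀ {p : Subset n} {x} → x ∈ p → x ∈ₗ elements p
∈-elements⁺ {p = p} {x} x∈ = ∈ₗ.∈-filter⁺ (_∈? p) (∈ₗ.∈-allFin x) x∈

∈-elements⁻ : ∀ (p : Subset n) {x} → x ∈ₗ elements p → x ∈ p
∈-elements⁻ p x∈ = proj₂ (∈ₗ.∈-filter⁻ (_∈? p) {xs = allFin _} x∈)

module _ (w : Web) where
  open Web w

  Closed : Subset arcs → Subset arcs → Set
  Closed Γ C = ∀ {j x y} → j ∈ₗ junctions → x ∈ₗ ends j → y ∈ₗ ends j → x ∈ C → y ∈ Γ → y ∈ C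

  private
    near : Subset arcs → List (Junction arcs)
    near C = filter (λ j → any? (_∈? C) (ends j)) junctions

  ∈-grow⁻ : ∀ Γ C {x} → x ∈ grow w Γ C →
    x ∈ C ⊎ x ∈ Γ × ∃₂ λ j y → j ∈ₗ junctions × y ∈ₗ ends j × y ∈ C × x ∈ₗ ends j
  ∈-grow⁻ Γ C x∈ with Subset.x∈p∪q⁻ C _ x∈
  ... | inj₁ x∈C = inj₁ x∈C
  ... | inj₂ x∈∩ with Subset.x∈p∩q⁻ Γ _ x∈∩
  ...   | x∈Γ , x∈near with ∈ₗ.∈-concatMap⁻ ends {xs = near C} (∈-fromList⁻ (concatMap ends (near C)) x∈near)
  ...     | x∈ends with find x∈ends
  ...       | j , j∈near , x∈j with ∈ₗ.∈-filter⁻ (λ j → any? (_∈? C) (ends j)) {xs = junctions} j∈near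
  ...         | j∈ , touches with find touches
  ...           | y , y∈j , y∈C = inj₂ (x∈Γ , j , y , j∈ , y∈j , y∈C , x∈j)

  ∈-grow⁺ : ∀ {Γ C j x y} → j ∈ₗ junctions → y ∈ₗ ends j → y ∈ C → x ∈ₗ ends j → x ∈ Γ → x ∈ grow w Γ C
  ∈-grow⁺ {C = C} j∈ y∈j y∈C x∈j x∈Γ = Subset.x∈p∪q⁺ (inj₂ (Subset.x∈p∩q⁺ (x∈Γ , ∈-fromList⁺
    (∈ₗ.∈-concatMap⁺ ends (lose
      (∈ₗ.∈-filter⁺ (λ j → any? (_∈? C) (ends j)) j∈ (lose y∈j y∈C)) x∈j)))))

  ⊆-grow : ∀ Γ C → C ⊆ grow w Γ C
  ⊆-grow Γ C = Subset.x∈p∪q⁺ ∘ inj₁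

  grow-least : ∀ {Γ C D} → Closed Γ D → C ⊆ D → grow w Γ C ⊆ D
  grow-least {Γ} {C} closed C⊆D x∈ with ∈-grow⁻ Γ C x∈
  ... | inj₁ x∈C = C⊆D x∈C
  ... | inj₂ (x∈Γ , j , y , j∈ , y∈j , y∈C , x∈j) = closed j∈ y∈j x∈j (C⊆D y∈C) x∈Γ

  grow⊆⇒closed : ∀ {Γ C} → grow w Γ C ⊆ C → Closed Γ C
  grow⊆⇒closed le j∈ x∈j y∈j x∈C y∈Γ = le (∈-grow⁺ j∈ x∈j x∈C y∈j y∈Γ)

  private
    growN-start : ∀ Γ e k C → e ∈ C → e ∈ growN w Γ e k C
    growN-start Γ e zero    C e∈ = e∈
    growN-start Γ e (suc k) C e∈ = growN-start Γ e k (grow w Γ C) (⊆-grow Γ C e∈)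

    growN-least : ∀ {Γ e D} k C → Closed Γ D → C ⊆ D → growN w Γ e k C ⊆ D
    growN-least zero    C closed C⊆D = C⊆D
    growN-least {Γ} {e} (suc k) C closed C⊆D =
      growN-least {e = e} k (grow w Γ C) closed (grow-least closed C⊆D)

    -- A round that adds no arc has reached a closed set; otherwise the size grows as the number of
    -- rounds left drops. So either the set is closed or rounds left plus size exceed `arcs`, and
    -- with no rounds left the second alternative is absurd. At the start it holds, since `arcs`
    -- rounds and one arc give `arcs + 1`.
    growN-closed : ∀ Γ e k C → Closed Γ C ⊎ arcs < k + ∣ C ∣ → Closed Γ (growN w Γ e k C)
    growN-closed Γ e zero    C (inj₁ closed) = closed
    growN-closed Γ e zero    C (inj₂ lt)     = ⊥-elim (ℕ.<⇒≱ lt (Subset.∣p∣≤n C))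
    growN-closed Γ e (suc k) C h = growN-closed Γ e k (grow w Γ C) (next h)
      where
      stable : Closed Γ C → Closed Γ (grow w Γ C)
      stable closed j∈ x∈j y∈j x∈ y∈Γ = ⊆-grow Γ C (closed j∈ x∈j y∈j (grow-least closed id x∈) y∈Γ)
      next : Closed Γ C ⊎ arcs < suc k + ∣ C ∣ → Closed Γ (grow w Γ C) ⊎ arcs < k + ∣ grow w Γ C ∣
      next (inj₁ closed) = inj₁ (stable closed)
      next (inj₂ lt) with C ⊂? grow w Γ C
      ... | yes C⊂ = inj₂ (ℕ.≤-trans lt (ℕ.≤-trans (ℕ.≤-reflexive (sym (ℕ.+-suc k ∣ C ∣)))
                                                   (ℕ.+-monoʳ-≤ k (Subset.p⊂q⇒∣p∣<∣q∣ C⊂))))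
      ... | no C⊄ = inj₁ (stable (grow⊆⇒closed λ {x} x∈ → case x ∈? C of λ
        { (yes x∈C) → x∈C
        ; (no x∉C)  → ⊥-elim (C⊄ (⊆-grow Γ C , x , x∈ , x∉C)) }))

  component-start : ∀ Γ e → e ∈ component w Γ e
  component-start Γ e = subst (e ∈_) (sym (component≡growN w Γ e)) (growN-start Γ e arcs ⁅ e ⁆ (Subset.x∈⁅x⁆ e))

  -- With `component-start` and `component-closed` this characterises the component as the least
  -- closed set through `e`. From here on only this description is used, not the iteration.
  component-least : ∀ {Γ e D} → Closed Γ D → e ∈ D → component w Γ e ⊆ D
  component-least {Γ} {e} {D} closed e∈ = subst (_⊆ D) (sym (component≡growN w Γ e))
    (growN-least {e = e} arcs ⁅ e ⁆ closed λ x∈ → subst (_∈ D) (sym (Subset.x∈⁅y⁆⇒x≡y e x∈)) e∈)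

  component-closed : ∀ Γ e → Closed Γ (component w Γ e)
  component-closed Γ e = subst (Closed Γ) (sym (component≡growN w Γ e))
    (growN-closed Γ e arcs ⁅ e ⁆ (inj₂ (ℕ.≤-reflexive
      (sym (trans (cong (arcs ℕ.+_) (Subset.∣⁅x⁆∣≡1 e)) (ℕ.+-comm arcs 1))))))

  component-⊆ : ∀ {Γ e} → e ∈ Γ → component w Γ e ⊆ Γ
  component-⊆ = component-least λ _ _ _ _ y∈Γ → y∈Γ

length-constant : ∀ {xs : List A} {x} → Unique xs → (∀ {y} → y ∈ₗ xs → y ≡ x) → x ∈ₗ xs → length xs ≡ 1
length-constant {xs = y ∷ []}     _        _   _ = refl
length-constant {xs = y ∷ z ∷ xs} (y∉ ∷ _) all _ =
  ⊥-elim (All.lookup y∉ (here refl) (trans (all (here refl)) (sym (all (there (here refl))))))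

x∈p─q⇒x∉q : ∀ (p q : Subset n) {x} → x ∈ p ─ q → x ∉ q
x∈p─q⇒x∉q (a ∷ p) (false ∷ q) {zero}  x∈ ()
x∈p─q⇒x∉q (a ∷ p) (true  ∷ q) {zero}  ()
x∈p─q⇒x∉q (a ∷ p) (b ∷ q) {suc x} (Vec.there x∈) (Vec.there x∈q) = x∈p─q⇒x∉q p q x∈ x∈q

-- Components as equivalence classes, and simple sets of arcs

module _ (w : Web) where
  open Web w

  -- If `e` lay outside the component of `x`, then `Γ` without that component would be a closed set
  -- containing `e`, hence also `x`.
  component-sym : ∀ {Γ e x} → e ∈ Γ → x ∈ component w Γ e → e ∈ component w Γ x
  component-sym {Γ} {e} {x} e∈Γ x∈ with e ∈? component w Γ x
  ... | yes e∈ = e∈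
  ... | no  e∉ = ⊥-elim (x∈p─q⇒x∉q Γ _ (component-least w rest-closed (Subset.x∈p∧x∉q⇒x∈p─q e∈Γ e∉) x∈)
                                       (component-start w Γ x))
    where
    rest-closed : Closed w Γ (Γ ─ component w Γ x)
    rest-closed j∈ u∈j y∈j u∈ y∈Γ = Subset.x∈p∧x∉q⇒x∈p─q y∈Γ λ y∈ →
      x∈p─q⇒x∉q Γ _ u∈ (component-closed w Γ x j∈ y∈j u∈j y∈ (Subset.p─q⊆p Γ _ u∈))

  component-≡ : ∀ {Γ e x} → e ∈ Γ → x ∈ component w Γ e → component w Γ x ≡ component w Γ e
  component-≡ {Γ} {e} {x} e∈Γ x∈ = Subset.⊆-antisym
    (component-least w (component-closed w Γ e) x∈)
    (component-least w (component-closed w Γ x) (component-sym e∈Γ x∈))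

  private
    _≟ₛ_ : ∀ (p q : Subset arcs) → Dec (p ≡ q)
    _≟ₛ_ = Vec.≡-dec Bool._≟_

  ∈-components⁻ : ∀ Γ {C} → C ∈ₗ components w Γ → ∃ λ e → e ∈ Γ × C ≡ component w Γ e
  ∈-components⁻ Γ C∈ with ∈ₗ.∈-map⁻ (component w Γ) (∈ₗ.∈-deduplicate⁻ _≟ₛ_ (map (component w Γ) (elements Γ)) C∈)
  ... | e , e∈ , C≡ = e , ∈-elements⁻ Γ e∈ , C≡

  ∈-components⁺ : ∀ Γ {e} → e ∈ Γ → component w Γ e ∈ₗ components w Γ
  ∈-components⁺ Γ e∈ = ∈ₗ.∈-deduplicate⁺ _≟ₛ_ (∈ₗ.∈-map⁺ (component w Γ) (∈-elements⁺ e∈))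

  unique-components : ∀ Γ → Unique (components w Γ)
  unique-components Γ = deduplicate-! _≟ₛ_ _

  components-connected : ∀ {Γ e} → e ∈ Γ → (∀ {x} → x ∈ Γ → component w Γ x ≡ Γ) → length (components w Γ) ≡ 1
  components-connected {Γ} {e} e∈ connected = length-constant (unique-components Γ)
    (λ C∈ → let x , x∈ , C≡ = ∈-components⁻ Γ C∈ in trans C≡ (connected x∈))
    (subst (_∈ₗ components w Γ) (connected e∈) (∈-components⁺ Γ e∈))

  Fork : Subset arcs → (e l r : Fin arcs) → Set
  Fork S e l r = (e ∈ S ⇔ (l ∈ S ⊎ r ∈ S)) × ¬ (l ∈ S × r ∈ S)

  SimpleAt : Subset arcs → Junction arcs → Set
  SimpleAt S (merge l r e) = Fork S e l r
  SimpleAt S (split e l r) = Fork S e l r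
  SimpleAt S (glue e e′)   = e ∈ S ⇔ e′ ∈ S

  -- Simple sets are the disjoint unions of strands: at most one strand passes through each vertex.
  -- Loops and the colour classes of a colouring are both of this kind, so one theory of components
  -- serves both.
  Simple : Subset arcs → Set
  Simple S = ∀ {j} → j ∈ₗ junctions → SimpleAt S j

  private
    #[_,_] : Subset arcs → Fin arcs → ℕ
    #[ S , x ] = if does (x ∈? S) then 1 else 0

    count≤1 : ∀ S x → #[ S , x ] ≤ 1
    count≤1 S x with x ∈? S
    ... | yes _ = s≤s z≤n
    ... | no _  = z≤n

    count-∷ : ∀ S x xs → length (filter (_∈? S) (x ∷ xs)) ≡ #[ S , x ] + length (filter (_∈? S) xs)
    count-∷ S x xs with x ∈? S
    ... | yes _ = refl
    ... | no _  = refl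

    count-1 : ∀ S x → length (filter (_∈? S) (x ∷ [])) ≡ #[ S , x ]
    count-1 S x = trans (count-∷ S x []) (ℕ.+-identityʳ _)

    count-2 : ∀ S x y → length (filter (_∈? S) (x ∷ y ∷ [])) ≡ #[ S , x ] + #[ S , y ]
    count-2 S x y = trans (count-∷ S x (y ∷ [])) (cong (#[ S , x ] ℕ.+_) (count-1 S y))

    fork⇒counts : ∀ S e l r → Fork S e l r → #[ S , l ] + #[ S , r ] ≡ #[ S , e ]
    fork⇒counts S e l r (fork , disjoint) with l ∈? S | r ∈? S | e ∈? S
    ... | yes l∈ | yes r∈ | _      = ⊥-elim (disjoint (l∈ , r∈))
    ... | yes l∈ | no r∉  | yes e∈ = refl
    ... | yes l∈ | no r∉  | no e∉  = ⊥-elim (e∉ (Equivalence.from fork (inj₁ l∈)))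
    ... | no l∉  | yes r∈ | yes e∈ = refl
    ... | no l∉  | yes r∈ | no e∉  = ⊥-elim (e∉ (Equivalence.from fork (inj₂ r∈)))
    ... | no l∉  | no r∉  | yes e∈ = ⊥-elim ([ l∉ , r∉ ]′ (Equivalence.to fork e∈))
    ... | no l∉  | no r∉  | no e∉  = refl

    counts⇒fork : ∀ S e l r → #[ S , l ] + #[ S , r ] ≡ #[ S , e ] → Fork S e l r
    counts⇒fork S e l r eq with l ∈? S | r ∈? S | e ∈? S
    counts⇒fork S e l r () | yes l∈ | yes r∈ | yes e∈
    counts⇒fork S e l r () | yes l∈ | yes r∈ | no e∉
    counts⇒fork S e l r _  | yes l∈ | no r∉  | yes e∈ = mk⇔ (λ _ → inj₁ l∈) (λ _ → e∈) , r∉ ∘ proj₂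
    counts⇒fork S e l r () | yes l∈ | no r∉  | no e∉
    counts⇒fork S e l r _  | no l∉  | yes r∈ | yes e∈ = mk⇔ (λ _ → inj₂ r∈) (λ _ → e∈) , l∉ ∘ proj₁
    counts⇒fork S e l r () | no l∉  | yes r∈ | no e∉
    counts⇒fork S e l r () | no l∉  | no r∉  | yes e∈
    counts⇒fork S e l r _  | no l∉  | no r∉  | no e∉  =
      mk⇔ (⊥-elim ∘ e∉) [ ⊥-elim ∘ l∉ , ⊥-elim ∘ r∉ ]′ , l∉ ∘ proj₁

    glued⇒counts : ∀ S e e′ → e ∈ S ⇔ e′ ∈ S → #[ S , e ] ≡ #[ S , e′ ]
    glued⇒counts S e e′ glued with e ∈? S | e′ ∈? S
    ... | yes e∈ | yes e′∈ = refl
    ... | yes e∈ | no e′∉  = ⊥-elim (e′∉ (Equivalence.to glued e∈))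
    ... | no e∉  | yes e′∈ = ⊥-elim (e∉ (Equivalence.from glued e′∈))
    ... | no e∉  | no e′∉  = refl

    counts⇒glued : ∀ S e e′ → #[ S , e ] ≡ #[ S , e′ ] → e ∈ S ⇔ e′ ∈ S
    counts⇒glued S e e′ eq with e ∈? S | e′ ∈? S
    counts⇒glued S e e′ _  | yes e∈ | yes e′∈ = mk⇔ (λ _ → e′∈) (λ _ → e∈)
    counts⇒glued S e e′ () | yes e∈ | no e′∉
    counts⇒glued S e e′ () | no e∉  | yes e′∈
    counts⇒glued S e e′ _  | no e∉  | no e′∉  = mk⇔ (⊥-elim ∘ e∉) (⊥-elim ∘ e′∉)

  FlowAt : Subset arcs → Junction arcs → Set
  FlowAt S j = length (filter (_∈? S) (ins j)) ≡ length (filter (_∈? S) (outs j)) ×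
               length (filter (_∈? S) (ins j)) ≤ 1

  flow⇒simple : ∀ S j → FlowAt S j → SimpleAt S j
  flow⇒simple S (merge l r e) (eq , _) = 
    counts⇒fork S e l r (trans (sym (count-2 S l r)) (trans eq (count-1 S e)))
  flow⇒simple S (split e l r) (eq , _) = 
    counts⇒fork S e l r (trans (sym (count-2 S l r)) (trans (sym eq) (count-1 S e)))
  flow⇒simple S (glue e e′)   (eq , _) = 
    counts⇒glued S e e′ (trans (sym (count-1 S e)) (trans eq (count-1 S e′)))

  simple⇒flow : ∀ S j → SimpleAt S j → FlowAt S j
  simple⇒flow S (merge l r e) fork  = trans ins≡ (sym (count-1 S e)) , subst (_≤ 1) (sym ins≡) (count≤1 S e)
    where ins≡ = trans (count-2 S l r) (fork⇒counts S e l r fork)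
  simple⇒flow S (split e l r) fork  =
    trans (count-1 S e) (sym (trans (count-2 S l r) (fork⇒counts S e l r fork))) ,
    subst (_≤ 1) (sym (count-1 S e)) (count≤1 S e)
  simple⇒flow S (glue e e′)   glued =
    trans (count-1 S e) (trans (glued⇒counts S e e′ glued) (sym (count-1 S e′))) ,
    subst (_≤ 1) (sym (count-1 S e)) (count≤1 S e)

  -- All the strands of a simple set through a junction use this arc.
  hub : Junction arcs → Fin arcs
  hub (merge l r e) = e
  hub (split e l r) = e
  hub (glue e e′)   = e

  hub-∈ : ∀ {S} j {x} → SimpleAt S j → x ∈ₗ ends j → x ∈ S → hub j ∈ S
  hub-∈ (merge l r e) (fork , _) (here refl)                 x∈ = Equivalence.from fork (inj₁ x∈)
  hub-∈ (merge l r e) (fork , _) (there (here refl))         x∈ = Equivalence.from fork (inj₂ x∈)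
  hub-∈ (merge l r e) (fork , _) (there (there (here refl))) x∈ = x∈
  hub-∈ (split e l r) (fork , _) (here refl)                 x∈ = x∈
  hub-∈ (split e l r) (fork , _) (there (here refl))         x∈ = Equivalence.from fork (inj₁ x∈)
  hub-∈ (split e l r) (fork , _) (there (there (here refl))) x∈ = Equivalence.from fork (inj₂ x∈)
  hub-∈ (glue e e′)   glued      (here refl)                 x∈ = x∈
  hub-∈ (glue e e′)   glued      (there (here refl))         x∈ = Equivalence.from glued x∈

  -- At each junction a closed set contains all the arcs of `S` or none of them, so the local
  -- condition is inherited.
  closed⇒simple : ∀ {S C} → Simple S → Closed w S C → C ⊆ S → Simple C
  closed⇒simple {S} {C} simple closed C⊆S {j} j∈ = at j j∈ (simple j∈)
    where
    fork : ∀ {j e l r} → j ∈ₗ junctions → e ∈ₗ ends j → l ∈ₗ ends j → r ∈ₗ ends j → Fork S e l r → Fork C e l r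
    fork j∈ e∈j l∈j r∈j (S-fork , disjoint) = mk⇔
      (λ e∈ → case Equivalence.to S-fork (C⊆S e∈) of λ
        { (inj₁ l∈) → inj₁ (closed j∈ e∈j l∈j e∈ l∈)
        ; (inj₂ r∈) → inj₂ (closed j∈ e∈j r∈j e∈ r∈) })
      [ (λ l∈ → closed j∈ l∈j e∈j l∈ (Equivalence.from S-fork (inj₁ (C⊆S l∈))))
      , (λ r∈ → closed j∈ r∈j e∈j r∈ (Equivalence.from S-fork (inj₂ (C⊆S r∈)))) ]′ ,
      λ (l∈ , r∈) → disjoint (C⊆S l∈ , C⊆S r∈)
    at : ∀ j → j ∈ₗ junctions → SimpleAt S j → SimpleAt C j
    at (merge l r e) j∈ = fork j∈ (there (there (here refl))) (here refl) (there (here refl))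
    at (split e l r) j∈ = fork j∈ (here refl) (there (here refl)) (there (there (here refl)))
    at (glue e e′)   j∈ glued = mk⇔
      (λ e∈ → closed j∈ (here refl) (there (here refl)) e∈ (Equivalence.to glued (C⊆S e∈)))
      (λ e′∈ → closed j∈ (there (here refl)) (here refl) e′∈ (Equivalence.from glued (C⊆S e′∈)))

  loop-simple : ∀ {L} → IsLoop w L → Simple L
  loop-simple {L} (_ , flow) {j} j∈ = flow⇒simple L j (All.lookup flow j∈)

  loop-nonempty : ∀ {L} → IsLoop w L → ∃ λ e → e ∈ L
  loop-nonempty {L} (one , _) with components w L in eq
  ... | C ∷ _ = let e , e∈ , _ = ∈-components⁻ L (subst (C ∈ₗ_) (sym eq) (here refl)) in e , e∈

  loop-connected : ∀ {L x} → IsLoop w L → x ∈ L → component w L x ≡ L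
  loop-connected {L} {x} (one , _) x∈ with components w L in eq
  loop-connected {L} {x} (one , _) x∈ | C ∷ [] =
    Subset.⊆-antisym (component-⊆ w x∈) λ {y} y∈ →
      subst (y ∈_) (trans (is-C y∈) (sym (is-C x∈))) (component-start w L y)
    where
    is-C : ∀ {y} → y ∈ L → component w L y ≡ C
    is-C {y} y∈ with subst (component w L y ∈ₗ_) eq (∈-components⁺ L y∈)
    ... | here e = e

  component-loop : ∀ {S} → Simple S → ∀ {e} → e ∈ S → IsLoop w (component w S e)
  component-loop {S} simple {e} e∈ =
    components-connected (component-start w S e) connected ,
    All.tabulate λ {j} j∈ → simple⇒flow C j (closed⇒simple simple C-closed C⊆S j∈)
    where
    C = component w S e
    C⊆S : C ⊆ S
    C⊆S = component-⊆ w e∈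
    C-closed : Closed w S C
    C-closed = component-closed w S e
    connected : ∀ {x} → x ∈ C → component w C x ≡ C
    connected {x} x∈ = Subset.⊆-antisym (component-⊆ w x∈)
      (subst (_⊆ component w C x) (component-≡ e∈ x∈)
        (component-least w
          (λ j∈ u∈j y∈j u∈ y∈S → component-closed w C x j∈ u∈j y∈j u∈
                                    (C-closed j∈ u∈j y∈j (component-⊆ w x∈ u∈) y∈S))
          (component-start w C x)))

  module _ (S : Subset arcs) {A : Set} (h : Fin arcs → A) where

    ConstantAt : Junction arcs → Set
    ConstantAt j = ∀ {x y} → x ∈ₗ ends j → y ∈ₗ ends j → x ∈ S → y ∈ S → h x ≡ h y

    -- The choice of `h` decides what is followed along the web: values in `⊤` count the strands,
    -- values in `ℕ` record their order, and a further boolean marks membership in a component.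
    trace : List (Fin arcs) → List A
    trace es = map h (filter (_∈? S) es)

    private
      own : Fin arcs → List A
      own x = if does (x ∈? S) then h x ∷ [] else []

      trace-∷ : ∀ x es → trace (x ∷ es) ≡ own x ++ trace es
      trace-∷ x es with x ∈? S
      ... | yes _ = refl
      ... | no _  = refl

      own-fork : ∀ {e l r} → Fork S e l r → (l ∈ S → e ∈ S → h l ≡ h e) → (r ∈ S → e ∈ S → h r ≡ h e) →
        own l ++ own r ≡ own e
      own-fork {e} {l} {r} (fork , disjoint) hl hr with l ∈? S | r ∈? S | e ∈? S
      ... | yes l∈ | yes r∈ | _      = ⊥-elim (disjoint (l∈ , r∈))
      ... | yes l∈ | no r∉  | yes e∈ = cong (_∷ []) (hl l∈ e∈)
      ... | yes l∈ | no r∉  | no e∉  = ⊥-elim (e∉ (Equivalence.from fork (inj₁ l∈)))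
      ... | no l∉  | yes r∈ | yes e∈ = cong (_∷ []) (hr r∈ e∈)
      ... | no l∉  | yes r∈ | no e∉  = ⊥-elim (e∉ (Equivalence.from fork (inj₂ r∈)))
      ... | no l∉  | no r∉  | yes e∈ = ⊥-elim ([ l∉ , r∉ ]′ (Equivalence.to fork e∈))
      ... | no l∉  | no r∉  | no e∉  = refl

      trace-fork : ∀ {e l r} es → own l ++ own r ≡ own e → trace (l ∷ r ∷ es) ≡ trace (e ∷ es)
      trace-fork {e} {l} {r} es eq = begin
        trace (l ∷ r ∷ es)          ≡⟨ trace-∷ l (r ∷ es) ⟩
        own l ++ trace (r ∷ es)     ≡⟨ cong (own l ++_) (trace-∷ r es) ⟩
        own l ++ own r ++ trace es  ≡⟨ List.++-assoc (own l) (own r) _ ⟨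
        (own l ++ own r) ++ trace es ≡⟨ cong (_++ trace es) eq ⟩
        own e ++ trace es           ≡⟨ trace-∷ e es ⟨
        trace (e ∷ es)              ∎
        where open ≡-Reasoning

    -- At a vertex `S` has at most one arc on either side, and these carry the same value; all other
    -- arcs pass through unchanged.
    trace-slice : ∀ {es es′} (s : Slice thickness es es′) → SimpleAt S (vertex s) → ConstantAt (vertex s) →
      trace es ≡ trace es′
    trace-slice (merge {l} {r} {e} {es} _) fork constant = trace-fork {e} {l} {r} es (own-fork {e} {l} {r} fork
      (constant (here refl) (there (there (here refl))))
      (constant (there (here refl)) (there (there (here refl)))))
    trace-slice (split {e} {l} {r} {es} _) fork constant = sym (trace-fork {e} {l} {r} es (own-fork {e} {l} {r} fork
      (constant (there (here refl)) (here refl))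
      (constant (there (there (here refl))) (here refl))))
    trace-slice (skip {e} {es} {es′} s) simple constant = trans (trace-∷ e es)
      (trans (cong (own e ++_) (trace-slice s simple constant)) (sym (trace-∷ e es′)))

    trace-words : ∀ {es es′} (ss : Star (Slice thickness) es es′) →
      All (SimpleAt S) (vertices ss) → All ConstantAt (vertices ss) →
      ∀ {fs} → fs ∈ₗ words ss → trace fs ≡ trace es
    trace-words ε        _        _        (here refl)  = refl
    trace-words (s ◅ ss) (p ∷ ps) (c ∷ cs) (here refl)  = refl
    trace-words (s ◅ ss) (p ∷ ps) (c ∷ cs) (there fs∈) =
      trans (trace-words ss ps cs fs∈) (sym (trace-slice s p c))

  top∈words : ∀ {es es′} (ss : Star (Slice thickness) es es′) → es′ ∈ₗ words ss
  top∈words ε        = here refl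
  top∈words (s ◅ ss) = there (top∈words ss)

  outs⊆next : ∀ {es es′} (s : Slice thickness es es′) {x} → x ∈ₗ outs (vertex s) → x ∈ₗ es′
  outs⊆next (merge _) (here refl)         = here refl
  outs⊆next (split _) (here refl)         = here refl
  outs⊆next (split _) (there (here refl)) = there (here refl)
  outs⊆next (skip s)  x∈                  = there (outs⊆next s x∈)

  word-of : ∀ {es es′} (ss : Star (Slice thickness) es es′) {x} →
    x ∈ₗ es ++ concatMap outs (vertices ss) → ∃ λ fs → fs ∈ₗ words ss × x ∈ₗ fs
  word-of {es} ε        x∈ = es , here refl , subst (_ ∈ₗ_) (List.++-identityʳ es) x∈
  word-of {es} (s ◅ ss) x∈ with ∈ₗ.∈-++⁻ es x∈
  ... | inj₁ x∈es   = es , here refl , x∈es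
  ... | inj₂ x∈outs with ∈ₗ.∈-++⁻ (outs (vertex s)) x∈outs
  ...   | inj₁ x∈s  = let fs , fs∈ , x∈fs = word-of ss (∈ₗ.∈-++⁺ˡ (outs⊆next s x∈s)) in fs , there fs∈ , x∈fs
  ...   | inj₂ x∈ss = let fs , fs∈ , x∈fs = word-of ss (∈ₗ.∈-++⁺ʳ _ x∈ss) in fs , there fs∈ , x∈fs

  -- By `born` every arc starts at the bottom or leaves a vertex, and in the latter case it belongs
  -- to the word after that vertex.
  arc-in-word : ∀ x → ∃ λ fs → fs ∈ₗ words slices × x ∈ₗ fs
  arc-in-word x = word-of slices (↭.∈-resp-↭ (↭-sym born) (∈ₗ.∈-allFin x))

-- Numbering the strands of a simple set

subset : ∀ {P : Fin n → Set} → Decidable P → Subset n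
subset P? = Vec.tabulate λ x → does (P? x)

∈-subset⁺ : ∀ {P : Fin n → Set} (P? : Decidable P) {x} → P x → x ∈ subset P?
∈-subset⁺ P? {x} p = Vec.lookup⇒[]= x _ (trans (Vec.lookup∘tabulate _ x) (dec-true (P? x) p))

∈-subset⁻ : ∀ {P : Fin n → Set} (P? : Decidable P) {x} → x ∈ subset P? → P x
∈-subset⁻ P? {x} x∈ with P? x | trans (sym (Vec.lookup∘tabulate (λ x → does (P? x)) x)) (Vec.[]=⇒lookup x∈)
... | yes p | _ = p
... | no _  | ()

ascending-exists : ∀ {xs : List (Fin n)} → Unique xs → ∃ λ (f : Fin n → ℕ) → AllPairs (λ x y → f x < f y) xs
ascending-exists []                 = (λ _ → 0) , []
ascending-exists {xs = y ∷ xs} (y∉ ∷ u) = f , All.tabulate first ∷ later xs y∉ asc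
  where
  g = proj₁ (ascending-exists u)
  asc = proj₂ (ascending-exists u)
  f : Fin _ → ℕ
  f x = if does (x Fin.≟ y) then 0 else suc (g x)
  f-y : f y ≡ 0
  f-y with y Fin.≟ y
  ... | yes _  = refl
  ... | no y≢y = ⊥-elim (y≢y refl)
  f-≢ : ∀ {x} → y ≢ x → f x ≡ suc (g x)
  f-≢ {x} y≢x with x Fin.≟ y
  ... | yes x≡y = ⊥-elim (y≢x (sym x≡y))
  ... | no _    = refl
  first : ∀ {x} → x ∈ₗ xs → f y < f x
  first x∈ = subst₂ _<_ (sym f-y) (sym (f-≢ (All.lookup y∉ x∈))) (s≤s z≤n)
  later : ∀ zs → All (y ≢_) zs → AllPairs (λ x z → g x < g z) zs → AllPairs (λ x z → f x < f z) zs
  later []       _          []       = []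
  later (z ∷ zs) (y≢z ∷ y≢) (p ∷ ps) =
    All.map (λ (y≢x , lt) → subst₂ _<_ (sym (f-≢ y≢z)) (sym (f-≢ y≢x)) (s≤s lt)) (All.zip (y≢ , p)) ∷ later zs y≢ ps

allPairs-lookup : ∀ {R : Rel A 0ℓ} {xs} → AllPairs R xs → ∀ {i j} → i Fin.< j → R (lookup xs i) (lookup xs j)
allPairs-lookup (p ∷ ps) {zero}  {suc j} _         = All.lookup p (∈ₗ.∈-lookup j)
allPairs-lookup (p ∷ ps) {suc i} {suc j} (s≤s i<j) = allPairs-lookup ps i<j

unique-++⁻ : ∀ (xs : List A) {ys} → Unique (xs ++ ys) →
  Unique xs × Unique ys × (∀ {x} → x ∈ₗ xs → x ∉ₗ ys)
unique-++⁻ []       u        = [] , u , λ ()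
unique-++⁻ (x ∷ xs) (x∉ ∷ u) with unique-++⁻ xs u
... | uxs , uys , disjoint = All.++⁻ˡ xs x∉ ∷ uxs , uys , λ
  { (here refl) x∈ys → All.lookup (All.++⁻ʳ xs x∉) x∈ys refl
  ; (there x∈) → disjoint x∈ }

unique-↭ : ∀ {xs ys : List A} → xs ↭ ys → Unique xs → Unique ys
unique-↭ {A = A} p = ↭ₛ.Unique-resp-↭ (setoid A) (↭.↭⇒↭ₛ p)

module _ (w : Web) where
  open Web w

  module _ {S : Subset arcs} where

    open Data.List.Membership.DecPropositional (Fin._≟_ {arcs}) using () renaming (_∈?_ to _∈ₗ?_)

    -- Values given at the bottom are carried upward along the strands of `S`, each vertex
    -- overwriting the values on its outgoing arcs. These arcs are new, so no value used at an
    -- earlier vertex is changed.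
    extend : ∀ {es es′} (ss : Star (Slice thickness) es es′) (f : Fin arcs → A) →
      (∀ {x} → x ∈ₗ es → x ∉ₗ concatMap outs (vertices ss)) →
      Unique (concatMap outs (vertices ss)) → All (SimpleAt w S) (vertices ss) →
      ∃ λ h → (∀ {x} → x ∉ₗ concatMap outs (vertices ss) → h x ≡ f x) × All (ConstantAt w S h) (vertices ss)
    extend         ε        f fresh u ps = f , (λ _ → refl) , []
    extend {A = A} {es} {es′} (_◅_ {j = fs} s ss) f fresh u (p ∷ ps) =
      h , (λ x∉ → trans (h≡f′ (x∉ ∘ ∈ₗ.∈-++⁺ʳ (outs v))) (f′≡f (x∉ ∘ ∈ₗ.∈-++⁺ˡ))) , constant ∷ cs
      where
      v = vertex s
      later = concatMap outs (vertices ss)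

      -- At most one incoming arc of a merge lies in `S`, and its value is passed on. If neither
      -- does, `f r` is a dummy: then the outgoing arc is outside `S` too, and constancy is demanded
      -- on `S` only.
      inherited : Junction arcs → A
      inherited (merge l r e) = if does (l ∈? S) then f l else f r
      inherited (split e l r) = f e
      inherited (glue e e′)   = f e

      inherited-ins : ∀ j {x} → SimpleAt w S j → x ∈ₗ ins j → x ∈ S → f x ≡ inherited j
      inherited-ins (merge l r e) {x} (_ , disjoint) x∈j x∈ with l ∈? S | x∈j
      ... | yes _  | here refl         = refl
      ... | yes l∈ | there (here refl) = ⊥-elim (disjoint (l∈ , x∈))
      ... | no l∉  | here refl         = ⊥-elim (l∉ x∈)
      ... | no _   | there (here refl) = refl
      inherited-ins (split e l r) _ (here refl) _ = refl
      inherited-ins (glue e e′)   _ (here refl) _ = refl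

      f′ : Fin arcs → A
      f′ x = if does (x ∈ₗ? outs v) then inherited v else f x

      f′≡inherited : ∀ {x} → x ∈ₗ outs v → f′ x ≡ inherited v
      f′≡inherited {x} x∈ with x ∈ₗ? outs v
      ... | yes _ = refl
      ... | no x∉ = ⊥-elim (x∉ x∈)

      f′≡f : ∀ {x} → x ∉ₗ outs v → f′ x ≡ f x
      f′≡f {x} x∉ with x ∈ₗ? outs v
      ... | yes x∈ = ⊥-elim (x∉ x∈)
      ... | no _   = refl

      outs-fresh : ∀ {x} → x ∈ₗ outs v → x ∉ₗ later
      outs-fresh = proj₂ (proj₂ (unique-++⁻ (outs v) u))

      next⊆ : ∀ {es es′} (s : Slice thickness es es′) {x} → x ∈ₗ es′ → x ∈ₗ es ⊎ x ∈ₗ outs (vertex s)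
      next⊆ (merge _) (here refl)         = inj₂ (here refl)
      next⊆ (merge _) (there x∈)          = inj₁ (there (there x∈))
      next⊆ (split _) (here refl)         = inj₂ (here refl)
      next⊆ (split _) (there (here refl)) = inj₂ (there (here refl))
      next⊆ (split _) (there (there x∈))  = inj₁ (there x∈)
      next⊆ (skip s)  (here refl)         = inj₁ (here refl)
      next⊆ (skip s)  (there x∈) with next⊆ s x∈
      ... | inj₁ x∈es   = inj₁ (there x∈es)
      ... | inj₂ x∈outs = inj₂ x∈outs

      ins⊆ : ∀ {es es′} (s : Slice thickness es es′) {x} → x ∈ₗ ins (vertex s) → x ∈ₗ es
      ins⊆ (merge _) (here refl)         = here refl
      ins⊆ (merge _) (there (here refl)) = there (here refl)
      ins⊆ (split _) (here refl)         = here refl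
      ins⊆ (skip s)  x∈                  = there (ins⊆ s x∈)

      fresh′ : ∀ {x} → x ∈ₗ fs → x ∉ₗ later
      fresh′ x∈ with next⊆ s x∈
      ... | inj₁ x∈es   = fresh x∈es ∘ ∈ₗ.∈-++⁺ʳ (outs v)
      ... | inj₂ x∈outs = outs-fresh x∈outs

      rec = extend ss f′ fresh′ (proj₁ (proj₂ (unique-++⁻ (outs v) u))) ps
      h = proj₁ rec
      h≡f′ = proj₁ (proj₂ rec)
      cs = proj₂ (proj₂ rec)

      h≡inherited : ∀ {x} → x ∈ₗ ends v → x ∈ S → h x ≡ inherited v
      h≡inherited x∈v x∈ with ∈ₗ.∈-++⁻ (ins v) x∈v
      ... | inj₂ x∈outs = trans (h≡f′ (outs-fresh x∈outs)) (f′≡inherited x∈outs)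
      ... | inj₁ x∈ins  = trans (h≡f′ (x∉ ∘ ∈ₗ.∈-++⁺ʳ (outs v)))
                            (trans (f′≡f (x∉ ∘ ∈ₗ.∈-++⁺ˡ)) (inherited-ins v p x∈ins x∈))
        where x∉ = fresh (ins⊆ s x∈ins)

      constant : ConstantAt w S h v
      constant x∈v y∈v x∈ y∈ = trans (h≡inherited x∈v x∈) (sym (h≡inherited y∈v y∈))

    record Labelling : Set where
      field
        label     : Fin arcs → ℕ
        constant  : ∀ {j} → j ∈ₗ junctions → ConstantAt w S label j
        ascending : ∀ {es} → es ∈ₗ words slices → AllPairs _<_ (trace w S label es)

    private
      split-junctions : ∀ {P : Junction arcs → Set} → (∀ {j} → j ∈ₗ junctions → P j) → All P (vertices slices)
      split-junctions all = All.tabulate (all ∘ ∈ₗ.∈-++⁺ˡ)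

    trace-constant : ∀ {h : Fin arcs → A} → Simple w S → (∀ {j} → j ∈ₗ junctions → ConstantAt w S h j) →
      ∀ {es} → es ∈ₗ words slices → trace w S h es ≡ trace w S h bottom
    trace-constant {h = h} simple constant = trace-words w S h slices (split-junctions simple) (split-junctions constant)

    -- The strands of S keep their order from left to right. Numbering them from the
    -- left at the bottom labels all the arcs of S, consistently across the cut.
    labelling : Simple w S → Labelling
    labelling simple = record
      { label     = h
      ; constant  = [ All.lookup cs , glue-constant ]′ ∘ ∈ₗ.∈-++⁻ (vertices slices)
      ; ascending = λ es∈ → subst (AllPairs _<_)
          (trans trace-f (sym (trace-words w S h slices (split-junctions simple) cs es∈)))
          (AllPairs.map⁺ (AllPairs.filter⁺ (_∈? S) asc)) }
      where
      u = unique-++⁻ bottom (unique-↭ (↭-sym born) (Unique.allFin⁺ arcs))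
      f = proj₁ (ascending-exists (proj₁ u))
      asc = proj₂ (ascending-exists (proj₁ u))
      rec = extend slices f (proj₂ (proj₂ u)) (proj₁ (proj₂ u)) (split-junctions simple)
      h = proj₁ rec
      cs = proj₂ (proj₂ rec)

      trace-f : trace w S f bottom ≡ trace w S h bottom
      trace-f = List.map-cong-local (All.tabulate λ x∈ →
        sym (proj₁ (proj₂ rec) (proj₂ (proj₂ u) (proj₁ (∈ₗ.∈-filter⁻ (_∈? S) {xs = bottom} x∈)))))

      -- Simplicity at the cut says that `S` occupies the same positions of both words, so equal
      -- traces give equal values on the two arcs of each glued pair.
      glue-traces : ∀ es es′ → (∀ {j} → j ∈ₗ map (uncurry glue) (zip es es′) → SimpleAt w S j) →
        trace w S h es ≡ trace w S h es′ → ∀ {j} → j ∈ₗ map (uncurry glue) (zip es es′) → ConstantAt w S h j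
      glue-traces (e ∷ es) (e′ ∷ es′) glued eq j∈ = case-heads (e ∈? S) (e′ ∈? S) eq j∈
        where
        head : e ∈ S → e′ ∈ S → h e ≡ h e′ → ConstantAt w S h (glue e e′)
        head e∈ e′∈ h≡ (here refl)         (here refl)         _ _ = refl
        head e∈ e′∈ h≡ (here refl)         (there (here refl)) _ _ = h≡
        head e∈ e′∈ h≡ (there (here refl)) (here refl)         _ _ = sym h≡
        head e∈ e′∈ h≡ (there (here refl)) (there (here refl)) _ _ = refl
        case-heads : Dec (e ∈ S) → Dec (e′ ∈ S) → trace w S h (e ∷ es) ≡ trace w S h (e′ ∷ es′) →
          ∀ {j} → j ∈ₗ map (uncurry glue) (zip (e ∷ es) (e′ ∷ es′)) → ConstantAt w S h j
        case-heads (yes e∈) (no e′∉) _ _ = ⊥-elim (e′∉ (Equivalence.to (glued (here refl)) e∈))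
        case-heads (no e∉) (yes e′∈) _ _ = ⊥-elim (e∉ (Equivalence.from (glued (here refl)) e′∈))
        case-heads (yes e∈) (yes e′∈) eq j∈
          with eq′ ← subst₂ (λ xs ys → map h xs ≡ map h ys)
                       (List.filter-accept (_∈? S) {xs = es} e∈) (List.filter-accept (_∈? S) {xs = es′} e′∈) eq
          with j∈
        ... | here refl  = head e∈ e′∈ (List.∷-injectiveˡ eq′)
        ... | there j∈′ = glue-traces es es′ (glued ∘ there) (List.∷-injectiveʳ eq′) j∈′
        case-heads (no e∉) (no e′∉) eq (there j∈) = glue-traces es es′ (glued ∘ there)
          (subst₂ (λ xs ys → map h xs ≡ map h ys)
            (List.filter-reject (_∈? S) {xs = es} e∉) (List.filter-reject (_∈? S) {xs = es′} e′∉) eq) j∈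
        case-heads (no e∉) (no e′∉) eq (here refl) {x} {y} x∈j y∈j x∈ y∈ = ⊥-elim (absurd x∈j x∈)
          where
          absurd : ∀ {x} → x ∈ₗ e ∷ e′ ∷ [] → x ∉ S
          absurd (here refl)         = e∉
          absurd (there (here refl)) = e′∉

      glue-constant : ∀ {j} → j ∈ₗ map (uncurry glue) (zip top bottom) → ConstantAt w S h j
      glue-constant = glue-traces top bottom (simple ∘ ∈ₗ.∈-++⁺ʳ (vertices slices))
        (trace-words w S h slices (split-junctions simple) cs (top∈words w slices))

    module _ (simple : Simple w S) where
      open Labelling (labelling simple)

      private
        label-injective : ∀ {xs} → AllPairs _<_ (map label xs) →
          ∀ {x y} → x ∈ₗ xs → y ∈ₗ xs → label x ≡ label y → x ≡ y
        label-injective (p ∷ ps) (here refl) (here refl) _ = refl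
        label-injective (p ∷ ps) (here refl) (there y∈)  e =
          ⊥-elim (ℕ.<-irrefl e (All.lookup p (∈ₗ.∈-map⁺ label y∈)))
        label-injective (p ∷ ps) (there x∈)  (here refl) e =
          ⊥-elim (ℕ.<-irrefl (sym e) (All.lookup p (∈ₗ.∈-map⁺ label x∈)))
        label-injective (p ∷ ps) (there x∈)  (there y∈)  e = label-injective ps x∈ y∈ e

        ascending′ : ∀ es → AllPairs _<_ (trace w S label es) →
          AllPairs (λ x y → x ∈ S → y ∈ S → label x < label y) es
        ascending′ []       _ = []
        ascending′ (e ∷ es) p = cons (e ∈? S) p
          where
          cons : Dec (e ∈ S) → AllPairs _<_ (trace w S label (e ∷ es)) → _
          cons (no e∉) p = All.tabulate (λ _ e∈ _ → ⊥-elim (e∉ e∈)) ∷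
            ascending′ es (subst (λ xs → AllPairs _<_ (map label xs)) (List.filter-reject (_∈? S) {xs = es} e∉) p)
          cons (yes e∈) p with subst (λ xs → AllPairs _<_ (map label xs)) (List.filter-accept (_∈? S) {xs = es} e∈) p
          ... | q ∷ qs = All.tabulate (λ y∈es _ y∈ → All.lookup q (∈ₗ.∈-map⁺ label (∈ₗ.∈-filter⁺ (_∈? S) y∈es y∈))) ∷
                         ascending′ es qs

        label-closed : ∀ e → Closed w S (subset (λ x → (x ∈? S) ×-dec (label x ℕ.≟ label e)))
        label-closed e {j} j∈ x∈j y∈j x∈ y∈S =
          let x∈S , eq = ∈-subset⁻ (λ x → (x ∈? S) ×-dec (label x ℕ.≟ label e)) x∈
          in ∈-subset⁺ (λ x → (x ∈? S) ×-dec (label x ℕ.≟ label e)) (y∈S , trans (constant j∈ y∈j x∈j y∈S x∈S) eq)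

        -- The level sets of `label` within `S` are closed, so a component cannot leave one.
        label-component : ∀ {e x} → e ∈ S → x ∈ component w S e → label x ≡ label e
        label-component {e} e∈ x∈ = proj₂ (∈-subset⁻ (λ x → (x ∈? S) ×-dec (label x ℕ.≟ label e))
          (component-least w (label-closed e) (∈-subset⁺ (λ x → (x ∈? S) ×-dec (label x ℕ.≟ label e)) (e∈ , refl)) x∈))

        -- Let `h` pair the label with membership in the component of `e`. Both entries are constant
        -- along strands, so the value of `e` reappears in a word through `e′`, at some arc `y` of
        -- that component with the label of `e′`. Labels within one word are distinct, hence `y` is
        -- `e′`.
        component-label : ∀ {e e′} → e ∈ S → e′ ∈ S → label e ≡ label e′ → component w S e′ ≡ component w S e
        component-label {e} {e′} e∈ e′∈ eq with arc-in-word w e | arc-in-word w e′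
        ... | es , es∈ , e∈es | es′ , es′∈ , e′∈es′
          with ∈ₗ.∈-map⁻ h (subst (h e ∈ₗ_) traces (∈ₗ.∈-map⁺ h (∈ₗ.∈-filter⁺ (_∈? S) e∈es e∈)))
          where
          h : Fin arcs → ℕ × Bool
          h x = label x , does (x ∈? component w S e)
          same : ∀ {j} → j ∈ₗ junctions → ∀ {x y} → x ∈ₗ ends j → y ∈ₗ ends j → x ∈ S → y ∈ S →
            does (x ∈? component w S e) ≡ does (y ∈? component w S e)
          same j∈ {x} {y} x∈j y∈j x∈ y∈ with x ∈? component w S e | y ∈? component w S e
          ... | yes _   | yes _   = refl
          ... | no _    | no _    = refl
          ... | yes x∈C | no y∉C  = ⊥-elim (y∉C (component-closed w S e j∈ x∈j y∈j x∈C y∈))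
          ... | no x∉C  | yes y∈C = ⊥-elim (x∉C (component-closed w S e j∈ y∈j x∈j y∈C x∈))
          h-constant : ∀ {j} → j ∈ₗ junctions → ConstantAt w S h j
          h-constant j∈ x∈j y∈j x∈ y∈ = cong₂ _,_ (constant j∈ x∈j y∈j x∈ y∈) (same j∈ x∈j y∈j x∈ y∈)
          traces : trace w S h es ≡ trace w S h es′
          traces = trans (trace-constant simple h-constant es∈) (sym (trace-constant simple h-constant es′∈))
        ... | y , y∈ , h≡ = component-≡ w e∈ (subst (_∈ component w S e) y≡e′ y∈C)
          where
          y≡e′ : y ≡ e′
          y≡e′ = label-injective (ascending es′∈) y∈ (∈ₗ.∈-filter⁺ (_∈? S) e′∈es′ e′∈)
                   (trans (sym (cong proj₁ h≡)) eq)
          y∈C : y ∈ component w S e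
          y∈C with y ∈? component w S e | e ∈? component w S e | cong proj₂ h≡
          ... | yes y∈C | _      | _ = y∈C
          ... | no _    | no e∉  | _ = ⊥-elim (e∉ (component-start w S e))
          ... | no _    | yes _  | ()

        component-≺ : ∀ {e e′} → e ∈ S → e′ ∈ S → label e < label e′ → _≺_ w (component w S e) (component w S e′)
        component-≺ {e} {e′} e∈ e′∈ lt = All.tabulate λ {es} es∈ i j i∈ j∈ →
          let before : ∀ {i j} → i Fin.< j → lookup es i ∈ S → lookup es j ∈ S →
                       label (lookup es i) < label (lookup es j)
              before i<j = allPairs-lookup (ascending′ es (ascending es∈)) i<j
              i∈S = component-⊆ w e∈ i∈
              j∈S = component-⊆ w e′∈ j∈
              lt′ = subst₂ _<_ (sym (label-component e∈ i∈)) (sym (label-component e′∈ j∈)) lt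
          in case Fin.<-cmp i j of λ
            { (tri< i<j _ _) → i<j
            ; (tri≈ _ refl _) → ⊥-elim (ℕ.<-irrefl refl lt′)
            ; (tri> _ _ j<i) → ⊥-elim (ℕ.<-asym lt′ (before j<i j∈S i∈S)) }

      components-comparable : ∀ {C C′} → C ∈ₗ components w S → C′ ∈ₗ components w S →
        C ≢ C′ → _≺_ w C C′ ⊎ _≺_ w C′ C
      components-comparable C∈ C′∈ C≢C′ with ∈-components⁻ w S C∈ | ∈-components⁻ w S C′∈
      ... | e , e∈ , refl | e′ , e′∈ , refl with ℕ.<-cmp (label e) (label e′)
      ...   | tri< lt _ _ = inj₁ (component-≺ e∈ e′∈ lt)
      ...   | tri≈ _ eq _ = ⊥-elim (C≢C′ (sym (component-label e∈ e′∈ eq)))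
      ...   | tri> _ _ gt = inj₂ (component-≺ e′∈ e∈ gt)

-- The order on loops and the loops of a row

unique⇒allPairs : ∀ {R : Rel A 0ℓ} {xs} → Unique xs →
  (∀ {x y} → x ∈ₗ xs → y ∈ₗ xs → x ≢ y → R x y) → AllPairs R xs
unique⇒allPairs []       r = []
unique⇒allPairs (x∉ ∷ u) r =
  All.tabulate (λ y∈ → r (here refl) (there y∈) (All.lookup x∉ y∈)) ∷
  unique⇒allPairs u (λ x∈ y∈ → r (there x∈) (there y∈))

module _ (w : Web) where
  open Web w

  private
    infix 4 _<ₗ_
    _<ₗ_ : Subset arcs → Subset arcs → Set
    _<ₗ_ = _≺_ w

  -- The trace with trivial values has the same length in every word, and it is nonempty in a word
  -- through an arc of `L`.
  loop-meets-word : ∀ {L} → IsLoop w L → ∀ {es} → es ∈ₗ words slices → ∃ λ i → lookup es i ∈ L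
  loop-meets-word {L} loop {es} es∈ with loop-nonempty w loop
  ... | e , e∈ with arc-in-word w e
  ...   | fs , fs∈ , e∈fs with ∈ₗ.∈-map⁻ h (subst (tt ∈ₗ_) traces (∈ₗ.∈-map⁺ h (∈ₗ.∈-filter⁺ (_∈? L) e∈fs e∈)))
    where
    h : Fin arcs → ⊤
    h _ = tt
    traces : trace w L h fs ≡ trace w L h es
    traces = trans (trace-constant w (loop-simple w loop) (λ _ _ _ _ _ → refl) fs∈)
             (sym (trace-constant w (loop-simple w loop) (λ _ _ _ _ _ → refl) es∈))
  ...     | x , x∈ , _ with ∈ₗ.∈-filter⁻ (_∈? L) {xs = es} x∈
  ...       | x∈es , x∈L = Any.index x∈es , subst (_∈ L) (AnyP.lookup-index x∈es) x∈L

  ≺-disjoint : ∀ {L L′ x} → L <ₗ L′ → x ∈ L → x ∉ L′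
  ≺-disjoint {L} {L′} {x} L≺L′ x∈ x∈′ with arc-in-word w x
  ... | es , es∈ , x∈es = ℕ.<-irrefl refl
    (All.lookup L≺L′ es∈ _ _ (subst (_∈ L) (AnyP.lookup-index x∈es) x∈) (subst (_∈ L′) (AnyP.lookup-index x∈es) x∈′))

  ≺-irrefl : ∀ {L} → IsLoop w L → ¬ L <ₗ L
  ≺-irrefl loop L≺L = let e , e∈ = loop-nonempty w loop in ≺-disjoint L≺L e∈ e∈

  -- The middle loop meets every word and separates the outer two there. An empty set in the middle
  -- would be comparable with everything.
  ≺-trans : ∀ {L L′ L″} → IsLoop w L′ → L <ₗ L′ → L′ <ₗ L″ → L <ₗ L″
  ≺-trans loop p q = All.tabulate λ es∈ i j i∈ j∈ → let k , k∈ = loop-meets-word loop es∈ in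
    ℕ.<-trans (All.lookup p es∈ i k i∈ k∈) (All.lookup q es∈ k j k∈ j∈)

  ≺-asym : ∀ {L L′} → IsLoop w L → IsLoop w L′ → L <ₗ L′ → ¬ L′ <ₗ L
  ≺-asym loop loop′ p q = ≺-irrefl loop (≺-trans loop′ p q)

  Comparable : Subset arcs → Subset arcs → Set
  Comparable L L′ = L <ₗ L′ ⊎ L′ <ₗ L

  linked⇒sorted : ∀ {Ls} → All (IsLoop w) Ls → Linked _<ₗ_ Ls → AllPairs _<ₗ_ Ls
  linked⇒sorted []             []       = []
  linked⇒sorted (_ ∷ [])       [-]      = [] ∷ []
  linked⇒sorted (_ ∷ ls@(l ∷ _)) (p ∷ ps) with linked⇒sorted ls ps
  ... | q ∷ qs = (p ∷ All.map (≺-trans l p) q) ∷ q ∷ qs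

  insert-↭ : ∀ L Ls → insert w L Ls ↭ L ∷ Ls
  insert-↭ L []        = ↭.refl
  insert-↭ L (L′ ∷ Ls) with _≺?_ w L L′
  ... | yes _ = ↭.refl
  ... | no  _ = ↭-trans (↭.prep L′ (insert-↭ L Ls)) (↭.swap L′ L ↭.refl)

  sort-↭ : ∀ Ls → ≺-sort w Ls ↭ Ls
  sort-↭ []       = ↭.refl
  sort-↭ (L ∷ Ls) = ↭-trans (insert-↭ L (≺-sort w Ls)) (↭.prep L (sort-↭ Ls))

  insert-sorted : ∀ {L Ls} → All (IsLoop w) Ls → All (Comparable L) Ls → AllPairs _<ₗ_ Ls →
    AllPairs _<ₗ_ (insert w L Ls)
  insert-sorted {L} {[]}      _        _        _        = [] ∷ []
  insert-sorted {L} {L′ ∷ Ls} (l ∷ ls) (c ∷ cs) (p ∷ ps) with _≺?_ w L L′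
  ... | yes L≺L′ = (L≺L′ ∷ All.map (≺-trans l L≺L′) p) ∷ p ∷ ps
  ... | no  L⊀L′ = ↭.All-resp-↭ (↭-sym (insert-↭ L Ls)) ([ ⊥-elim ∘ L⊀L′ , id ]′ c ∷ p) ∷ insert-sorted ls cs ps

  sort-sorted : ∀ {Ls} → All (IsLoop w) Ls → AllPairs Comparable Ls → AllPairs _<ₗ_ (≺-sort w Ls)
  sort-sorted []       []       = []
  sort-sorted (l ∷ ls) (c ∷ cs) = insert-sorted
    (↭.All-resp-↭ (↭-sym (sort-↭ _)) ls) (↭.All-resp-↭ (↭-sym (sort-↭ _)) c) (sort-sorted ls cs)

  sorted-unique : ∀ {Ls Ls′} → All (IsLoop w) Ls → AllPairs _<ₗ_ Ls → AllPairs _<ₗ_ Ls′ → Ls ↭ Ls′ → Ls ≡ Ls′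
  sorted-unique {[]}     {Ls′}      _        _        _        perm = sym (↭.↭-empty-inv (↭-sym perm))
  sorted-unique {L ∷ Ls} {[]}       _        _        _        perm = ⊥-elim (↭.¬x∷xs↭[] perm)
  sorted-unique {L ∷ Ls} {L′ ∷ Ls′} ls@(l ∷ ls₁) (p ∷ ps) (q ∷ qs) perm =
    go (heads (∈L∷ (here refl)) (∈L′∷ (here refl)))
    where
    ∈L∷ : ∀ {x} → x ∈ₗ L′ ∷ Ls′ → x ∈ₗ L ∷ Ls
    ∈L∷ = ↭.∈-resp-↭ (↭-sym perm)
    ∈L′∷ : ∀ {x} → x ∈ₗ L ∷ Ls → x ∈ₗ L′ ∷ Ls′
    ∈L′∷ = ↭.∈-resp-↭ perm
    heads : L′ ∈ₗ L ∷ Ls → L ∈ₗ L′ ∷ Ls′ → L ≡ L′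
    heads (here e)   _          = sym e
    heads (there _)  (here e)   = e
    heads (there i)  (there i′) = ⊥-elim (≺-asym l (All.lookup ls₁ i) (All.lookup p i) (All.lookup q i′))
    go : L ≡ L′ → L ∷ Ls ≡ L′ ∷ Ls′
    go refl = cong (L ∷_) (sorted-unique ls₁ ps qs (↭.drop-∷ perm))

  sorted⇒unique : ∀ {Ls} → All (IsLoop w) Ls → AllPairs _<ₗ_ Ls → Unique Ls
  sorted⇒unique []       []       = []
  sorted⇒unique (l ∷ ls) (p ∷ ps) = All.map (λ { L≺L′ refl → ≺-irrefl l L≺L′ }) p ∷ sorted⇒unique ls ps

  sorted-disjoint : ∀ {Ls} → AllPairs _<ₗ_ Ls → ∀ {L L′ x} → L ∈ₗ Ls → L′ ∈ₗ Ls → x ∈ L → x ∈ L′ → L ≡ L′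
  sorted-disjoint (p ∷ ps) (here refl) (here refl) _  _   = refl
  sorted-disjoint (p ∷ ps) (here refl) (there i′)  x∈ x∈′ = ⊥-elim (≺-disjoint (All.lookup p i′) x∈ x∈′)
  sorted-disjoint (p ∷ ps) (there i)   (here refl) x∈ x∈′ = ⊥-elim (≺-disjoint (All.lookup p i) x∈′ x∈)
  sorted-disjoint (p ∷ ps) (there i)   (there i′)  x∈ x∈′ = sorted-disjoint ps i i′ x∈ x∈′

  module _ {Ls : List (Subset arcs)} (loops : All (IsLoop w) Ls) (sorted : AllPairs _<ₗ_ Ls) where

    -- Two loops of a row that touch the same junction both contain its `hub`, and distinct loops of
    -- a row are disjoint.
    loop-closed : ∀ {L} → L ∈ₗ Ls → Closed w (⋃ Ls) L
    loop-closed {L} L∈ {j} {x} {y} j∈ x∈j y∈j x∈ y∈⋃ with find (∈-⋃⁻ Ls y∈⋃)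
    ... | L′ , L′∈ , y∈ = subst (y ∈_) (sorted-disjoint sorted L′∈ L∈
      (hub-∈ w j (loop-simple w (All.lookup loops L′∈) j∈) y∈j y∈)
      (hub-∈ w j (loop-simple w (All.lookup loops L∈) j∈) x∈j x∈)) y∈

    component-⋃ : ∀ {L x} → L ∈ₗ Ls → x ∈ L → component w (⋃ Ls) x ≡ L
    component-⋃ {L} {x} L∈ x∈ = Subset.⊆-antisym
      (component-least w (loop-closed L∈) x∈)
      (subst (_⊆ component w (⋃ Ls) x) (loop-connected w (All.lookup loops L∈) x∈)
        (component-least w
          (λ j∈ u∈j y∈j u∈ y∈L → component-closed w (⋃ Ls) x j∈ u∈j y∈j u∈ (∈-⋃⁺ (lose L∈ y∈L)))
          (component-start w (⋃ Ls) x)))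

    components-⋃ : components w (⋃ Ls) ↭ Ls
    components-⋃ = sameElements⇒↭ (unique-components w (⋃ Ls)) (sorted⇒unique loops sorted) to from
      where
      to : ∀ {C} → C ∈ₗ components w (⋃ Ls) → C ∈ₗ Ls
      to C∈ with ∈-components⁻ w (⋃ Ls) C∈
      ... | e , e∈ , refl with find (∈-⋃⁻ Ls e∈)
      ...   | L , L∈ , e∈L = subst (_∈ₗ Ls) (sym (component-⋃ L∈ e∈L)) L∈
      from : ∀ {L} → L ∈ₗ Ls → L ∈ₗ components w (⋃ Ls)
      from L∈ with loop-nonempty w (All.lookup loops L∈)
      ... | x , x∈ = subst (_∈ₗ components w (⋃ Ls)) (component-⋃ L∈ x∈) (∈-components⁺ w (⋃ Ls) (∈-⋃⁺ (lose L∈ x∈)))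

    -- A row is recovered from the union of its loops. This gives one half of the bijection between
    -- arrays and colourings, and it evaluates `SW` on rows that move as a whole.
    sort-components-⋃ : ≺-sort w (components w (⋃ Ls)) ≡ Ls
    sort-components-⋃ = sym (sorted-unique loops sorted
      (sort-sorted (↭.All-resp-↭ (↭-sym components-⋃) loops)
        (unique⇒allPairs (unique-components w (⋃ Ls)) λ C∈ C′∈ →
          comparable (↭.∈-resp-↭ components-⋃ C∈) (↭.∈-resp-↭ components-⋃ C′∈)))
      (↭-sym (↭-trans (sort-↭ (components w (⋃ Ls))) components-⋃)))
      where
      comparable : ∀ {L L′} → L ∈ₗ Ls → L′ ∈ₗ Ls → L ≢ L′ → Comparable L L′
      comparable = go sorted
        where
        go : ∀ {Ls} → AllPairs _<ₗ_ Ls → ∀ {L L′} → L ∈ₗ Ls → L′ ∈ₗ Ls → L ≢ L′ → Comparable L L′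
        go (p ∷ ps) (here refl) (here refl) L≢ = ⊥-elim (L≢ refl)
        go (p ∷ ps) (here refl) (there i′)  _  = inj₁ (All.lookup p i′)
        go (p ∷ ps) (there i)   (here refl) _  = inj₂ (All.lookup p i)
        go (p ∷ ps) (there i)   (there i′)  L≢ = go ps i i′ L≢

  strands : Subset arcs → List (Subset arcs)
  strands S = ≺-sort w (components w S)

  module _ {S : Subset arcs} (simple : Simple w S) where

    private
      components-loops : All (IsLoop w) (components w S)
      components-loops = All.tabulate λ C∈ → let e , e∈ , C≡ = ∈-components⁻ w S C∈ in
        subst (IsLoop w) (sym C≡) (component-loop w simple e∈)

    strands-loops : All (IsLoop w) (strands S)
    strands-loops = ↭.All-resp-↭ (↭-sym (sort-↭ (components w S))) components-loops

    strands-sorted : AllPairs _<ₗ_ (strands S)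
    strands-sorted = sort-sorted components-loops
      (unique⇒allPairs (unique-components w S) (components-comparable w simple))

    ⋃-strands : ⋃ (strands S) ≡ S
    ⋃-strands = Subset.⊆-antisym to from
      where
      to : ⋃ (strands S) ⊆ S
      to x∈ with find (∈-⋃⁻ (strands S) x∈)
      ... | C , C∈ , x∈C with ∈-components⁻ w S (↭.∈-resp-↭ (sort-↭ (components w S)) C∈)
      ...   | e , e∈ , refl = component-⊆ w e∈ x∈C
      from : S ⊆ ⋃ (strands S)
      from {x} x∈ = ∈-⋃⁺ (lose
        (↭.∈-resp-↭ (↭-sym (sort-↭ (components w S))) (∈-components⁺ w S x∈))
        (component-start w S x))

-- Colourings and arrays

subset-ext : ∀ {p q : Subset n} → (∀ x → x ∈ p ⇔ x ∈ q) → p ≡ q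
subset-ext e = Subset.⊆-antisym (λ {x} → Equivalence.to (e x)) (λ {x} → Equivalence.from (e x))

vec-ext : ∀ {u v : Vec A n} → (∀ i → Vec.lookup u i ≡ Vec.lookup v i) → u ≡ v
vec-ext {u = u} {v} e = trans (sym (Vec.tabulate∘lookup u)) (trans (Vec.tabulate-cong e) (Vec.tabulate∘lookup v))

any?≡lookup-⋃ : ∀ e (Ls : List (Subset n)) → does (any? (e ∈?_) Ls) ≡ Vec.lookup (⋃ Ls) e
any?≡lookup-⋃ e Ls with any? (e ∈?_) Ls | Vec.lookup (⋃ Ls) e in eq
... | yes any | true  = refl
... | yes any | false = case trans (sym (Vec.[]=⇒lookup (∈-⋃⁺ any))) eq of λ ()
... | no ¬any | true  = ⊥-elim (¬any (∈-⋃⁻ Ls (Vec.lookup⇒[]= e (⋃ Ls) eq)))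
... | no ¬any | false = refl

disjoint-∪ : ∀ (p q : Subset n) → ∣ p ∪ q ∣ ≡ ∣ p ∣ + ∣ q ∣ → ∀ {x} → x ∈ p → x ∉ q
disjoint-∪ (true ∷ p)  (true ∷ q)  eq _ _ = ⊥-elim (ℕ.<-irrefl (ℕ.suc-injective eq)
  (ℕ.≤-<-trans (∣∪∣≤ p q) (ℕ.≤-reflexive (sym (ℕ.+-suc ∣ p ∣ ∣ q ∣)))))
  where
  ∣∪∣≤ : ∀ {n} (p q : Subset n) → ∣ p ∪ q ∣ ≤ ∣ p ∣ + ∣ q ∣
  ∣∪∣≤ []          []          = z≤n
  ∣∪∣≤ (true ∷ p)  (true ∷ q)  = s≤s (ℕ.≤-trans (∣∪∣≤ p q) (ℕ.+-monoʳ-≤ ∣ p ∣ (ℕ.n≤1+n ∣ q ∣)))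
  ∣∪∣≤ (true ∷ p)  (false ∷ q) = s≤s (∣∪∣≤ p q)
  ∣∪∣≤ (false ∷ p) (true ∷ q)  = ℕ.≤-trans (s≤s (∣∪∣≤ p q)) (ℕ.≤-reflexive (sym (ℕ.+-suc ∣ p ∣ ∣ q ∣)))
  ∣∪∣≤ (false ∷ p) (false ∷ q) = ∣∪∣≤ p q
disjoint-∪ (true ∷ p)  (false ∷ q) eq Vec.here       ()
disjoint-∪ (true ∷ p)  (false ∷ q) eq (Vec.there x∈) (Vec.there x∈′) = disjoint-∪ p q (ℕ.suc-injective eq) x∈ x∈′
disjoint-∪ (false ∷ p) (true ∷ q)  eq (Vec.there x∈) (Vec.there x∈′) =
  disjoint-∪ p q (ℕ.suc-injective (trans eq (ℕ.+-suc ∣ p ∣ ∣ q ∣))) x∈ x∈′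
disjoint-∪ (false ∷ p) (false ∷ q) eq (Vec.there x∈) (Vec.there x∈′) = disjoint-∪ p q eq x∈ x∈′

all-subsets : ∀ (p : Subset n) → p ∈ₗ subsets n
all-subsets = ∈-vecs λ { true → here refl ; false → there (here refl) }

unique-subsets : ∀ n → Unique (subsets n)
unique-subsets = unique-vecs (((λ ()) ∷ []) ∷ [] ∷ [])

module _ (w : Web) where
  open Web w

  -- A variant of `coloring` whose number of colours is an argument. For an array of shape `α` it
  -- can be taken as `length α`, without transport along an equation of lengths.
  coloringOf : ∀ N → Array w → Coloring w N
  coloringOf N T = Vec.tabulate λ e → Vec.tabulate λ i → Vec.lookup (⋃ (row T i)) e

  lookup-coloringOf : ∀ N T e (i : Fin N) → Vec.lookup (Vec.lookup (coloringOf N T) e) i ≡ Vec.lookup (⋃ (row T i)) e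
  lookup-coloringOf N T e i = trans
    (cong (λ A → Vec.lookup A i) (Vec.lookup∘tabulate _ e)) (Vec.lookup∘tabulate _ i)

  Γ-coloringOf : ∀ N T (i : Fin N) → Γ w (coloringOf N T) i ≡ ⋃ (row T i)
  Γ-coloringOf N T i = trans (Vec.tabulate-cong λ e → lookup-coloringOf N T e i) (Vec.tabulate∘lookup _)

  ∈-Γ⁺ : ∀ {c : Coloring w N} {i e} → i ∈ Vec.lookup c e → e ∈ Γ w c i
  ∈-Γ⁺ {c = c} {i} {e} i∈ = Vec.lookup⇒[]= e _ (trans (Vec.lookup∘tabulate _ e) (Vec.[]=⇒lookup i∈))

  ∈-Γ⁻ : ∀ {c : Coloring w N} {i e} → e ∈ Γ w c i → i ∈ Vec.lookup c e
  ∈-Γ⁻ {c = c} {i} {e} e∈ = Vec.lookup⇒[]= i _ (trans (sym (Vec.lookup∘tabulate _ e)) (Vec.[]=⇒lookup e∈))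

  coloringOf-length : ∀ T → coloringOf (length T) T ≡ coloring w T
  coloringOf-length T = Vec.tabulate-cong λ e → Vec.tabulate-cong λ i →
    trans (sym (any?≡lookup-⋃ e (row T i))) (cong (λ R → does (any? (e ∈?_) R)) (row≡lookup T i))
    where
    row≡lookup : ∀ (T : Array w) i → row T i ≡ lookup T i
    row≡lookup (R ∷ T) zero    = refl
    row≡lookup (R ∷ T) (suc i) = row≡lookup T i

  invT≡inv-w : ∀ T → length T ≡ N → invT w T ≡ inv-w w (coloringOf N T)
  invT≡inv-w T refl = cong (inv-w w) (sym (coloringOf-length T))

  private
    bit : Bool → ℕ
    bit b = if b then 1 else 0

    ∣∷∣ : ∀ b (v : Subset n) → ∣ b ∷ v ∣ ≡ bit b + ∣ v ∣
    ∣∷∣ true  v = refl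
    ∣∷∣ false v = refl

    lookup-∉ : ∀ {e} {p : Subset n} → e ∉ p → Vec.lookup p e ≡ false
    lookup-∉ {e = e} {p} e∉ with Vec.lookup p e in eq
    ... | true  = ⊥-elim (e∉ (Vec.lookup⇒[]= e p eq))
    ... | false = refl

  -- Loops of one row are disjoint, so an arc lies on at most one of them, and being covered at all
  -- is the same as the number of loops covering it.
  bit-row : ∀ {R} → AllPairs (_≺_ w) R → ∀ e → bit (Vec.lookup (⋃ R) e) ≡ length (filter (e ∈?_) R)
  bit-row []               e = cong bit (Vec.lookup-replicate e false)
  bit-row {L ∷ R} (p ∷ ps) e = cases (e ∈? L)
    where
    cases : Dec (e ∈ L) → bit (Vec.lookup (⋃ (L ∷ R)) e) ≡ length (filter (e ∈?_) (L ∷ R))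
    cases (yes e∈) = trans
      (cong bit (Vec.[]=⇒lookup (∈-⋃⁺ {ps = L ∷ R} (here e∈))))
      (sym (cong length (trans (List.filter-accept (e ∈?_) e∈)
        (cong (L ∷_) (List.filter-none (e ∈?_) (All.map (λ L≺L′ → ≺-disjoint w L≺L′ e∈) p))))))
    cases (no e∉) = begin
      bit (Vec.lookup (L ∪ ⋃ R) e)        ≡⟨ cong bit (Vec.lookup-zipWith _∨_ e L (⋃ R)) ⟩
      bit (Vec.lookup L e ∨ Vec.lookup (⋃ R) e)  ≡⟨ cong (λ b → bit (b ∨ Vec.lookup (⋃ R) e)) (lookup-∉ e∉) ⟩
      bit (Vec.lookup (⋃ R) e)            ≡⟨ bit-row ps e ⟩
      length (filter (e ∈?_) R)         ≡⟨ cong length (List.filter-reject (e ∈?_) e∉) ⟨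
      length (filter (e ∈?_) (L ∷ R))   ∎
      where open ≡-Reasoning

  ∣coloringOf∣ : ∀ {T} → All (AllPairs (_≺_ w)) T → ∀ e →
    ∣ Vec.tabulate {n = length T} (λ i → Vec.lookup (⋃ (row T i)) e) ∣ ≡ length (filter (e ∈?_) (concat T))
  ∣coloringOf∣ []                    e = refl
  ∣coloringOf∣ {R ∷ T} (sorted ∷ ss) e = begin
    ∣ Vec.lookup (⋃ R) e ∷ rest ∣
      ≡⟨ ∣∷∣ (Vec.lookup (⋃ R) e) rest ⟩
    bit (Vec.lookup (⋃ R) e) + ∣ rest ∣
      ≡⟨ cong₂ _+_ (bit-row sorted e) (∣coloringOf∣ ss e) ⟩
    length (filter (e ∈?_) R) + length (filter (e ∈?_) (concat T))
      ≡⟨ List.length-++ (filter (e ∈?_) R) ⟨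
    length (filter (e ∈?_) R ++ filter (e ∈?_) (concat T))
      ≡⟨ cong length (List.filter-++ (e ∈?_) R (concat T)) ⟨
    length (filter (e ∈?_) (concat (R ∷ T))) ∎
    where
    open ≡-Reasoning
    rest : Subset (length T)
    rest = Vec.tabulate λ i → Vec.lookup (⋃ (row T i)) e

  simple-through : ∀ {S} j → SimpleAt w S j → Any (_∈ S) (ins j) ⇔ Any (_∈ S) (outs j)
  simple-through (merge l r e) (fork , _) = mk⇔
    (λ { (here l∈)         → here (Equivalence.from fork (inj₁ l∈))
       ; (there (here r∈)) → here (Equivalence.from fork (inj₂ r∈)) })
    (λ { (here e∈) → [ here , there ∘ here ]′ (Equivalence.to fork e∈) })
  simple-through (split e l r) (fork , _) = mk⇔
    (λ { (here e∈) → [ here , there ∘ here ]′ (Equivalence.to fork e∈) })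
    (λ { (here l∈)         → here (Equivalence.from fork (inj₁ l∈))
       ; (there (here r∈)) → here (Equivalence.from fork (inj₂ r∈)) })
  simple-through (glue e e′) glued = mk⇔
    (λ { (here e∈) → here (Equivalence.to glued e∈) }) (λ { (here e∈) → here (Equivalence.from glued e∈) })

  ∈-⋃-colors : ∀ {c : Coloring w N} {i} es → i ∈ ⋃ (map (Vec.lookup c) es) ⇔ Any (_∈ Γ w c i) es
  ∈-⋃-colors {c = c} es = mk⇔
    (λ i∈ → Any.map (∈-Γ⁺ {c = c}) (AnyP.map⁻ (∈-⋃⁻ (map (Vec.lookup c) es) i∈)))
    (λ any → ∈-⋃⁺ (AnyP.map⁺ (Any.map (∈-Γ⁻ {c = c}) any)))

  vertex-thickness : ∀ {es es′} (ss : Star (Slice thickness) es es′) {j} → j ∈ₗ vertices ss →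
    ∃₂ λ l r → ∃ λ e → (j ≡ merge l r e ⊎ j ≡ split e l r) × thickness l + thickness r ≡ thickness e
  vertex-thickness (s ◅ ss) (there j∈)  = vertex-thickness ss j∈
  vertex-thickness (s ◅ ss) (here refl) = at s
    where
    at : ∀ {es es′} (s : Slice thickness es es′) → ∃₂ λ l r → ∃ λ e →
      (vertex s ≡ merge l r e ⊎ vertex s ≡ split e l r) × thickness l + thickness r ≡ thickness e
    at (merge {l} {r} {e} eq) = l , r , e , inj₁ refl , eq
    at (split {e} {l} {r} eq) = l , r , e , inj₂ refl , sym eq
    at (skip s)               = at s

  -- The condition on unions would still allow a colour on both thin arcs of a vertex. As
  -- thicknesses add up there, the size of the union forces the two colour sets to be disjoint.
  coloring-simple : ∀ {c : Coloring w N} → IsColoring w c → ∀ i → Simple w (Γ w c i)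
  coloring-simple {c = c} (sizes , unions) i {j} j∈ = at (∈ₗ.∈-++⁻ (vertices slices) j∈)
    where
    c[_] = Vec.lookup c

    transfer : ∀ es es′ → ⋃ (map c[_] es) ≡ ⋃ (map c[_] es′) → Any (_∈ Γ w c i) es → Any (_∈ Γ w c i) es′
    transfer es es′ union any = Equivalence.to (∈-⋃-colors {c = c} es′)
      (subst (i ∈_) union (Equivalence.from (∈-⋃-colors {c = c} es) any))

    fork : ∀ {l r e} → thickness l + thickness r ≡ thickness e →
      ⋃ (map c[_] (l ∷ r ∷ [])) ≡ ⋃ (map c[_] (e ∷ [])) → Fork w (Γ w c i) e l r
    fork {l} {r} {e} t union = mk⇔
      (λ e∈ → case transfer (e ∷ []) (l ∷ r ∷ []) (sym union) (here e∈) of λ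
        { (here l∈) → inj₁ l∈ ; (there (here r∈)) → inj₂ r∈ })
      (λ lr∈ → case transfer (l ∷ r ∷ []) (e ∷ []) union ([ here , there ∘ here ]′ lr∈) of λ
        { (here e∈) → e∈ }) ,
      λ (l∈ , r∈) → disjoint-∪ c[ l ] c[ r ] size (∈-Γ⁻ {c = c} l∈) (∈-Γ⁻ {c = c} r∈)
      where
      size : ∣ c[ l ] ∪ c[ r ] ∣ ≡ ∣ c[ l ] ∣ + ∣ c[ r ] ∣
      size = begin
        ∣ c[ l ] ∪ c[ r ] ∣        ≡⟨ cong (λ A → ∣ c[ l ] ∪ A ∣) (Subset.∪-identityʳ c[ r ]) ⟨
        ∣ c[ l ] ∪ (c[ r ] ∪ _) ∣  ≡⟨ cong ∣_∣ (trans union (Subset.∪-identityʳ c[ e ])) ⟩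
        ∣ c[ e ] ∣                 ≡⟨ trans (sizes e) (sym t) ⟩
        thickness l + thickness r  ≡⟨ cong₂ _+_ (sizes l) (sizes r) ⟨
        ∣ c[ l ] ∣ + ∣ c[ r ] ∣    ∎
        where open ≡-Reasoning

    at : j ∈ₗ vertices slices ⊎ j ∈ₗ map (uncurry glue) (zip top bottom) → SimpleAt w (Γ w c i) j
    at (inj₁ j∈v) with vertex-thickness slices j∈v
    ... | l , r , e , inj₁ refl , t = fork t (All.lookup unions j∈)
    ... | l , r , e , inj₂ refl , t = fork t (sym (All.lookup unions j∈))
    at (inj₂ j∈g) with ∈ₗ.∈-map⁻ (uncurry glue) j∈g
    ... | (e , e′) , _ , refl = mk⇔
      (λ e∈ → case transfer (e ∷ []) (e′ ∷ []) (All.lookup unions j∈) (here e∈) of λ { (here e′∈) → e′∈ })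
      (λ e′∈ → case transfer (e′ ∷ []) (e ∷ []) (sym (All.lookup unions j∈)) (here e′∈) of λ { (here e∈) → e∈ })

  arrayOf : ∀ N → Coloring w N → Array w
  arrayOf N c = tabulate λ i → strands w (Γ w c i)

  coloringOf-arrayOf : ∀ {c : Coloring w N} → IsColoring w c → coloringOf N (arrayOf N c) ≡ c
  coloringOf-arrayOf {N} {c} coloring = vec-ext λ e → vec-ext λ i → begin
    Vec.lookup (Vec.lookup (coloringOf N (arrayOf N c)) e) i
      ≡⟨ lookup-coloringOf N (arrayOf N c) e i ⟩
    Vec.lookup (⋃ (row (arrayOf N c) i)) e
      ≡⟨ cong (λ R → Vec.lookup (⋃ R) e) (row-tabulate (λ i → strands w (Γ w c i)) i) ⟩
    Vec.lookup (⋃ (strands w (Γ w c i))) e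
      ≡⟨ cong (λ S → Vec.lookup S e) (⋃-strands w (coloring-simple {c = c} coloring i)) ⟩
    Vec.lookup (Γ w c i) e
      ≡⟨ Vec.lookup∘tabulate _ e ⟩
    Vec.lookup (Vec.lookup c e) i ∎
    where open ≡-Reasoning

  coloringOf-size : ∀ {T} → length T ≡ N → All (AllPairs (_≺_ w)) T → ∀ e →
    ∣ Vec.lookup (coloringOf N T) e ∣ ≡ length (filter (e ∈?_) (concat T))
  coloringOf-size refl sorted e = trans (cong ∣_∣ (Vec.lookup∘tabulate _ e)) (∣coloringOf∣ sorted e)

  array-sorted : ∀ {T} → IsArray w T → All (AllPairs (_≺_ w)) T
  array-sorted (loops , _ , linked) = All.zipWith (uncurry (linked⇒sorted w)) (loops , linked)

  array-coloring : ∀ {T} → length T ≡ N → IsArray w T → IsColoring w (coloringOf N T)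
  array-coloring {N} {T} refl array@(loops , thick , linked) =
    (λ e → trans (coloringOf-size refl (array-sorted array) e) (thick e)) ,
    All.tabulate λ {j} j∈ → subset-ext λ i → mk⇔
      (through (ins j) (outs j) λ L∈ →
        Equivalence.to (simple-through j (loop-simple w (All.lookup (all-row loops i) L∈) j∈)))
      (through (outs j) (ins j) λ L∈ →
        Equivalence.from (simple-through j (loop-simple w (All.lookup (all-row loops i) L∈) j∈)))
    where
    c = coloringOf N T
    through : ∀ {i} xs ys → (∀ {L} → L ∈ₗ row T i → Any (_∈ L) xs → Any (_∈ L) ys) →
      i ∈ ⋃ (map (Vec.lookup c) xs) → i ∈ ⋃ (map (Vec.lookup c) ys)
    through {i} xs ys move i∈ with find (Equivalence.to (∈-⋃-colors {c = c} xs) i∈)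
    ... | x , x∈xs , x∈Γ with find (∈-⋃⁻ (row T i) (subst (x ∈_) (Γ-coloringOf N T i) x∈Γ))
    ...   | L , L∈ , x∈L = Equivalence.from (∈-⋃-colors {c = c} ys) (Any.map
      (λ {y} y∈L → subst (y ∈_) (sym (Γ-coloringOf N T i)) (∈-⋃⁺ (lose L∈ y∈L)))
      (move L∈ (lose x∈xs x∈L)))

  arrayOf-coloringOf : ∀ {T} → length T ≡ N → IsArray w T → arrayOf N (coloringOf N T) ≡ T
  arrayOf-coloringOf {N} {T} refl array@(loops , _) = trans
    (List.tabulate-cong λ i → trans (cong (strands w) (Γ-coloringOf N T i))
      (sort-components-⋃ w (all-row loops i) (all-row (array-sorted array) i)))
    (tabulate-row T)

  coloring-array : ∀ {c : Coloring w N} → IsColoring w c → IsArray w (arrayOf N c)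
  coloring-array {N} {c} coloring@(sizes , _) =
    All.tabulate⁺ (λ i → strands-loops w (simple i)) ,
    (λ e → trans (sym (coloringOf-size (List.length-tabulate _) (All.tabulate⁺ λ i → strands-sorted w (simple i)) e))
                 (trans (cong (λ c → ∣ Vec.lookup c e ∣) (coloringOf-arrayOf {c = c} coloring)) (sizes e))) ,
    All.tabulate⁺ (λ i → Linked.AllPairs⇒Linked (strands-sorted w (simple i)))
    where simple = coloring-simple {c = c} coloring

  array-weight : ∀ {α T} → map length T ≡ α → length T ≡ length α → IsArray w T →
    HasWeight w α (coloringOf (length α) T)
  array-weight {α} {T} shape-T length-T array@(loops , _) i = begin
    length (components w (Γ w (coloringOf (length α) T) i))
      ≡⟨ cong (λ S → length (components w S)) (Γ-coloringOf (length α) T i) ⟩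
    length (components w (⋃ (row T i)))
      ≡⟨ ↭.↭-length (components-⋃ w (all-row′ length-T loops i) (all-row′ length-T (array-sorted array) i)) ⟩
    length (row T i)
      ≡⟨ length-row T shape-T i ⟩
    lookup α i ∎
    where
    open ≡-Reasoning
    all-row′ : ∀ {P : List (Subset arcs) → Set} {T} → length T ≡ N → All P T → ∀ (i : Fin N) → P (row T i)
    all-row′ refl = all-row

  coeff-X : ∀ α d → coeff (X w α) d ≡
    ∑ (fillings (subsets arcs) α) λ T → [ isArray? w T ]? ℤ.* coeff (q^ invT w T) d
  coeff-X α d = begin
    coeff (X w α) d
      ≡⟨ coeff-Σ (filter S? cs) _ d ⟩
    ∑ (filter S? cs) (λ c → coeff (q^ inv-w w c) d)
      ≡⟨ ∑-bijection (isArray? w) S? (coloringOf #α) (arrayOf #α)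
           (unique-fillings (unique-subsets arcs) α) (unique-vecs (unique-subsets #α) arcs) to from _ ⟩
    ∑ (filter (isArray? w) Ts) (λ T → coeff (q^ inv-w w (coloringOf #α T)) d)
      ≡⟨ ∑-filter (isArray? w) Ts _ ⟩
    ∑ Ts (λ T → [ isArray? w T ]? ℤ.* coeff (q^ inv-w w (coloringOf #α T)) d)
      ≡⟨ ∑-cong Ts (λ {T} T∈ → cong (λ z → [ isArray? w T ]? ℤ.* coeff (q^ z) d) (sym (invT≡inv-w T (length-∈ T∈)))) ⟩
    ∑ Ts (λ T → [ isArray? w T ]? ℤ.* coeff (q^ invT w T) d) ∎
    where
    open ≡-Reasoning
    #α = length α
    cs = vecs (subsets #α) arcs
    Ts = fillings (subsets arcs) α
    S? = λ c → isColoring? w c ×-dec hasWeight? w α c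
    length-∈ : ∀ {T} → T ∈ₗ Ts → length T ≡ #α
    length-∈ {T} T∈ = trans (sym (List.length-map length T)) (cong length (∈-fillings⁻ α T∈))
    to : ∀ {T} → T ∈ₗ Ts → IsArray w T → coloringOf #α T ∈ₗ cs ×
      (IsColoring w (coloringOf #α T) × HasWeight w α (coloringOf #α T)) × arrayOf #α (coloringOf #α T) ≡ T
    to {T} T∈ array = ∈-vecs all-subsets (coloringOf #α T) ,
      (array-coloring (length-∈ T∈) array , array-weight (∈-fillings⁻ α T∈) (length-∈ T∈) array) ,
      arrayOf-coloringOf (length-∈ T∈) array
    from : ∀ {c} → c ∈ₗ cs → IsColoring w c × HasWeight w α c → arrayOf #α c ∈ₗ Ts ×
      IsArray w (arrayOf #α c) × coloringOf #α (arrayOf #α c) ≡ c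
    from {c} _ (coloring , weight) =
      subst (λ ks → arrayOf #α c ∈ₗ fillings (subsets arcs) ks) shape-c (∈-fillings⁺ all-subsets (arrayOf #α c)) ,
      coloring-array {c = c} coloring , coloringOf-arrayOf {c = c} coloring
      where
      shape-c : map length (arrayOf #α c) ≡ α
      shape-c = trans (List.map-tabulate (λ i → strands w (Γ w c i)) length)
        (trans (List.tabulate-cong λ i → trans (↭.↭-length (sort-↭ w (components w (Γ w c i)))) (weight i))
               (List.tabulate-lookup α))

-- Inversions

[_]ᵇ : Bool → ℤ
[ b ]ᵇ = if b then 1ℤ else 0ℤ

+∣∷∣ : ∀ b (A : Subset n) → + ∣ b ∷ A ∣ ≡ [ b ]ᵇ ℤ.+ + ∣ A ∣
+∣∷∣ true  A = refl
+∣∷∣ false A = sym (ℤ.+-identityˡ _)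

elements-∷ : ∀ b (A : Subset n) → elements (b ∷ A) ≡ (if b then zero ∷ [] else []) ++ map suc (elements A)
elements-∷ {n} b A = trans (head b) (cong ((if b then zero ∷ [] else []) ++_) (trans
  (cong (filter (_∈? (b ∷ A))) (sym (List.map-tabulate id suc))) (tail (allFin n))))
  where
  head : ∀ b → elements (b ∷ A) ≡ (if b then zero ∷ [] else []) ++ filter (_∈? (b ∷ A)) (tabulate suc)
  head true  = refl
  head false = refl
  tail : ∀ is → filter (_∈? (b ∷ A)) (map suc is) ≡ map suc (filter (_∈? A) is)
  tail []       = refl
  tail (i ∷ is) with i ∈? A
  ... | yes _ = cong (suc i ∷_) (tail is)
  ... | no _  = tail is

∑-elements-∷ : ∀ b (A : Subset n) f → ∑ (elements (b ∷ A)) f ≡ [ b ]ᵇ ℤ.* f zero ℤ.+ ∑ (elements A) (f ∘ suc)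
∑-elements-∷ b A f = trans (cong (λ is → ∑ is f) (elements-∷ b A)) (trans
  (∑-++ (if b then zero ∷ [] else []) _ f) (cong₂ ℤ._+_ (first b) (∑-map suc (elements A) f)))
  where
  first : ∀ b → ∑ (if b then zero ∷ [] else []) f ≡ [ b ]ᵇ ℤ.* f zero
  first true  = trans (ℤ.+-identityʳ _) (sym (ℤ.*-identityˡ _))
  first false = refl

∑-elements-1 : ∀ (A : Subset n) → ∑ (elements A) (λ _ → 1ℤ) ≡ + ∣ A ∣
∑-elements-1 []      = refl
∑-elements-1 (b ∷ A) = trans (∑-elements-∷ b A _)
  (trans (cong₂ ℤ._+_ (ℤ.*-identityʳ [ b ]ᵇ) (∑-elements-1 A)) (sym (+∣∷∣ b A)))

inv≡∑ : ∀ (A B : Subset n) → inv A B ≡ ∑ (elements A) λ a → ∑ (elements B) λ b → sgn (toℕ a ⊖ toℕ b)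
inv≡∑ A B = trans (cong sumℤ (sym (List.map-id (cartesianProductWith s (elements A) (elements B)))))
                  (∑-product s (elements A) (elements B) id)
  where
  s : Fin _ → Fin _ → ℤ
  s a b = sgn (toℕ a ⊖ toℕ b)

-- Colour 0 is below all others: on the left it contributes -1 for each remaining element of `B`, on
-- the right +1 for each remaining element of `A`, and against itself nothing.
inv-∷ : ∀ a b (A B : Subset n) →
  inv (a ∷ A) (b ∷ B) ≡ inv A B ℤ.+ [ b ]ᵇ ℤ.* + ∣ A ∣ ℤ.- [ a ]ᵇ ℤ.* + ∣ B ∣
inv-∷ {n} a b A B = begin
  inv (a ∷ A) (b ∷ B)
    ≡⟨ inv≡∑ (a ∷ A) (b ∷ B) ⟩
  (∑ (elements (a ∷ A)) λ x → ∑ (elements (b ∷ B)) λ y → s x y)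
    ≡⟨ ∑-elements-∷ a A _ ⟩
  [ a ]ᵇ ℤ.* ∑ (elements (b ∷ B)) (s (zero {n})) ℤ.+ (∑ (elements A) λ x → ∑ (elements (b ∷ B)) λ y → s (suc x) y)
    ≡⟨ cong₂ ℤ._+_ (cong₂ ℤ._*_ (refl {x = [ a ]ᵇ}) row₀) rows₊ ⟩
  [ a ]ᵇ ℤ.* (-1ℤ ℤ.* + ∣ B ∣) ℤ.+ ([ b ]ᵇ ℤ.* + ∣ A ∣ ℤ.+ inv A B)
    ≡⟨ arrange [ a ]ᵇ (+ ∣ B ∣) ([ b ]ᵇ ℤ.* + ∣ A ∣) (inv A B) ⟩
  inv A B ℤ.+ [ b ]ᵇ ℤ.* + ∣ A ∣ ℤ.- [ a ]ᵇ ℤ.* + ∣ B ∣ ∎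
  where
  open ≡-Reasoning
  s : ∀ {m n} → Fin m → Fin n → ℤ
  s x y = sgn (toℕ x ⊖ toℕ y)
  arrange : ∀ a B bA i → a ℤ.* (-1ℤ ℤ.* B) ℤ.+ (bA ℤ.+ i) ≡ i ℤ.+ bA ℤ.- a ℤ.* B
  arrange = solve-∀
  row₀ : ∑ (elements (b ∷ B)) (s (zero {n})) ≡ -1ℤ ℤ.* + ∣ B ∣
  row₀ = trans (∑-elements-∷ b B (s (zero {n}))) (trans
    (cong₂ ℤ._+_ (ℤ.*-zeroʳ [ b ]ᵇ)
      (trans (∑-*ˡ (elements B) -1ℤ (λ _ → 1ℤ)) (cong₂ ℤ._*_ (refl {x = -1ℤ}) (∑-elements-1 B))))
    (ℤ.+-identityˡ _))
  rows₊ : (∑ (elements A) λ x → ∑ (elements (b ∷ B)) λ y → s (suc x) y) ≡ [ b ]ᵇ ℤ.* + ∣ A ∣ ℤ.+ inv A B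
  rows₊ = begin
    (∑ (elements A) λ x → ∑ (elements (b ∷ B)) λ y → s (suc x) y)
      ≡⟨ ∑-cong′ (elements A) (λ x → trans (∑-elements-∷ b B (s (suc x)))
           (cong₂ ℤ._+_ (refl {x = [ b ]ᵇ ℤ.* 1ℤ}) (∑-cong′ (elements B) λ y →
             cong sgn (ℤ.[1+m]⊖[1+n]≡m⊖n (toℕ x) (toℕ y))))) ⟩
    (∑ (elements A) λ x → [ b ]ᵇ ℤ.* 1ℤ ℤ.+ ∑ (elements B) λ y → s x y)
      ≡⟨ ∑-+ (elements A) _ _ ⟩
    ∑ (elements A) (λ _ → [ b ]ᵇ ℤ.* 1ℤ) ℤ.+ (∑ (elements A) λ x → ∑ (elements B) λ y → s x y)
      ≡⟨ cong₂ ℤ._+_ (trans (∑-*ˡ (elements A) [ b ]ᵇ (λ _ → 1ℤ))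
                            (cong₂ ℤ._*_ (refl {x = [ b ]ᵇ}) (∑-elements-1 A)))
                     (sym (inv≡∑ A B)) ⟩
    [ b ]ᵇ ℤ.* + ∣ A ∣ ℤ.+ inv A B ∎

-- Two consecutive colours that do not meet at a merge may be identified there:
-- p and q (p′ and q′) tell whether they occur on the right (left) incoming arc.
inv-merge : ∀ p q p′ q′ (A B : Subset n) →
  p ∧ q ≡ false → p′ ∧ q′ ≡ false → p ∧ q′ ≡ false → p′ ∧ q ≡ false →
  inv (p ∷ q ∷ A) (p′ ∷ q′ ∷ B) ≡ inv ((q ∨ p) ∷ A) ((q′ ∨ p′) ∷ B)
inv-merge p q p′ q′ A B pq p′q′ pq′ p′q = begin
  inv (p ∷ q ∷ A) (p′ ∷ q′ ∷ B)
    ≡⟨ inv-∷ p p′ (q ∷ A) (q′ ∷ B) ⟩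
  inv (q ∷ A) (q′ ∷ B) ℤ.+ [ p′ ]ᵇ ℤ.* + ∣ q ∷ A ∣ ℤ.- [ p ]ᵇ ℤ.* + ∣ q′ ∷ B ∣
    ≡⟨ cong₂ ℤ._-_ (cong₂ ℤ._+_ (inv-∷ q q′ A B) (cong₂ ℤ._*_ (refl {x = [ p′ ]ᵇ}) (+∣∷∣ q A)))
                   (cong₂ ℤ._*_ (refl {x = [ p ]ᵇ}) (+∣∷∣ q′ B)) ⟩
  inv A B ℤ.+ [ q′ ]ᵇ ℤ.* #A ℤ.- [ q ]ᵇ ℤ.* #B ℤ.+ [ p′ ]ᵇ ℤ.* ([ q ]ᵇ ℤ.+ #A) ℤ.- [ p ]ᵇ ℤ.* ([ q′ ]ᵇ ℤ.+ #B)
    ≡⟨ expand (inv A B) #A #B [ p ]ᵇ [ q ]ᵇ [ p′ ]ᵇ [ q′ ]ᵇ ⟩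
  -- The last bracket is the contribution of the two colours against each other, which vanishes
  -- because they do not meet.
  inv A B ℤ.+ ([ q′ ]ᵇ ℤ.+ [ p′ ]ᵇ) ℤ.* #A ℤ.- ([ q ]ᵇ ℤ.+ [ p ]ᵇ) ℤ.* #B ℤ.+ ([ p′ ]ᵇ ℤ.* [ q ]ᵇ ℤ.- [ p ]ᵇ ℤ.* [ q′ ]ᵇ)
    ≡⟨ cong₂ ℤ._+_ (cong₂ ℤ._-_ (cong₂ ℤ._+_ (refl {x = inv A B}) (cong (ℤ._* #A) (union p′ q′ p′q′)))
                                (cong (ℤ._* #B) (union p q pq)))
                   (cong₂ ℤ._-_ (product p′ q p′q) (product p q′ pq′)) ⟩
  inv A B ℤ.+ [ q′ ∨ p′ ]ᵇ ℤ.* #A ℤ.- [ q ∨ p ]ᵇ ℤ.* #B ℤ.+ 0ℤ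
    ≡⟨ ℤ.+-identityʳ _ ⟩
  inv A B ℤ.+ [ q′ ∨ p′ ]ᵇ ℤ.* #A ℤ.- [ q ∨ p ]ᵇ ℤ.* #B
    ≡⟨ inv-∷ (q ∨ p) (q′ ∨ p′) A B ⟨
  inv ((q ∨ p) ∷ A) ((q′ ∨ p′) ∷ B) ∎
  where
  open ≡-Reasoning
  #A = + ∣ A ∣
  #B = + ∣ B ∣
  expand : ∀ i a b p q p′ q′ →
    i ℤ.+ q′ ℤ.* a ℤ.- q ℤ.* b ℤ.+ p′ ℤ.* (q ℤ.+ a) ℤ.- p ℤ.* (q′ ℤ.+ b) ≡
    i ℤ.+ (q′ ℤ.+ p′) ℤ.* a ℤ.- (q ℤ.+ p) ℤ.* b ℤ.+ (p′ ℤ.* q ℤ.- p ℤ.* q′)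
  expand = solve-∀
  union : ∀ p q → p ∧ q ≡ false → [ q ]ᵇ ℤ.+ [ p ]ᵇ ≡ [ q ∨ p ]ᵇ
  union true  false _ = refl
  union false true  _ = refl
  union false false _ = refl
  product : ∀ p q → p ∧ q ≡ false → [ p ]ᵇ ℤ.* [ q ]ᵇ ≡ 0ℤ
  product true  false _ = refl
  product false true  _ = refl
  product false false _ = refl

∣∣-merge : ∀ p q (A : Subset n) → p ∧ q ≡ false → ∣ p ∷ q ∷ A ∣ ≡ ∣ (q ∨ p) ∷ A ∣
∣∣-merge true  false A _ = refl
∣∣-merge false true  A _ = refl
∣∣-merge false false A _ = refl

colors : ∀ (T : List (List (Subset n))) → Fin n → Subset (length T)
colors T x = Vec.tabulate {n = length T} λ i → Vec.lookup (⋃ (row T i)) x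

-- By `inv-∷` a further row interacts with the rest through the sizes of the colour sets, so these
-- must be carried along in the induction. Equality of the sets themselves makes no sense, as the
-- numbers of rows differ.
record SameInv (r l : Fin n) (T T′ : List (List (Subset n))) : Set where
  constructor same
  field
    same-inv : inv (colors T r) (colors T l) ≡ inv (colors T′ r) (colors T′ l)
    size-r   : ∣ colors T r ∣ ≡ ∣ colors T′ r ∣
    size-l   : ∣ colors T l ∣ ≡ ∣ colors T′ l ∣

open SameInv

sameInv-∷ : ∀ {r l : Fin n} {T T′} R → SameInv r l T T′ → SameInv r l (R ∷ T) (R ∷ T′)
sameInv-∷ {r = r} {l} {T} {T′} R s = record
  { same-inv = begin
      inv (ρ ∷ colors T r) (λ′ ∷ colors T l)
        ≡⟨ inv-∷ ρ λ′ (colors T r) (colors T l) ⟩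
      inv (colors T r) (colors T l) ℤ.+ [ λ′ ]ᵇ ℤ.* + ∣ colors T r ∣ ℤ.- [ ρ ]ᵇ ℤ.* + ∣ colors T l ∣
        ≡⟨ cong₂ ℤ._-_ (cong₂ ℤ._+_ (same-inv s) (cong (λ m → [ λ′ ]ᵇ ℤ.* + m) (size-r s)))
                       (cong (λ m → [ ρ ]ᵇ ℤ.* + m) (size-l s)) ⟩
      inv (colors T′ r) (colors T′ l) ℤ.+ [ λ′ ]ᵇ ℤ.* + ∣ colors T′ r ∣ ℤ.- [ ρ ]ᵇ ℤ.* + ∣ colors T′ l ∣
        ≡⟨ inv-∷ ρ λ′ (colors T′ r) (colors T′ l) ⟨
      inv (ρ ∷ colors T′ r) (λ′ ∷ colors T′ l) ∎
  ; size-r = size ρ (colors T r) (colors T′ r) (size-r s)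
  ; size-l = size λ′ (colors T l) (colors T′ l) (size-l s) }
  where
  open ≡-Reasoning
  ρ  = Vec.lookup (⋃ R) r
  λ′ = Vec.lookup (⋃ R) l
  size : ∀ {m n} b (A : Subset m) (B : Subset n) → ∣ A ∣ ≡ ∣ B ∣ → ∣ b ∷ A ∣ ≡ ∣ b ∷ B ∣
  size true  A B = cong suc
  size false A B = id

sameInv-trans : ∀ {r l : Fin n} {T T′ T″} → SameInv r l T T′ → SameInv r l T′ T″ → SameInv r l T T″
sameInv-trans (same i r l) (same i′ r′ l′) = same (trans i i′) (trans r r′) (trans l l′)

∉-∧ : ∀ {p q : Subset n} {x y} → ¬ (x ∈ p × y ∈ q) → Vec.lookup p x ∧ Vec.lookup q y ≡ false
∉-∧ {p = p} {q} {x} {y} ¬both with Vec.lookup p x in eqp | Vec.lookup q y in eqq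
... | true  | true  = ⊥-elim (¬both (Vec.lookup⇒[]= x p eqp , Vec.lookup⇒[]= y q eqq))
... | true  | false = refl
... | false | true  = refl
... | false | false = refl

sameInv-merge : ∀ {r l : Fin n} {L P} U → (∀ {x y} → x ∈ₗ r ∷ l ∷ [] → y ∈ₗ r ∷ l ∷ [] → ¬ (x ∈ ⋃ P × y ∈ L)) →
  SameInv r l ((L ∷ P) ∷ U) (P ∷ (L ∷ []) ∷ U)
sameInv-merge {r = r} {l} {L} {P} U apart = record
  { same-inv = trans
      (cong₂ (λ a b → inv (a ∷ colors U r) (b ∷ colors U l)) (∨-lookup r) (∨-lookup l))
      (sym (inv-merge (p r) (q r) (p l) (q l) (colors U r) (colors U l)
        (∉-∧′ (here refl) (here refl)) (∉-∧′ (there (here refl)) (there (here refl)))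
        (∉-∧′ (here refl) (there (here refl))) (∉-∧′ (there (here refl)) (here refl))))
  ; size-r = size (here refl)
  ; size-l = size (there (here refl)) }
  where
  p q : Fin _ → Bool
  p = Vec.lookup (⋃ P)
  q = Vec.lookup (⋃ (L ∷ []))
  q≡ : ∀ x → q x ≡ Vec.lookup L x
  q≡ x = cong (λ A → Vec.lookup A x) (Subset.∪-identityʳ L)
  ∨-lookup : ∀ x → Vec.lookup (⋃ (L ∷ P)) x ≡ q x ∨ p x
  ∨-lookup x = trans (Vec.lookup-zipWith _∨_ x L (⋃ P)) (cong (_∨ p x) (sym (q≡ x)))
  ∉-∧′ : ∀ {x y} → x ∈ₗ r ∷ l ∷ [] → y ∈ₗ r ∷ l ∷ [] → p x ∧ q y ≡ false
  ∉-∧′ {x} {y} x∈ y∈ = trans (cong (p x ∧_) (q≡ y)) (∉-∧ {p = ⋃ P} {L} (apart x∈ y∈))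
  size : ∀ {x} → x ∈ₗ r ∷ l ∷ [] → ∣ colors ((L ∷ P) ∷ U) x ∣ ≡ ∣ colors (P ∷ (L ∷ []) ∷ U) x ∣
  size {x} x∈ = trans (cong (λ a → ∣ a ∷ colors U x ∣) (∨-lookup x))
    (sym (∣∣-merge (p x) (q x) (colors U x) (∉-∧′ x∈ x∈)))

-- Arrays of hook shape

⊥─p≡⊥ : ∀ (p : Subset n) → Subset.⊥ ─ p ≡ Subset.⊥
⊥─p≡⊥ p = Subset.⊆-antisym (Subset.p─q⊆p Subset.⊥ p) (λ x∈ → ⊥-elim (Subset.∉⊥ x∈))

p─p≡⊥ : ∀ (p : Subset n) → p ─ p ≡ Subset.⊥
p─p≡⊥ p = Subset.Empty-unique λ (x , x∈) → x∈p─q⇒x∉q p p x∈ (Subset.p─q⊆p p p x∈)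

module _ (w : Web) where
  open Web w

  private
    linkedₗ? : ∀ R → Dec (Linked (_≺_ w) R)
    linkedₗ? = linked? (_≺?_ w)

  -- An uncut gap joins `x` to the row `P`. A loop through either incoming arc of the merge also
  -- contains its outgoing arc, so the disjoint loops `x` and those of `P` cannot both pass through
  -- it, and `sameInv-merge` applies.
  sameInv-rows : ∀ {l r e} → merge l r e ∈ₗ junctions → ∀ P (b : Vec Bool j) v →
    All (IsLoop w) (P ++ toList v) → All (Linked (_≺_ w)) (rows P b v) →
    SameInv r l (rows P b v) (singletons P v)
  sameInv-rows j∈ P []          []      _     _        = same refl refl refl
  sameInv-rows j∈ P (true ∷ b)  (x ∷ v) loops (_ ∷ ls) =
    sameInv-∷ P (sameInv-rows j∈ (x ∷ []) b v (All.++⁻ʳ P loops) ls)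
  sameInv-rows {l = l} {r} {e} j∈ P (false ∷ b) (x ∷ v) loops ls = sameInv-trans
    (sameInv-rows j∈ (x ∷ P) b v loops′ ls)
    (sameInv-merge (map (_∷ []) (toList v)) apart)
    where
    loops′ : All (IsLoop w) (x ∷ P ++ toList v)
    loops′ = ↭.All-resp-↭ (↭.shift x P (toList v)) loops
    P-sorted : AllPairs (_≺_ w) (x ∷ P)
    P-sorted = linked⇒sorted w (All.++⁻ˡ (x ∷ P) loops′) (linked-first (x ∷ P) b v ls)
    end : ∀ {y} → y ∈ₗ r ∷ l ∷ [] → y ∈ₗ l ∷ r ∷ e ∷ []
    end (here refl)         = there (here refl)
    end (there (here refl)) = here refl
    apart : ∀ {y z} → y ∈ₗ r ∷ l ∷ [] → z ∈ₗ r ∷ l ∷ [] → ¬ (y ∈ ⋃ P × z ∈ x)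
    apart y∈j z∈j (y∈ , z∈x) with find (∈-⋃⁻ P y∈)
    ... | L , L∈ , y∈L = ≺-disjoint w (All.lookup (AllPairs.head P-sorted) L∈)
      (hub-∈ w (merge l r e) (loop-simple w (All.head loops′) j∈) (end z∈j) z∈x)
      (hub-∈ w (merge l r e) (loop-simple w (All.lookup (All.++⁻ˡ P (All.tail loops′)) L∈) j∈) (end y∈j) y∈L)

  invT-rows : ∀ P (b : Vec Bool j) v →
    All (IsLoop w) (P ++ toList v) → All (Linked (_≺_ w)) (rows P b v) →
    invT w (rows P b v) ≡ invT w (singletons P v)
  invT-rows P b v loops ls = begin
    invT w (rows P b v)
      ≡⟨ invT≡inv-w w (rows P b v) refl ⟩
    ∑ junctions (invAt w c)
      ≡⟨ ∑-cong junctions (λ {j} → at j) ⟩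
    ∑ junctions (invAt w c′)
      ≡⟨ invT≡inv-w w (singletons P v) refl ⟨
    invT w (singletons P v) ∎
    where
    open ≡-Reasoning
    c  = coloringOf w (length (rows P b v)) (rows P b v)
    c′ = coloringOf w (length (singletons P v)) (singletons P v)
    at : ∀ j → j ∈ₗ junctions → invAt w c j ≡ invAt w c′ j
    at (merge l r e) j∈ = begin
      inv (Vec.lookup c r) (Vec.lookup c l)
        ≡⟨ cong₂ inv (Vec.lookup∘tabulate (colors (rows P b v)) r)
                     (Vec.lookup∘tabulate (colors (rows P b v)) l) ⟩
      inv (colors (rows P b v) r) (colors (rows P b v) l)
        ≡⟨ SameInv.same-inv (sameInv-rows j∈ P b v loops ls) ⟩
      inv (colors (singletons P v) r) (colors (singletons P v) l)
        ≡⟨ cong₂ inv (Vec.lookup∘tabulate (colors (singletons P v)) r)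
                     (Vec.lookup∘tabulate (colors (singletons P v)) l) ⟨
      inv (Vec.lookup c′ r) (Vec.lookup c′ l) ∎
    at (split e l r) _ = refl
    at (glue e e′)   _ = refl

  -- The part of `IsArray` that depends only on the multiset of loops; the order within rows is
  -- split off.
  IsDecomposition : List (Subset arcs) → Set
  IsDecomposition Ls = All (IsLoop w) Ls × (∀ e → length (filter (e ∈?_) Ls) ≡ thickness e)

  isDecomposition? : ∀ Ls → Dec (IsDecomposition Ls)
  isDecomposition? Ls = all? (isLoop? w) Ls ×-dec Fin.all? λ e → length (filter (e ∈?_) Ls) ℕ.≟ thickness e

  decomposition-↭ : ∀ {Ls Ls′} → Ls ↭ Ls′ → IsDecomposition Ls → IsDecomposition Ls′
  decomposition-↭ p (loops , thick) =
    ↭.All-resp-↭ p loops , λ e → trans (sym (↭.↭-length (↭.filter-↭ (e ∈?_) p))) (thick e)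

  isArray⇔ : ∀ {T} → IsArray w T ⇔ (All (Linked (_≺_ w)) T × IsDecomposition (concat T))
  isArray⇔ = mk⇔ (λ (loops , thick , ls) → ls , All.concat⁺ loops , thick)
                 (λ (ls , loops , thick) → All.concat⁻ loops , thick , ls)

  weight : ℤ → Array w → ℤ
  weight d T = coeff (q^ invT w T) d

  -- On the right the weight is that of the fully cut word, hence independent of `b`. The row order
  -- and the loop conditions that `invT-rows` asks for are supplied by the two indicators in front.
  array-rows : ∀ d P (b : Vec Bool j) v →
    [ isArray? w (rows P b v) ]? ℤ.* weight d (rows P b v) ≡
    [ all? linkedₗ? (rows P b v) ]? ℤ.* ([ isDecomposition? (P ++ toList v) ]? ℤ.* weight d (singletons P v))
  array-rows d P b v = begin
    [ isArray? w T ]? ℤ.* weight d T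
      ≡⟨ cong (ℤ._* weight d T) (trans
           ([]?-cong (isArray? w T) (linkedT? ×-dec decomposition?) (mk⇔
             (map₂ (decomposition-↭ (concat-rows P b v)) ∘ Equivalence.to isArray⇔)
             (Equivalence.from isArray⇔ ∘ map₂ (decomposition-↭ (↭-sym (concat-rows P b v))))))
           ([]?-× linkedT? decomposition?)) ⟩
    [ linkedT? ]? ℤ.* [ decomposition? ]? ℤ.* weight d T
      ≡⟨ ℤ.*-assoc [ linkedT? ]? _ _ ⟩
    [ linkedT? ]? ℤ.* ([ decomposition? ]? ℤ.* weight d T)
      ≡⟨ []?-*-cong linkedT? (λ ls → []?-*-cong decomposition? λ (loops , _) →
           cong (λ z → coeff (q^ z) d) (invT-rows P b v loops ls)) ⟩
    [ linkedT? ]? ℤ.* ([ decomposition? ]? ℤ.* weight d (singletons P v)) ∎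
    where
    open ≡-Reasoning
    T = rows P b v
    linkedT? = all? linkedₗ? T
    decomposition? = isDecomposition? (P ++ toList v)

  module _ {P : List (Subset arcs)} (loops : All (IsLoop w) P) (linked : Linked (_≺_ w) P) where

    private
      P-sorted = linked⇒sorted w loops linked
      ∅ = Subset.⊥ {arcs}

    -- With `B` empty every arc of `C` points downward, so the winding number is minus the number of
    -- crossings of the cut, and a loop does cross it. Hence all components are swapped.
    winding-∅ : ∀ {C} → IsLoop w C → winding w ∅ C ≢ 0ℤ
    winding-∅ {C} loop eq = nonzero _ meets-cut (trans (sym (ℤ.+-identityˡ _))
      (trans (cong (λ m → + m ℤ.- + length (filter (_∈? (C ─ ∅)) bottom)) (sym none)) eq))
      where
      none : length (filter (_∈? (C ∩ ∅)) bottom) ≡ 0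
      none = cong length (List.filter-none (_∈? (C ∩ ∅)) {xs = bottom}
        (All.tabulate λ _ x∈ → Subset.∉⊥ (proj₂ (Subset.x∈p∩q⁻ C ∅ x∈))))
      bottom∈ : ∀ {es es′} (ss : Star (Slice thickness) es es′) → es ∈ₗ words ss
      bottom∈ ε        = here refl
      bottom∈ (s ◅ ss) = here refl
      meets-cut : 0 < length (filter (_∈? (C ─ ∅)) bottom)
      meets-cut with loop-meets-word w loop (bottom∈ slices)
      ... | i , i∈ = List.filter-some (_∈? (C ─ ∅)) (lose (∈ₗ.∈-lookup {xs = bottom} i)
        (subst (lookup bottom i ∈_) (sym (Subset.p─⊥≡p C)) i∈))
      nonzero : ∀ m → 0 < m → ℤ.- (+ m) ≢ 0ℤ
      nonzero (suc m) _ ()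

    Γ*-∅ : Γ* w (⋃ P) ∅ ≡ ⋃ P
    Γ*-∅ = begin
      ⋃ (filter essential? (components w ((⋃ P ─ ∅) ∪ (∅ ─ ⋃ P))))
        ≡⟨ cong (λ S → ⋃ (filter essential? (components w S)))
             (trans (cong₂ _∪_ (Subset.p─⊥≡p (⋃ P)) (⊥─p≡⊥ (⋃ P))) (Subset.∪-identityʳ (⋃ P))) ⟩
      ⋃ (filter essential? (components w (⋃ P)))
        ≡⟨ cong ⋃ (List.filter-all essential? (All.map winding-∅ (↭.All-resp-↭ (↭-sym perm) loops))) ⟩
      ⋃ (components w (⋃ P))
        ≡⟨ Subset.⊆-antisym (∈-⋃⁺ ∘ ↭.Any-resp-↭ perm ∘ ∈-⋃⁻ _) (∈-⋃⁺ ∘ ↭.Any-resp-↭ (↭-sym perm) ∘ ∈-⋃⁻ P) ⟩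
      ⋃ P ∎
      where
      open ≡-Reasoning
      essential? = λ C → ¬? (winding w ∅ C ℤ.≟ 0ℤ)
      perm = components-⋃ w loops P-sorted

    swapped-∅ : swapped w (⋃ P) ∅ ≡ ∅
    swapped-∅ = begin
      (⋃ P ─ Γ* w (⋃ P) ∅) ∪ (∅ ∩ Γ* w (⋃ P) ∅)
        ≡⟨ cong₂ _∪_ (trans (cong (⋃ P ─_) Γ*-∅) (p─p≡⊥ (⋃ P))) (Subset.∩-zeroˡ _) ⟩
      ∅ ∪ ∅
        ≡⟨ Subset.∪-identityʳ ∅ ⟩
      ∅ ∎
      where open ≡-Reasoning

    swapped′-∅ : swapped′ w (⋃ P) ∅ ≡ ⋃ P
    swapped′-∅ = begin
      (∅ ─ Γ* w (⋃ P) ∅) ∪ (⋃ P ∩ Γ* w (⋃ P) ∅)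
        ≡⟨ cong₂ _∪_ (⊥─p≡⊥ _) (trans (cong (⋃ P ∩_) Γ*-∅) (Subset.∩-idem (⋃ P))) ⟩
      ∅ ∪ ⋃ P
        ≡⟨ Subset.∪-identityˡ (⋃ P) ⟩
      ⋃ P ∎
      where open ≡-Reasoning

    components-∅ : components w ∅ ≡ []
    components-∅ with components w ∅ in eq
    ... | []    = refl
    ... | C ∷ _ = let e , e∈ , _ = ∈-components⁻ w ∅ (subst (C ∈ₗ_) (sym eq) (here refl))
                  in ⊥-elim (Subset.∉⊥ e∈)

    -- At a cell (i , 1) with a row of length one, B is empty, so the whole row
    -- above moves behind the single loop.
    SW-singleton : ∀ L U → SW w 0 0 (P ∷ (L ∷ []) ∷ U) ≡ [] ∷ (L ∷ P) ∷ U
    SW-singleton L U = cong₂ (λ R R′ → R ∷ (L ∷ R′) ∷ U)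
      (cong (≺-sort w) (trans (cong (components w) swapped-∅) components-∅))
      (trans (cong (strands w) swapped′-∅) (sort-components-⋃ w loops P-sorted))

  -- On arrays of hook shape `SW` only permutes the loops, so the result is still a decomposition,
  -- and only the order within rows can keep it from being an array.
  concat-SW : ∀ P (v : Vec (Subset arcs) j) → All (IsLoop w) (P ++ toList v) → Linked (_≺_ w) P →
    ∀ {ij} → ij ∈ₗ admissible w (singletons P v) →
    concat (uncurry (SW w) ij (singletons P v)) ↭ concat (singletons P v)
  -- The second row has one loop, and `1 ⊓ suc (length P)` is 1, so its first cell is the only
  -- admissible one.
  concat-SW P (x ∷ v) loops linked {ij} ij∈ with ∈ₗ.∈-++⁻ (map (0 ,_) (upTo 1)) ij∈
  ... | inj₁ (here refl) = subst (λ T → concat T ↭ concat (singletons P (x ∷ v)))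
    (sym (SW-singleton (All.++⁻ˡ P loops) linked x (map (_∷ []) (toList v))))
    (↭-sym (↭.shift x P (concat (map (_∷ []) (toList v)))))
  ... | inj₂ ij∈′ with ∈ₗ.∈-map⁻ (map₁ suc) ij∈′
  ...   | ij′ , ij′∈ , refl = ↭.++⁺ˡ P (concat-SW (x ∷ []) v (All.++⁻ʳ P loops) [-] ij′∈)

  -- At the cell of `x` the rows `P` and `x ∷ []` become the empty row and `x ∷ P`, while all other
  -- rows stay. So the order survives exactly when `x` may join `P`; the lower cells are treated in
  -- the same way with `x ∷ []` as the row above.
  noRise⇔notInvertible : ∀ P (v : Vec (Subset arcs) j) → All (IsLoop w) (P ++ toList v) → Linked (_≺_ w) P →
    NoRise (_≺?_ w) P v ⇔
    (¬ Any (λ ij → All (Linked (_≺_ w)) (uncurry (SW w) ij (singletons P v))) (admissible w (singletons P v)))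
  noRise⇔notInvertible P []      loops linked = mk⇔ (λ _ ()) (λ _ → tt)
  noRise⇔notInvertible P (x ∷ v) loops linked = mk⇔ to from
    where
    T = singletons P (x ∷ v)
    Linkedˢ : ℕ × ℕ → Set
    Linkedˢ ij = All (Linked (_≺_ w)) (uncurry (SW w) ij T)
    SW₀ = SW-singleton (All.++⁻ˡ P loops) linked x (map (_∷ []) (toList v))
    rec = noRise⇔notInvertible (x ∷ []) v (All.++⁻ʳ P loops) [-]
    singles-linked : ∀ vs → All (Linked (_≺_ w)) (map (_∷ []) vs)
    singles-linked []       = []
    singles-linked (_ ∷ vs) = [-] ∷ singles-linked vs
    to : NoRise (_≺?_ w) P (x ∷ v) → ¬ Any Linkedˢ (admissible w T)
    to (n , ns) any with AnyP.++⁻ (map (0 ,_) (upTo 1)) any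
    ... | inj₁ (here ls) = case subst (All (Linked (_≺_ w))) SW₀ ls of λ { (_ ∷ l ∷ _) → n l }
    ... | inj₂ any′      = Equivalence.to rec ns (Any.map All.tail (AnyP.map⁻ any′))
    from : ¬ Any Linkedˢ (admissible w T) → NoRise (_≺?_ w) P (x ∷ v)
    from ¬any =
      (λ l → ¬any (here (subst (All (Linked (_≺_ w))) (sym SW₀) ([] ∷ l ∷ singles-linked (toList v))))) ,
      Equivalence.from rec λ any → ¬any (there (AnyP.map⁺ (Any.map (linked ∷_) any)))

  isTableau⇔ : ∀ P (v : Vec (Subset arcs) j) → IsTableau w (singletons P v) ⇔
    ((Linked (_≺_ w) P × NoRise (_≺?_ w) P v) × IsDecomposition (P ++ toList v))
  isTableau⇔ P v = mk⇔ to from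
    where
    T = singletons P v
    concat≡ = concat-singletons P v
    invertible⇔ : Linked (_≺_ w) P → IsDecomposition (P ++ toList v) →
      Invertible w T ⇔ Any (λ ij → All (Linked (_≺_ w)) (uncurry (SW w) ij T)) (admissible w T)
    invertible⇔ linked decomposition = mk⇔
      (Any.map (proj₁ ∘ Equivalence.to isArray⇔))
      (λ any → let ij , ij∈ , ls = find any in lose ij∈ (Equivalence.from isArray⇔
        (ls , decomposition-↭ (↭-sym (concat-SW P v (proj₁ decomposition) linked ij∈))
                              (subst IsDecomposition (sym concat≡) decomposition))))
    to : IsTableau w T → _
    to (array , ¬invertible) with Equivalence.to isArray⇔ array
    ... | linked ∷ _ , decomposition =
      (linked , Equivalence.from (noRise⇔notInvertible P v (proj₁ dec) linked)
                  (¬invertible ∘ Equivalence.from (invertible⇔ linked dec))) , dec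
      where dec = subst IsDecomposition concat≡ decomposition
    from : _ → IsTableau w T
    from ((linked , noRise) , dec) =
      Equivalence.from isArray⇔ (linked ∷ All.map⁺ (All.tabulate λ _ → [-]) ,
        subst IsDecomposition (sym concat≡) dec) ,
      Equivalence.to (noRise⇔notInvertible P v (proj₁ dec) linked) noRise ∘ Equivalence.to (invertible⇔ linked dec)

  alternating-X : ∀ k j d → ∑ (vecs bools j) (λ b → sign b ℤ.* coeff (X w (shape k b)) d) ≡
    coeff (Σ[ tableaux w (k ∷ replicate j 1) ] λ T → q^ invT w T) d
  alternating-X k j d = begin
    ∑ (vecs bools j) (λ b → sign b ℤ.* coeff (X w (shape k b)) d)
      ≡⟨ ∑-cong′ (vecs bools j) (λ b → cong₂ ℤ._*_ (refl {x = sign b}) (coeff-X w (shape k b) d)) ⟩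
    ∑ (vecs bools j) (λ b → sign b ℤ.* ∑ (fillings xs (shape k b)) λ T → [ isArray? w T ]? ℤ.* weight d T)
      ≡⟨ alternating-fillings (_≺?_ w) xs k j _ _ (array-rows d) ⟩
    (∑ (vecs xs k) λ P → ∑ (vecs xs j) λ v → [ good? (toList P) v ]? ℤ.*
      ([ isDecomposition? (toList P ++ toList v) ]? ℤ.* weight d (singletons (toList P) v)))
      ≡⟨ ∑-cong′ (vecs xs k) (λ P → ∑-cong′ (vecs xs j) λ v → term (toList P) v) ⟩
    (∑ (vecs xs k) λ P → ∑ (vecs xs j) λ v →
      [ isTableau? w (singletons (toList P) v) ]? ℤ.* weight d (singletons (toList P) v))
      ≡⟨ ∑-fillings-hook xs k j _ ⟨
    (∑ (fillings xs (k ∷ replicate j 1)) λ T → [ isTableau? w T ]? ℤ.* weight d T)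
      ≡⟨ ∑-filter (isTableau? w) (fillings xs (k ∷ replicate j 1)) (weight d) ⟨
    ∑ (tableaux w (k ∷ replicate j 1)) (weight d)
      ≡⟨ coeff-Σ (tableaux w (k ∷ replicate j 1)) _ d ⟨
    coeff (Σ[ tableaux w (k ∷ replicate j 1) ] λ T → q^ invT w T) d ∎
    where
    open ≡-Reasoning
    xs = subsets arcs
    good? : ∀ P (v : Vec (Subset arcs) j) → Dec (Linked (_≺_ w) P × NoRise (_≺?_ w) P v)
    good? P v = linkedₗ? P ×-dec noRise? (_≺?_ w) P v
    term : ∀ P v → [ good? P v ]? ℤ.* ([ isDecomposition? (P ++ toList v) ]? ℤ.* weight d (singletons P v)) ≡
                   [ isTableau? w (singletons P v) ]? ℤ.* weight d (singletons P v)
    term P v = trans (sym (ℤ.*-assoc [ good? P v ]? _ _)) (cong (ℤ._* weight d (singletons P v))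
      (trans (sym ([]?-× (good? P v) (isDecomposition? (P ++ toList v))))
             (sym ([]?-cong (isTableau? w (singletons P v)) (good? P v ×-dec isDecomposition? (P ++ toList v))
                            (isTableau⇔ P v)))))

theorem2 : (w : Web) (a : List ℕ → Laurent) →
    IsSchurExpansion (Web.degree w) (X w) a →
    ∀ k → 1 ≤ k → k ≤ Web.degree w →
    (a (hook k (Web.degree w)) ≈ Σ[ tableaux w (hook k (Web.degree w)) ] (λ T → q^ (invT w T))) ×
    (∀ d → 0ℤ ≤ℤ coeff (a (hook k (Web.degree w))) d)
theorem2 w a expansion (suc k) _ k≤n = expand , λ d → subst (0ℤ ≤ℤ_) (sym (expand d)) (subst (0ℤ ≤ℤ_)
  (sym (coeff-Σ (tableaux w (hook (suc k) (Web.degree w))) _ d))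
  (∑-≥0 (tableaux w (hook (suc k) (Web.degree w))) λ T → coeff-q^-≥0 (invT w T) d))
  where
  expand : a (hook (suc k) (Web.degree w)) ≈ Σ[ tableaux w (hook (suc k) (Web.degree w)) ] (λ T → q^ (invT w T))
  -- Both lemmas evaluate the same alternating sum of coefficients of `X w`, where the number of
  -- boxes below the first row is the degree minus `suc k`.
  expand d = trans (hook-coefficient {f = X w} expansion k (Web.degree w ℕ.∸ suc k) (ℕ.m+[n∸m]≡n k≤n) d)
                   (alternating-X w (suc k) (Web.degree w ℕ.∸ suc k) d)
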